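{- Let $G=(V,E)$ be a multigraph with $m$ edges (loops counted). Let $\mathcal P$ be the poset, ordered by inclusion, of all subsets $H\subseteq E$ such that the graph $(V,H)$ has no bridge (equivalently, $H$ is a union of cycles of $G$; $\emptyset\in\mathcal P$), and let $\mu(H)=\mu_{\mathcal P}(\emptyset,H)$ be its Möbius function. Then $$h^\ast(\mathcal C_G;z)=\sum_{H\in\mathcal P}\mu(H)\,(2z)^{|H|}(1+3z)^{m-|H|}.$$
   Context: For a finite undirected multigraph $G=(V,E)$ (loops, parallel edges and isolated nodes allowed) with $n=|V|$, $m=|E|$, work in $\mathbb{R}^V\times\mathbb{R}^E\cong\mathbb{R}^{n+m}$ with standard basis vectors $e_u$, $e_f$. For each edge $f$ with endpoints $u,v$ ($u=v$ for a loop) set $\widetilde e_f=e_u+e_v-e_f$, $\overleftarrow e_f=e_u-e_v+e_f$, $\overrightarrow e_f=-e_u+e_v+e_f$. The cosmological polytope $\mathcal C_G$ is the convex hull of $\{e_f,\widetilde e_f,\overleftarrow e_f,\overrightarrow e_f: f\in E\}\cup\{e_u: u\in V\}$, a lattice polytope of dimension $n+m-1$. For a $d$-dimensional lattice polytope $P\subseteq\mathbb{R}^N$, the $h^\ast$-polynomial is defined by $\sum_{j\ge0}|jP\cap\mathbb{Z}^N|z^j=h^\ast(P;z)/(1-z)^{d+1}$. The Möbius function of a finite poset is the unique $\mu$ with $\mu(s,s)=1$, $\mu(s,t)=0$ unless $s\le t$, and $\sum_{s\le r\le t}\mu(s,r)=0$ for $s<t$.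
   Formalization: The polytope, its dilates and its dimension are taken in rational rather than real space (convex combinations with rational coefficients); for a hull of finitely many lattice points this leaves the lattice points of the dilates and the dimension unchanged. -}

module Defs where

open import Data.Fin.Base using (Fin; _↑ˡ_; _↑ʳ_)
import Data.Fin.Properties as Fin
open import Data.Fin.Subset as Sub using (Subset; _-_; inside; outside)
import Data.Fin.Subset.Properties as Sub
open import Data.Integer.Base as ℤ using (ℤ; +_; 0ℤ; 1ℤ)
open import Data.List.Base as List using (List; []; _∷_; _++_; filter; upTo; allFin)
open import Data.List.Membership.Propositional as List using ()
open import Data.List.Membership.Propositional.Properties
  using (∈-filter⁺; ∈-filter⁻; ∈-map⁺; ∈-map⁻; ∈-allFin)
open import Data.List.Relation.Unary.Any using (here; there)
open import Data.List.Relation.Unary.Unique.Propositional using (Unique)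
open import Data.Nat.Base as ℕ using (ℕ; zero; suc; _∸_)
open import Data.Product.Base using (Σ-syntax; ∃-syntax; _×_; _,_; proj₁; proj₂)
open import Data.Rational.Base as ℚ using (ℚ; 0ℚ; 1ℚ)
open import Data.Sum.Base using (_⊎_; inj₁; inj₂)
open import Data.Vec.Base as Vec using (Vec; zipWith; replicate; _[_]≔_)
open import Data.Vec.Relation.Unary.All using (All)
open import Function.Bundles using (_⇔_)
open import Level using (0ℓ)
open import Relation.Binary.Core using (Rel)
open import Relation.Binary.Definitions using (Decidable)
open import Relation.Binary.Structures using (IsEquivalence)
open import Relation.Binary.PropositionalEquality using (_≡_; _≢_; refl; sym)
open import Relation.Binary.Construct.Closure.Equivalence as Eq using (EqClosure)
open import Relation.Nullary using (¬_)
open import Relation.Nullary.Decidable using (map′; ¬?; _×-dec_; _⊎-dec_)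
open import Relation.Unary as Pred using (Pred)

-- V = Fin n and E = Fin m.  The ends of an edge are stored in some order,
-- but connectivity, bridges and the cosmological polytope do not depend on it.
record Multigraph (n m : ℕ) : Set where
  field
    ends : Fin m → Fin n × Fin n

  src tgt : Fin m → Fin n
  src f = proj₁ (ends f)
  tgt f = proj₂ (ends f)

open Multigraph public

module _ {n m : ℕ} (G : Multigraph n m) where

  -- Adjacency via an edge of H, in the stored order only; Connected
  -- symmetrises it.
  Adjacent : Subset m → Rel (Fin n) 0ℓ
  Adjacent H u v = ∃[ f ] (f Sub.∈ H × ends G f ≡ (u , v))

  Connected : Subset m → Rel (Fin n) 0ℓ
  Connected H = EqClosure (Adjacent H)

  -- A bridge is an edge that separates its ends.
  IsBridge : Subset m → Fin m → Set
  IsBridge H f = f Sub.∈ H × ¬ Connected (H - f) (src G f) (tgt G f)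

  Bridgeless : Subset m → Set
  Bridgeless H = ∀ f → ¬ IsBridge H f

private
  module _ {n : ℕ} where

    Via : List (Fin n × Fin n) → Rel (Fin n) 0ℓ
    Via es u v = (u , v) List.∈ es

    module _ (a b : Fin n) (es : List (Fin n × Fin n)) where

      _~_ : Rel (Fin n) 0ℓ
      _~_ = EqClosure (Via es)

      open IsEquivalence (Eq.isEquivalence (Via es)) public
        renaming (refl to ~refl; sym to ~sym; trans to ~trans)
        using ()

      _≈_ : Rel (Fin n) 0ℓ
      u ≈ v = u ~ v ⊎ (u ~ a × b ~ v) ⊎ (u ~ b × a ~ v)

      ≈-isEquivalence : IsEquivalence _≈_
      ≈-isEquivalence = record { refl = inj₁ ~refl ; sym = s ; trans = t }
        where
        s : ∀ {u v} → u ≈ v → v ≈ u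
        s (inj₁ p)              = inj₁ (~sym p)
        s (inj₂ (inj₁ (p , q))) = inj₂ (inj₂ (~sym q , ~sym p))
        s (inj₂ (inj₂ (p , q))) = inj₂ (inj₁ (~sym q , ~sym p))

        t : ∀ {u v w} → u ≈ v → v ≈ w → u ≈ w
        t (inj₁ p) (inj₁ q)                            = inj₁ (~trans p q)
        t (inj₁ p) (inj₂ (inj₁ (q , r)))               = inj₂ (inj₁ (~trans p q , r))
        t (inj₁ p) (inj₂ (inj₂ (q , r)))               = inj₂ (inj₂ (~trans p q , r))
        t (inj₂ (inj₁ (p , q))) (inj₁ r)               = inj₂ (inj₁ (p , ~trans q r))
        t (inj₂ (inj₂ (p , q))) (inj₁ r)               = inj₂ (inj₂ (p , ~trans q r))
        t (inj₂ (inj₁ (p , q))) (inj₂ (inj₁ (r , x)))  = inj₂ (inj₁ (p , x))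
        t (inj₂ (inj₁ (p , q))) (inj₂ (inj₂ (r , x)))  = inj₁ (~trans p x)
        t (inj₂ (inj₂ (p , q))) (inj₂ (inj₁ (r , x)))  = inj₁ (~trans p x)
        t (inj₂ (inj₂ (p , q))) (inj₂ (inj₂ (r , x)))  = inj₂ (inj₂ (p , x))

      to : ∀ {u v} → u ≈ v → EqClosure (Via ((a , b) ∷ es)) u v
      to p = go p
        where
        open IsEquivalence (Eq.isEquivalence (Via ((a , b) ∷ es)))
          using () renaming (trans to _⨾_; sym to inv)
        lift : ∀ {u v} → u ~ v → EqClosure (Via ((a , b) ∷ es)) u v
        lift = Eq.map there
        step : EqClosure (Via ((a , b) ∷ es)) a b
        step = Eq.return (here refl)
        go : ∀ {u v} → u ≈ v → EqClosure (Via ((a , b) ∷ es)) u v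
        go (inj₁ q)              = lift q
        go (inj₂ (inj₁ (q , r))) = lift q ⨾ (step ⨾ lift r)
        go (inj₂ (inj₂ (q , r))) = lift q ⨾ (inv step ⨾ lift r)

      from : ∀ {u v} → EqClosure (Via ((a , b) ∷ es)) u v → u ≈ v
      from = Eq.fold ≈-isEquivalence λ where
        (here refl) → inj₂ (inj₁ (~refl , ~refl))
        (there e)   → inj₁ (Eq.return e)

    via? : ∀ es → Decidable (EqClosure (Via es))
    via? [] u v = map′ (λ where refl → IsEquivalence.refl (Eq.isEquivalence (Via [])))
                       (Eq.fold isEquivalence λ ())
                       (u Fin.≟ v)
      where open import Relation.Binary.PropositionalEquality.Properties using (isEquivalence)
    via? ((a , b) ∷ es) u v = map′ (to a b es) (from a b es)
      (via? es u v ⊎-dec (via? es u a ×-dec via? es b v)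
                   ⊎-dec (via? es u b ×-dec via? es a v))

module _ {n m : ℕ} (G : Multigraph n m) where

  connected? : ∀ H → Decidable (Connected G H)
  connected? H u v = map′ (Eq.map to′) (Eq.map from′) (via? edges u v)
    where
    edges : List (Fin n × Fin n)
    edges = List.map (ends G) (filter (Sub._∈? H) (allFin m))

    to′ : ∀ {x y} → Via edges x y → Adjacent G H x y
    to′ p with ∈-map⁻ (ends G) p
    ... | f , f∈ , eq = f , proj₂ (∈-filter⁻ (Sub._∈? H) {xs = allFin m} f∈) , sym eq

    from′ : ∀ {x y} → Adjacent G H x y → Via edges x y
    from′ (f , f∈H , refl) =
      ∈-map⁺ (ends G) (∈-filter⁺ (Sub._∈? H) (∈-allFin f) f∈H)

  bridgeless? : Pred.Decidable (Bridgeless G)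
  bridgeless? H = Fin.all? λ f →
    ¬? ((f Sub.∈? H) ×-dec ¬? (connected? (H - f) (src G f) (tgt G f)))

allSubsets : ∀ m → List (Subset m)
allSubsets zero    = Vec.[] ∷ []
allSubsets (suc m) = List.map (outside Vec.∷_) (allSubsets m)
                  ++ List.map (inside  Vec.∷_) (allSubsets m)

bridgelessSubsets : ∀ {n m} → Multigraph n m → List (Subset m)
bridgelessSubsets {m = m} G = filter (bridgeless? G) (allSubsets m)

sumℤ : List ℤ → ℤ
sumℤ = List.foldr ℤ._+_ 0ℤ

-- μ is the Möbius function of the finite poset whose elements are listed,
-- without repetition, in P; values of μ outside P are unconstrained.
record IsMöbius {A : Set} (P : List A) {_≤_ : Rel A 0ℓ} (_≤?_ : Decidable _≤_)
                (μ : A → A → ℤ) : Set where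
  field
    diagonal : ∀ {s} → s List.∈ P → μ s s ≡ 1ℤ
    support  : ∀ {s t} → s List.∈ P → t List.∈ P → ¬ (s ≤ t) → μ s t ≡ 0ℤ
    interval : ∀ {s t} → s List.∈ P → t List.∈ P → s ≤ t → s ≢ t →
               sumℤ (List.map (μ s) (filter (λ r → (s ≤? r) ×-dec (r ≤? t)) P)) ≡ 0ℤ

-- Formal power series, given by their coefficients.
Series : Set
Series = ℕ → ℤ

infix  4 _≐_
infixl 7 _⊛_
infixr 8 _⊛^_

_≐_ : Rel Series 0ℓ
f ≐ g = ∀ k → f k ≡ g k

-- Coefficients are listed constant term first.
poly : List ℤ → Series
poly []       _       = 0ℤ
poly (a ∷ _)  zero    = a
poly (_ ∷ as) (suc k) = poly as k

_⊛_ : Series → Series → Series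
(f ⊛ g) k = sumℤ (List.map (λ i → f i ℤ.* g (k ∸ i)) (upTo (suc k)))

_⊛^_ : Series → ℕ → Series
f ⊛^ zero  = poly (1ℤ ∷ [])
f ⊛^ suc k = f ⊛ f ⊛^ k

sumSeries : List Series → Series
sumSeries fs k = sumℤ (List.map (λ f → f k) fs)

-- Convex hulls are taken in ℚᴺ.  For hulls of finitely many lattice points
-- this does not change the lattice points of the dilates (a rational point
-- that is a real convex combination of rational points is a rational one),
-- nor the dimension.

infixl 6 _+ᵥ_ _-ᵥ_
infixr 7 _*ᵥ_

_+ᵥ_ _-ᵥ_ : ∀ {N} → Vec ℚ N → Vec ℚ N → Vec ℚ N
_+ᵥ_ = zipWith ℚ._+_
_-ᵥ_ = zipWith ℚ._-_

_*ᵥ_ : ∀ {N} → ℚ → Vec ℚ N → Vec ℚ N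
c *ᵥ x = Vec.map (c ℚ.*_) x

0ᵥ : ∀ {N} → Vec ℚ N
0ᵥ = replicate _ 0ℚ

basis : ∀ {N} → Fin N → Vec ℚ N
basis i = 0ᵥ [ i ]≔ 1ℚ

fromℤ : ℤ → ℚ
fromℤ z = z ℚ./ 1

sumℚ : ∀ {k} → Vec ℚ k → ℚ
sumℚ = Vec.foldr′ ℚ._+_ 0ℚ

combination : ∀ {k N} → Vec ℚ k → Vec (Vec ℚ N) k → Vec ℚ N
combination cs xs = Vec.foldr′ _+ᵥ_ 0ᵥ (zipWith _*ᵥ_ cs xs)

Conv : ∀ {N} → Pred (Vec ℚ N) 0ℓ → Pred (Vec ℚ N) 0ℓ
Conv {N} S x = ∃[ k ] Σ[ xs ∈ Vec (Vec ℚ N) k ] Σ[ cs ∈ Vec ℚ k ]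
  (All S xs × All (0ℚ ℚ.≤_) cs × sumℚ cs ≡ 1ℚ × combination cs xs ≡ x)

InAffineHull : ∀ {k N} → Vec (Vec ℚ N) k → Pred (Vec ℚ N) 0ℓ
InAffineHull {k} xs y = Σ[ cs ∈ Vec ℚ k ] (sumℚ cs ≡ 1ℚ × combination cs xs ≡ y)

AffinelyIndependent : ∀ {k N} → Vec (Vec ℚ N) k → Set
AffinelyIndependent {k} xs = (cs : Vec ℚ k) →
  sumℚ cs ≡ 0ℚ → combination cs xs ≡ 0ᵥ → cs ≡ 0ᵥ

HasDimension : ∀ {N} → Pred (Vec ℚ N) 0ℓ → ℕ → Set
HasDimension {N} P d = Σ[ xs ∈ Vec (Vec ℚ N) (suc d) ]
  (All P xs × AffinelyIndependent xs × (∀ y → P y → InAffineHull xs y))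

LatticePoint : ∀ {N} → ℕ → Pred (Vec ℚ N) 0ℓ → Pred (Vec ℤ N) 0ℓ
LatticePoint j P z = ∃[ x ] (P x × fromℤ (+ j) *ᵥ x ≡ Vec.map fromℤ z)

HasCardinality : {A : Set} → Pred A 0ℓ → ℕ → Set
HasCardinality {A} S k = Σ[ xs ∈ List A ]
  (Unique xs × (∀ x → x List.∈ xs ⇔ S x) × List.length xs ≡ k)

-- h is the h*-polynomial of P: the Ehrhart series Σⱼ |jP ∩ ℤᴺ| zʲ equals
-- h / (1 - z)ᵈ⁺¹, with the denominator cleared.
IsHStar : ∀ {N} → Pred (Vec ℚ N) 0ℓ → Series → Set
IsHStar P h = ∃[ d ] Σ[ L ∈ (ℕ → ℕ) ]
  ( HasDimension P d
  × (∀ j → HasCardinality (LatticePoint j P) (L j))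
  × poly (1ℤ ∷ ℤ.- 1ℤ ∷ []) ⊛^ suc d ⊛ (λ j → + L j) ≐ h )

module _ {n m : ℕ} (G : Multigraph n m) where

  -- ℝ^V × ℝ^E is identified with ℝ^(n + m), the V-coordinates first.
  eV : Fin n → Vec ℚ (n ℕ.+ m)
  eV u = basis (u ↑ˡ m)

  eE : Fin m → Vec ℚ (n ℕ.+ m)
  eE f = basis (n ↑ʳ f)

  data Generator : Pred (Vec ℚ (n ℕ.+ m)) 0ℓ where
    edge  : ∀ f → Generator (eE f)
    tilde : ∀ f → Generator (eV (src G f) +ᵥ eV (tgt G f) -ᵥ eE f)
    left  : ∀ f → Generator (eV (src G f) -ᵥ eV (tgt G f) +ᵥ eE f)
    right : ∀ f → Generator (eV (tgt G f) -ᵥ eV (src G f) +ᵥ eE f)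
    node  : ∀ u → Generator (eV u)

  CosmologicalPolytope : Pred (Vec ℚ (n ℕ.+ m)) 0ℓ
  CosmologicalPolytope = Conv Generator

  möbiusSum : (Subset m → Subset m → ℤ) → Series
  möbiusSum μ = sumSeries (List.map term (bridgelessSubsets G))
    where
    term : Subset m → Series
    term H = poly (μ Sub.⊥ H ∷ [])
           ⊛ poly (0ℤ ∷ + 2 ∷ []) ⊛^ Sub.∣ H ∣
           ⊛ poly (1ℤ ∷ + 3 ∷ []) ⊛^ (m ∸ Sub.∣ H ∣)

{-# OPTIONS --safe #-}

-- Graded by the coordinate sum, the cone over the polytope has a lattice point
-- (x , y) exactly when x becomes nonnegative after every edge f with y f < 0 has
-- taken ∣ y f ∣ units from each of its ends and every edge with y f ≥ 0 has moved
-- at most y f units between its ends.  Max-flow min-cut, obtained by eliminating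
-- one edge at a time, gives both the comparison with the convex hull and the fact
-- that the points over a fixed point of G / f form an interval.  A slice
-- y f = c > 0 lengthens each such interval by 2c, so the Ehrhart series satisfy
--   E G = (1 + z) / (1 - z) E (G ∖ f) + 2z / (1 - z)² E (G / f),
-- without the last summand if f is a loop, and the h*-polynomial is
-- ∑ (2z)^∣S∣ (1 + z)^(m - ∣S∣) over the acyclic S ⊆ E.  Expanding
-- 1 + 3z = (1 + z) + 2z in the Möbius sum gives the same expression, since
-- ∑ μ(H) over the bridgeless H ⊆ S is 1 if S is acyclic and 0 otherwise.
module Submission where

open import Defs
open import Data.Fin.Subset using (Subset)
open import Data.Fin.Subset.Properties using (_⊆?_)
open import Data.Integer.Base using (ℤ)
open import Data.Nat.Base using (ℕ; NonZero)

-- The cone is needed in two forms. Flows are what a slice in one edge coordinate, the contraction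
-- map and a decomposition into generators refer to. Cuts are linear inequalities, which pass from
-- generators to their convex hull and bound a fibre from both sides. Eliminating a flow takes a
-- maximum of integers, so an integral point has integral flows and is a sum of generators; no
-- separate integrality argument is made. The lengths of the fibres are never computed: their total
-- is the number of points for c = 0, so only the increment 2c per fibre enters, and ∑ 2c zᶜ = 2z /
-- (1 - z)². In a slice y f = -c the other coordinates have total j + c, of which the edge consumes
-- 2c; what is left, j - c, is the same as for y f = c, whence the factor 1 + z. A graph with n
-- nodes and m edges is multiplied by (1 - z)ⁿ⁺ᵐ. Deletion lowers this exponent by one and
-- contraction by two, exactly the denominators of the recurrence, and the polynomial recurrence
-- that remains splits the acyclic S by whether f ∈ S.

-- Bridgeless and acyclic edge sets under deletion and contraction

module Graph where

  open import Data.Empty using (⊥-elim)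
  open import Data.Fin.Base using (Fin; zero; suc; punchIn; punchOut)
  open import Data.Fin.Properties using (_≟_; punchIn-punchOut; punchOut-cong)
  open import Data.Fin.Subset using (Subset; inside; outside; _∈_; _⊆_; ⊥; _─_; _-_; _∪_; ⋃)
  open import Data.Fin.Subset.Properties
    using (p─⊥≡p; drop-there; ⊆-antisym; ⊥⊆; ∉⊥; x∈p∪q⁺; x∈p∪q⁻; p─q⊆p; x∈p∧x≢y⇒x∈p-y; _⊆?_;
           drop-∷-⊆; out⊆)
  open import Data.List.Base as List using (List; filter)
  import Data.List.Membership.Propositional as List
  open import Data.List.Membership.Propositional.Properties
    using (∈-filter⁺; ∈-filter⁻; ∈-++⁺ˡ; ∈-++⁺ʳ; ∈-map⁺)
  open import Data.List.Relation.Unary.Any using (here; there)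
  open import Data.Nat.Base using (ℕ; zero; suc)
  open import Data.Product.Base using (_×_; _,_; proj₁; proj₂)
  open import Data.Sum.Base using (_⊎_; inj₁; inj₂)
  open import Data.Vec.Base using ([]; _∷_; here; there)
  open import Data.Vec.Properties using (≡-dec)
  import Data.Bool.Properties as Bool
  open import Function.Base using (_∘_; case_of_)
  open import Function.Bundles using (_⇔_; mk⇔; Equivalence)
  open import Relation.Binary.Construct.Closure.Equivalence as Eq using ()
  open import Relation.Binary.PropositionalEquality
  open import Relation.Binary.Structures using (IsEquivalence)
  open import Relation.Nullary using (¬_; Dec; yes; no; contradiction)
  open import Relation.Nullary.Decidable using (map′; decidable-stable)

  module _ {n : ℕ} {u v : Fin (suc n)} (v≢u : v ≢ u) where

    merge : Fin (suc n) → Fin n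
    merge i with v ≟ i
    ... | yes _  = punchOut v≢u
    ... | no v≢i = punchOut v≢i

    merge-v : merge v ≡ punchOut v≢u
    merge-v with v ≟ v
    ... | yes _  = refl
    ... | no v≢v = contradiction refl v≢v

    merge-u : merge u ≡ punchOut v≢u
    merge-u with v ≟ u
    ... | yes v≡u = contradiction v≡u v≢u
    ... | no _    = punchOut-cong v refl

    contract : ∀ {m} → Multigraph (suc n) m → Multigraph n m
    contract G .ends f = merge (src G f) , merge (tgt G f)

  delete : ∀ {n m} → Multigraph n (suc m) → Multigraph n m
  delete G .ends f = ends G (suc f)

  ∈-allSubsets : ∀ {m} (S : Subset m) → S List.∈ allSubsets m
  ∈-allSubsets []            = here refl
  ∈-allSubsets {suc m} (outside ∷ S) = ∈-++⁺ˡ (∈-map⁺ (outside ∷_) (∈-allSubsets S))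
  ∈-allSubsets {suc m} (inside ∷ S)  =
    ∈-++⁺ʳ (List.map (outside ∷_) (allSubsets m)) (∈-map⁺ (inside ∷_) (∈-allSubsets S))

  x∈p-y⇒x≢y : ∀ {m} (H : Subset m) {x y} → x ∈ H - y → x ≢ y
  x∈p-y⇒x≢y (inside  ∷ H) {zero}  {zero}  ()
  x∈p-y⇒x≢y (outside ∷ H) {zero}  {zero}  ()
  x∈p-y⇒x≢y (_ ∷ H) {suc x} {suc .x} (there p) refl = x∈p-y⇒x≢y H p refl

  -‿mono : ∀ {m} {H K : Subset m} f → H ⊆ K → H - f ⊆ K - f
  -‿mono {H = H} f H⊆K x∈ = x∈p∧x≢y⇒x∈p-y (H⊆K (p─q⊆p H _ x∈)) (x∈p-y⇒x≢y H x∈)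

  module _ {n m : ℕ} (G : Multigraph n m) where

    module Conn (H : Subset m) = IsEquivalence (Eq.isEquivalence (Adjacent G H))

    Connected-mono : ∀ {H K u v} → H ⊆ K → Connected G H u v → Connected G K u v
    Connected-mono H⊆K = Eq.map λ (f , f∈H , eq) → f , H⊆K f∈H , eq

    edge-connected : ∀ {H f} → f ∈ H → Connected G H (src G f) (tgt G f)
    edge-connected {f = f} f∈H = Eq.return (f , f∈H , refl)

    -- Bridges are defined by a negation, so obtaining an actual detour around `f` rests on the
    -- decidability of connectivity.
    bypass : ∀ {H} → Bridgeless G H → ∀ {f} → f ∈ H → Connected G (H - f) (src G f) (tgt G f)
    bypass {H} bl {f} f∈H =
      decidable-stable (connected? G (H - f) _ _) λ ¬c → bl f (f∈H , ¬c)

    from-bypass : ∀ {H} → (∀ {f} → f ∈ H → Connected G (H - f) (src G f) (tgt G f)) → Bridgeless G H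
    from-bypass c f (f∈H , ¬c) = ¬c (c f∈H)

    bridgeless-⊥ : Bridgeless G ⊥
    bridgeless-⊥ f (f∈⊥ , _) = ∉⊥ f∈⊥

    -- An edge of the union keeps the detour that it has within its own summand.
    bridgeless-∪ : ∀ {H K} → Bridgeless G H → Bridgeless G K → Bridgeless G (H ∪ K)
    bridgeless-∪ {H} {K} bH bK = from-bypass λ {f} f∈ → case x∈p∪q⁻ H K f∈ of λ where
      (inj₁ f∈H) → Connected-mono (-‿mono f (λ p → x∈p∪q⁺ (inj₁ p))) (bypass bH f∈H)
      (inj₂ f∈K) → Connected-mono (-‿mono f (λ p → x∈p∪q⁺ (inj₂ p))) (bypass bK f∈K)

    -- A path that cannot be rerouted to avoid f can be chosen to traverse f exactly once.
    Connected-split : ∀ {H x y} f → Connected G H x y →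
      Connected G (H - f) x y
      ⊎ (Connected G (H - f) x (src G f) × Connected G (H - f) (tgt G f) y)
      ⊎ (Connected G (H - f) x (tgt G f) × Connected G (H - f) (src G f) y)
    Connected-split {H} f = Eq.fold ≈-isEquivalence step
      where
      open Conn (H - f) using () renaming (refl to ~refl; sym to ~sym; trans to ~trans)
      _~_ = Connected G (H - f)
      a = src G f
      b = tgt G f
      _≈_ : Fin n → Fin n → Set
      x ≈ y = x ~ y ⊎ (x ~ a × b ~ y) ⊎ (x ~ b × a ~ y)

      step : ∀ {x y} → Adjacent G H x y → x ≈ y
      step (g , g∈H , refl) with g ≟ f
      ... | yes refl = inj₂ (inj₁ (~refl , ~refl))
      ... | no g≢f   = inj₁ (edge-connected (x∈p∧x≢y⇒x∈p-y g∈H g≢f))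

      s : ∀ {x y} → x ≈ y → y ≈ x
      s (inj₁ p)              = inj₁ (~sym p)
      s (inj₂ (inj₁ (p , q))) = inj₂ (inj₂ (~sym q , ~sym p))
      s (inj₂ (inj₂ (p , q))) = inj₂ (inj₁ (~sym q , ~sym p))

      t : ∀ {x y z} → x ≈ y → y ≈ z → x ≈ z
      t (inj₁ p) (inj₁ q)                           = inj₁ (~trans p q)
      t (inj₁ p) (inj₂ (inj₁ (q , r)))              = inj₂ (inj₁ (~trans p q , r))
      t (inj₁ p) (inj₂ (inj₂ (q , r)))              = inj₂ (inj₂ (~trans p q , r))
      t (inj₂ (inj₁ (p , q))) (inj₁ r)              = inj₂ (inj₁ (p , ~trans q r))
      t (inj₂ (inj₂ (p , q))) (inj₁ r)              = inj₂ (inj₂ (p , ~trans q r))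
      t (inj₂ (inj₁ (p , q))) (inj₂ (inj₁ (r , z))) = inj₂ (inj₁ (p , z))
      t (inj₂ (inj₁ (p , q))) (inj₂ (inj₂ (r , z))) = inj₁ (~trans p z)
      t (inj₂ (inj₂ (p , q))) (inj₂ (inj₁ (r , z))) = inj₁ (~trans p z)
      t (inj₂ (inj₂ (p , q))) (inj₂ (inj₂ (r , z))) = inj₂ (inj₂ (p , z))

      ≈-isEquivalence : IsEquivalence _≈_
      ≈-isEquivalence = record { refl = inj₁ ~refl ; sym = s ; trans = t }

    -- The largest bridgeless subset of `S`, which exists because bridgeless sets are closed under
    -- union. It turns the family of bridgeless subsets of `S` into an interval of the poset, to
    -- which the Möbius axiom applies.
    core : Subset m → Subset m
    core S = ⋃ (filter (_⊆? S) (bridgelessSubsets G))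

    private
      bridgeless-⋃ : ∀ Hs → (∀ {H} → H List.∈ Hs → Bridgeless G H) → Bridgeless G (⋃ Hs)
      bridgeless-⋃ List.[]       _ = bridgeless-⊥
      bridgeless-⋃ (H List.∷ Hs) b = bridgeless-∪ (b (here refl)) (bridgeless-⋃ Hs (b ∘ there))

      ⋃⊆ : ∀ {S : Subset m} Hs → (∀ {H} → H List.∈ Hs → H ⊆ S) → ⋃ Hs ⊆ S
      ⋃⊆ List.[]       _ p = ⊥-elim (∉⊥ p)
      ⋃⊆ (H List.∷ Hs) b p with x∈p∪q⁻ H (⋃ Hs) p
      ... | inj₁ q = b (here refl) q
      ... | inj₂ q = ⋃⊆ Hs (b ∘ there) q

      ⊆⋃ : ∀ {H : Subset m} {Hs} → H List.∈ Hs → H ⊆ ⋃ Hs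
      ⊆⋃ (here refl) p = x∈p∪q⁺ (inj₁ p)
      ⊆⋃ (there q)   p = x∈p∪q⁺ (inj₂ (⊆⋃ q p))

    ∈-bridgelessSubsets : ∀ {H} → H List.∈ bridgelessSubsets G ⇔ Bridgeless G H
    ∈-bridgelessSubsets = mk⇔
      (λ p → proj₂ (∈-filter⁻ (bridgeless? G) {xs = allSubsets m} p))
      (λ b → ∈-filter⁺ (bridgeless? G) (∈-allSubsets _) b)

    bridgeless-core : ∀ S → Bridgeless G (core S)
    bridgeless-core S = bridgeless-⋃ _ λ p →
      Equivalence.to ∈-bridgelessSubsets (proj₁ (∈-filter⁻ (_⊆? S) {xs = bridgelessSubsets G} p))

    core⊆ : ∀ S → core S ⊆ S
    core⊆ S = ⋃⊆ _ λ p → proj₂ (∈-filter⁻ (_⊆? S) {xs = bridgelessSubsets G} p)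

    ⊆core : ∀ {H S} → H ⊆ S → Bridgeless G H → H ⊆ core S
    ⊆core {S = S} H⊆S b = ⊆⋃ (∈-filter⁺ (_⊆? S) (Equivalence.from ∈-bridgelessSubsets b) H⊆S)

    -- Forests, described through bridgeless sets alone: a cycle would be a nonempty bridgeless
    -- subset. In this form the notion fits both the Möbius sum and the deletion-contraction
    -- recurrence, and cycles need not be formalised.
    Acyclic : Subset m → Set
    Acyclic S = ∀ {H} → H ⊆ S → Bridgeless G H → H ≡ ⊥

    core≡⊥⇒Acyclic : ∀ {S} → core S ≡ ⊥ → Acyclic S
    core≡⊥⇒Acyclic {S} eq {H} H⊆S b = ⊆-antisym (subst (H ⊆_) eq (⊆core H⊆S b)) ⊥⊆

    opaque
      -- All bridgeless subsets of `S` lie in its core, so comparing that one set with `⊥` decides.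
      acyclic? : ∀ S → Dec (Acyclic S)
      acyclic? S = map′ core≡⊥⇒Acyclic (λ a → a (core⊆ S) (bridgeless-core S))
                        (≡-dec Bool._≟_ (core S) ⊥)

  module _ {n m : ℕ} (G : Multigraph n (suc m)) where

    Connected-delete⁺ : ∀ {H x y} → Connected (delete G) H x y → Connected G (outside ∷ H) x y
    Connected-delete⁺ = Eq.map λ (f , f∈H , eq) → suc f , there f∈H , eq

    Connected-delete⁻ : ∀ {H x y} → Connected G (outside ∷ H) x y → Connected (delete G) H x y
    Connected-delete⁻ = Eq.map λ where (suc f , there f∈H , eq) → f , f∈H , eq

    bridgeless-delete : ∀ {H} → Bridgeless G (outside ∷ H) ⇔ Bridgeless (delete G) H
    bridgeless-delete = mk⇔
      (λ b → from-bypass (delete G) λ f∈H → Connected-delete⁻ (bypass G b (there f∈H)))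
      (λ b → from-bypass G λ where (there f∈H) → Connected-delete⁺ (bypass (delete G) b f∈H))

    acyclic-delete : ∀ {S} → Acyclic G (outside ∷ S) ⇔ Acyclic (delete G) S
    acyclic-delete {S} = mk⇔ to from
      where
      to : Acyclic G (outside ∷ S) → Acyclic (delete G) S
      to a H⊆S b with a (out⊆ H⊆S) (Equivalence.from bridgeless-delete b)
      ... | refl = refl
      from : Acyclic (delete G) S → Acyclic G (outside ∷ S)
      from a {inside  ∷ H} H⊆S b = case H⊆S here of λ ()
      from a {outside ∷ H} H⊆S b =
        cong (outside ∷_) (a (drop-∷-⊆ H⊆S) (Equivalence.to bridgeless-delete b))

    -- The loop on its own is bridgeless: its ends coincide, so they stay connected without any
    -- edge.
    loop-¬acyclic : ∀ {S} → src G zero ≡ tgt G zero → ¬ Acyclic G (inside ∷ S)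
    loop-¬acyclic {S} loop a with a {inside ∷ ⊥} (λ where here → here ; (there p) → ⊥-elim (∉⊥ p))
      (from-bypass G λ where
        here → subst (Connected G _ (src G zero)) loop (Conn.refl G _)
        (there p) → ⊥-elim (∉⊥ p))
    ... | ()

  module _ {n m : ℕ} (G : Multigraph (suc n) (suc m)) (v≢u : tgt G zero ≢ src G zero) where

    private
      u v : Fin (suc n)
      u = src G zero
      v = tgt G zero
      π = merge v≢u
      G/e = contract v≢u (delete G)

    Connected-contract⁺ : ∀ {s H x y} → Connected G (s ∷ H) x y → Connected G/e H (π x) (π y)
    Connected-contract⁺ {s} {H} = Eq.gfold (Eq.isEquivalence (Adjacent G/e H)) π λ where
      (zero , here , refl)     → subst (Connected G/e H (π u)) (trans (merge-u v≢u) (sym (merge-v v≢u)))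
                                       (Conn.refl G/e H)
      (suc f , there f∈ , eq) → Eq.return (f , f∈ , cong (λ (a , b) → π a , π b) eq)

    module _ {H : Subset m} where
      private
        module C = Conn G (inside ∷ H)

        -- `punchIn v` after `π` fixes every node except `v`, which it sends to `u`; the contracted
        -- edge itself joins these two.
        section : ∀ i → Connected G (inside ∷ H) (punchIn v (π i)) i
        section i with v ≟ i
        ... | no v≢i = subst (λ j → Connected G _ j i) (sym (punchIn-punchOut v≢i)) C.refl
        ... | yes refl = C.trans (subst (λ j → Connected G _ j u) (sym (punchIn-punchOut v≢u)) C.refl)
                                 (edge-connected G here)

      Connected-contract⁻ : ∀ {x y} → Connected G/e H (π x) (π y) → Connected G (inside ∷ H) x y
      Connected-contract⁻ {x} {y} c = C.trans (C.sym (section x)) (C.trans (lift c) (section y))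
        where
        lift : ∀ {k l} → Connected G/e H k l → Connected G (inside ∷ H) (punchIn v k) (punchIn v l)
        lift = Eq.gfold (Eq.isEquivalence (Adjacent G (inside ∷ H))) (punchIn v) λ where
          (f , f∈H , refl) → C.trans (section (src G (suc f)))
            (C.trans (edge-connected G (there f∈H)) (C.sym (section (tgt G (suc f)))))

    bridgeless-contract : ∀ {s H} → Bridgeless G (s ∷ H) → Bridgeless G/e H
    bridgeless-contract b = from-bypass G/e λ f∈H → Connected-contract⁺ (bypass G b (there f∈H))

    -- Either e lies on a cycle with H, or it is a bridge and may be dropped.
    bridgeless-lift : ∀ {H} → Bridgeless G/e H → Bridgeless G (inside ∷ H) ⊎ Bridgeless G (outside ∷ H)
    bridgeless-lift {H} b with connected? G ((inside ∷ H) - zero) u v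
    ... | yes c = inj₁ (from-bypass G λ where
            here        → c
            (there f∈H) → Connected-contract⁻ (bypass G/e b f∈H))
    ... | no ¬c = inj₂ (from-bypass G λ where (there f∈H) → avoid f∈H)
      where
      e-bridge : ¬ Connected G (outside ∷ H) u v
      e-bridge = ¬c ∘ subst (λ K → Connected G (outside ∷ K) u v) (sym (p─⊥≡p H))

      avoid : ∀ {f} → f ∈ H → Connected G (outside ∷ (H - f)) (src G (suc f)) (tgt G (suc f))
      avoid {f} f∈H = case Connected-split G zero (Connected-contract⁻ (bypass G/e b f∈H)) of λ where
          (inj₁ c)              → drop⊥ c
          -- If the detour around `f` has to traverse `e`, its two halves together with `f` connect
          -- the ends of `e` inside `H`, contrary to `e` being a bridge.
          (inj₂ (inj₁ (p , q))) → ⊥-elim (e-bridge (C.trans (C.sym (weaken p)) (C.trans f-conn (C.sym (weaken q)))))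
          (inj₂ (inj₂ (p , q))) → ⊥-elim (e-bridge (C.trans (weaken q) (C.trans (C.sym f-conn) (weaken p))))
        where
        module C = Conn G (outside ∷ H)
        f-conn : Connected G (outside ∷ H) (src G (suc f)) (tgt G (suc f))
        f-conn = edge-connected G (there f∈H)
        drop⊥ : ∀ {K x y} → Connected G (outside ∷ (K ─ ⊥)) x y → Connected G (outside ∷ K) x y
        drop⊥ {K} = subst (λ J → Connected G (outside ∷ J) _ _) (p─⊥≡p K)
        weaken : ∀ {x y} → Connected G (outside ∷ ((H - f) ─ ⊥)) x y → Connected G (outside ∷ H) x y
        weaken c = Connected-mono G (λ where (there p) → there (p─q⊆p H _ p)) (drop⊥ c)

    acyclic-contract : ∀ {S} → Acyclic G (inside ∷ S) ⇔ Acyclic G/e S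
    acyclic-contract {S} = mk⇔ to from
      where
      to : Acyclic G (inside ∷ S) → Acyclic G/e S
      to a {H} H⊆S b with bridgeless-lift b
      ... | inj₁ b′ = case a (λ where here → here ; (there p) → there (H⊆S p)) b′ of λ ()
      ... | inj₂ b′ with a (λ where (there p) → there (H⊆S p)) b′
      ...   | refl = refl

      from : Acyclic G/e S → Acyclic G (inside ∷ S)
      from a {s ∷ H} H⊆S b with a (λ p → drop-there (H⊆S (there p))) (bridgeless-contract b)
      from a {outside ∷ .⊥} H⊆S b | refl = refl
      -- What is left is `e` alone. A detour around it has no edges to use, so its ends would be
      -- equal.
      from a {inside  ∷ .⊥} H⊆S b | refl = ⊥-elim (v≢u (sym (Eq.fold isEquivalence
        (λ where (suc f , there p , _) → ⊥-elim (∉⊥ (p─q⊆p ⊥ ⊥ p)))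
        (bypass G b here))))

-- Max-flow min-cut for the cone over the polytope

module FlowsAndCuts where

  open Graph
  open import Data.Bool.Base using (Bool; true; false; if_then_else_; _∧_; _∨_; _xor_; not)
  open import Data.Fin.Base using (Fin; zero; suc)
  open import Data.Fin.Properties using (_≟_)
  open import Data.Fin.Subset using (Subset; _∩_; _∪_; ⁅_⁆)
  open import Data.Integer.Base hiding (suc)
  open import Data.Integer.Properties hiding (_≟_)
  open import Data.Integer.Tactic.RingSolver using (solve-∀)
  open import Data.List.Base as List using (List; []; _∷_)
  open import Data.List.Membership.Propositional as List using ()
  open import Data.List.Relation.Unary.Any using (here; there)
  open import Data.Nat.Base using (ℕ; zero; suc; z≤n)
  open import Data.Product.Base using (∃-syntax; _×_; _,_; proj₁; proj₂)
  open import Data.Sum.Base using (inj₁; inj₂)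
  open import Data.Vec.Base as Vec using (lookup)
  open import Data.Vec.Properties using (lookup-zipWith; lookup-replicate)
  open import Function.Base using (_∘_)
  open import Relation.Binary.PropositionalEquality
  open import Relation.Nullary using (yes; no; contradiction)

  open import Algebra.Properties.Semiring.Sum +-*-semiring
    using (sum; sum-cong-≗; ∑-distrib-+; *-distribˡ-sum; sum-replicate-zero) public

  δ : ∀ {n} → Fin n → Fin n → ℤ
  δ zero    zero    = 1ℤ
  δ zero    (suc j) = 0ℤ
  δ (suc i) zero    = 0ℤ
  δ (suc i) (suc j) = δ i j

  δ-refl : ∀ {n} (i : Fin n) → δ i i ≡ 1ℤ
  δ-refl zero    = refl
  δ-refl (suc i) = δ-refl i

  δ-≢ : ∀ {n} {i j : Fin n} → i ≢ j → δ i j ≡ 0ℤ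
  δ-≢ {i = zero}  {zero}  i≢j = contradiction refl i≢j
  δ-≢ {i = zero}  {suc j} i≢j = refl
  δ-≢ {i = suc i} {zero}  i≢j = refl
  δ-≢ {i = suc i} {suc j} i≢j = δ-≢ (i≢j ∘ cong suc)

  δ-injective : ∀ {n m} (f : Fin n → Fin m) → (∀ {i j} → f i ≡ f j → i ≡ j) →
    ∀ i j → δ (f i) (f j) ≡ δ i j
  δ-injective f inj i j with i ≟ j
  ... | yes refl = trans (δ-refl (f i)) (sym (δ-refl i))
  ... | no i≢j   = trans (δ-≢ (i≢j ∘ inj)) (sym (δ-≢ i≢j))

  sum-δ : ∀ {n} (f : Fin n → ℤ) i → sum (λ j → f j * δ i j) ≡ f i
  sum-δ {suc n} f zero = begin
    f zero * 1ℤ + sum (λ j → f (suc j) * 0ℤ)  ≡⟨ cong₂ _+_ (*-identityʳ (f zero)) (sum-cong-≗ (λ j → *-zeroʳ (f (suc j)))) ⟩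
    f zero + sum {n} (λ _ → 0ℤ)               ≡⟨ cong (_+_ (f zero)) (sum-replicate-zero n) ⟩
    f zero + 0ℤ                               ≡⟨ +-identityʳ (f zero) ⟩
    f zero                                    ∎
    where open ≡-Reasoning
  sum-δ f (suc i) = trans (cong₂ _+_ (*-zeroʳ (f zero)) (sum-δ (f ∘ suc) i)) (+-identityˡ _)

  sum-*-+ : ∀ {n} (f x d : Fin n → ℤ) t →
    sum (λ i → f i * (x i + t * d i)) ≡ sum (λ i → f i * x i) + t * sum (λ i → f i * d i)
  sum-*-+ f x d t = begin
    sum (λ i → f i * (x i + t * d i))                      ≡⟨ sum-cong-≗ (λ i → lem (f i) (x i) t (d i)) ⟩
    sum (λ i → f i * x i + t * (f i * d i))                ≡⟨ ∑-distrib-+ (λ i → f i * x i) _ ⟩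
    sum (λ i → f i * x i) + sum (λ i → t * (f i * d i))    ≡⟨ cong (_+_ (sum (λ i → f i * x i))) (*-distribˡ-sum t (λ i → f i * d i)) ⟨
    sum (λ i → f i * x i) + t * sum (λ i → f i * d i)      ∎
    where
    open ≡-Reasoning
    lem : ∀ a b c d → a * (b + c * d) ≡ a * b + c * (a * d)
    lem = solve-∀

  module _ {n : ℕ} where

    transfer consume : Fin n → Fin n → ℤ → (Fin n → ℤ) → Fin n → ℤ
    transfer u v t x i = x i + t * (δ u i - δ v i)
    consume  u v t x i = x i + t * (δ u i + δ v i)

    sum-transfer : ∀ (f x : Fin n → ℤ) u v t →
      sum (λ i → f i * transfer u v t x i) ≡ sum (λ i → f i * x i) + t * (f u - f v)
    sum-transfer f x u v t = trans (sum-*-+ f x _ t) (cong (λ z → sum (λ i → f i * x i) + t * z) (begin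
      sum (λ i → f i * (δ u i - δ v i))                       ≡⟨ sum-cong-≗ (λ i → lem (f i) (δ u i) (δ v i)) ⟩
      sum (λ i → f i * (δ u i + -1ℤ * δ v i))                 ≡⟨ sum-*-+ f (δ u) (δ v) -1ℤ ⟩
      sum (λ i → f i * δ u i) + -1ℤ * sum (λ i → f i * δ v i) ≡⟨ cong₂ (λ a b → a + -1ℤ * b) (sum-δ f u) (sum-δ f v) ⟩
      f u + -1ℤ * f v                                         ≡⟨ cong (_+_ (f u)) (-1*i≡-i (f v)) ⟩
      f u - f v                                               ∎))
      where
      open ≡-Reasoning
      lem : ∀ a b c → a * (b - c) ≡ a * (b + -1ℤ * c)
      lem = solve-∀

    sum-consume : ∀ (f x : Fin n → ℤ) u v t →
      sum (λ i → f i * consume u v t x i) ≡ sum (λ i → f i * x i) + t * (f u + f v)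
    sum-consume f x u v t = trans (sum-*-+ f x _ t) (cong (λ z → sum (λ i → f i * x i) + t * z) (begin
      sum (λ i → f i * (δ u i + δ v i))                       ≡⟨ sum-cong-≗ (λ i → lem (f i) (δ u i) (δ v i)) ⟩
      sum (λ i → f i * (δ u i + 1ℤ * δ v i))                  ≡⟨ sum-*-+ f (δ u) (δ v) 1ℤ ⟩
      sum (λ i → f i * δ u i) + 1ℤ * sum (λ i → f i * δ v i)  ≡⟨ cong₂ (λ a b → a + 1ℤ * b) (sum-δ f u) (sum-δ f v) ⟩
      f u + 1ℤ * f v                                          ≡⟨ cong (_+_ (f u)) (*-identityˡ (f v)) ⟩
      f u + f v                                               ∎))
      where
      open ≡-Reasoning
      lem : ∀ a b c → a * (b + c) ≡ a * (b + 1ℤ * c)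
      lem = solve-∀

    -- The treatment of one edge is kept apart from the recursion over all edges, with `R` standing
    -- for the condition on the others, so that slices with a prescribed edge weight can be
    -- expressed too.
    Step : ℤ → Fin n → Fin n → ((Fin n → ℤ) → Set) → (Fin n → ℤ) → Set
    Step (+ c)    u v R x = ∃[ t ] (- + c ≤ t × t ≤ + c × R (transfer u v t x))
    Step -[1+ c ] u v R x = R (consume u v -[1+ c ] x)

  -- Feasible G x y says that (x , y) lies in the cone over the cosmological
  -- polytope: an edge with y f ≥ 0 moves at most y f units between its ends,
  -- and one with y f < 0 takes ∣ y f ∣ units from each of its ends.
  Feasible : ∀ {n m} → Multigraph n m → (Fin n → ℤ) → (Fin m → ℤ) → Set
  Feasible {m = zero}  G x y = ∀ i → 0ℤ ≤ x i
  Feasible {m = suc m} G x y =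
    Step (y zero) (src G zero) (tgt G zero) (λ x′ → Feasible (delete G) x′ (y ∘ suc)) x

  ⟦_⟧ : Bool → ℤ
  ⟦ b ⟧ = if b then 1ℤ else 0ℤ

  -- The contribution of an edge to the surplus of a node set S, where a and b say
  -- which of its ends lie in S: capacity across the cut, or demand at the ends in S.
  κ : Bool → Bool → ℤ → ℤ
  κ a b (+ c)    = if a xor b then + c else 0ℤ
  κ a b -[1+ c ] = -[1+ c ] * (⟦ a ⟧ + ⟦ b ⟧)

  module _ {n m : ℕ} (G : Multigraph n m) where

    edgePart : (Fin m → ℤ) → (Fin n → Bool) → ℤ
    edgePart y s = sum (λ f → κ (s (src G f)) (s (tgt G f)) (y f))

    surplus : (Fin n → ℤ) → (Fin m → ℤ) → (Fin n → Bool) → ℤ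
    surplus x y s = sum (λ i → ⟦ s i ⟧ * x i) + edgePart y s

    -- The node sets range over `Subset n`, whose elements can be listed, so that the strongest of
    -- the bounds they impose on a flow exists as a maximum.
    Cut : (Fin n → ℤ) → (Fin m → ℤ) → Set
    Cut x y = (S : Subset n) → 0ℤ ≤ surplus x y (lookup S)

    surplus-cong : ∀ {x x′ y y′ s s′} → x ≗ x′ → y ≗ y′ → s ≗ s′ → surplus x y s ≡ surplus x′ y′ s′
    surplus-cong {y = y} {s′ = s′} x≗ y≗ s≗ = cong₂ _+_
      (sum-cong-≗ λ i → cong₂ (λ b → ⟦ b ⟧ *_) (s≗ i) (x≗ i))
      (sum-cong-≗ λ f → trans (cong₂ (λ a b → κ a b (y f)) (s≗ (src G f)) (s≗ (tgt G f)))
                              (cong (κ (s′ (src G f)) (s′ (tgt G f))) (y≗ f)))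

    Cut-resp : ∀ {x x′ y y′} → x ≗ x′ → y ≗ y′ → Cut x y → Cut x′ y′
    Cut-resp x≗ y≗ c S = subst (0ℤ ≤_) (surplus-cong {s = lookup S} x≗ y≗ (λ _ → refl)) (c S)

    surplus-transfer : ∀ x y s u v t →
      surplus (transfer u v t x) y s ≡ surplus x y s + t * (⟦ s u ⟧ - ⟦ s v ⟧)
    surplus-transfer x y s u v t =
      trans (cong (_+ edgePart y s) (sum-transfer (⟦_⟧ ∘ s) x u v t))
        (lem (sum (λ i → ⟦ s i ⟧ * x i)) (t * (⟦ s u ⟧ - ⟦ s v ⟧)) (edgePart y s))
      where
      lem : ∀ a b c → a + b + c ≡ a + c + b
      lem = solve-∀

    surplus-consume : ∀ x y s u v t →
      surplus (consume u v t x) y s ≡ surplus x y s + t * (⟦ s u ⟧ + ⟦ s v ⟧)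
    surplus-consume x y s u v t =
      trans (cong (_+ edgePart y s) (sum-consume (⟦_⟧ ∘ s) x u v t))
        (lem (sum (λ i → ⟦ s i ⟧ * x i)) (t * (⟦ s u ⟧ + ⟦ s v ⟧)) (edgePart y s))
      where
      lem : ∀ a b c → a + b + c ≡ a + c + b
      lem = solve-∀

  sum-mono : ∀ {n} {f g : Fin n → ℤ} → (∀ i → f i ≤ g i) → sum f ≤ sum g
  sum-mono {zero}  f≤g = ≤-refl
  sum-mono {suc n} f≤g = +-mono-≤ (f≤g zero) (sum-mono (f≤g ∘ suc))

  private
    ⟦⟧-modular : ∀ a b → ⟦ a ∧ b ⟧ + ⟦ a ∨ b ⟧ ≡ ⟦ a ⟧ + ⟦ b ⟧
    ⟦⟧-modular true  true  = refl
    ⟦⟧-modular true  false = refl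
    ⟦⟧-modular false true  = refl
    ⟦⟧-modular false false = refl

    -- Demands are modular, since each end contributes independently. Capacities give a cut
    -- function, where equality fails only if the edge runs between the two set differences.
    κ-submodular : ∀ a b a′ b′ c →
      κ (a ∧ a′) (b ∧ b′) c + κ (a ∨ a′) (b ∨ b′) c ≤ κ a b c + κ a′ b′ c
    κ-submodular a b a′ b′ -[1+ c ] = ≤-reflexive (begin
      C * (⟦ a ∧ a′ ⟧ + ⟦ b ∧ b′ ⟧) + C * (⟦ a ∨ a′ ⟧ + ⟦ b ∨ b′ ⟧)   ≡⟨ lem C ⟦ a ∧ a′ ⟧ ⟦ b ∧ b′ ⟧ ⟦ a ∨ a′ ⟧ ⟦ b ∨ b′ ⟧ ⟩
      C * ((⟦ a ∧ a′ ⟧ + ⟦ a ∨ a′ ⟧) + (⟦ b ∧ b′ ⟧ + ⟦ b ∨ b′ ⟧))     ≡⟨ cong₂ (λ p q → C * (p + q)) (⟦⟧-modular a a′) (⟦⟧-modular b b′) ⟩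
      C * ((⟦ a ⟧ + ⟦ a′ ⟧) + (⟦ b ⟧ + ⟦ b′ ⟧))                       ≡⟨ lem C ⟦ a ⟧ ⟦ b ⟧ ⟦ a′ ⟧ ⟦ b′ ⟧ ⟨
      C * (⟦ a ⟧ + ⟦ b ⟧) + C * (⟦ a′ ⟧ + ⟦ b′ ⟧)                     ∎)
      where
      open ≡-Reasoning
      C = -[1+ c ]
      lem : ∀ c p q r s → c * (p + q) + c * (r + s) ≡ c * ((p + r) + (q + s))
      lem = solve-∀
    κ-submodular true  true  a′    b′    (+ c) = ≤-reflexive (+-comm (κ a′ b′ (+ c)) 0ℤ)
    κ-submodular false false a′    b′    (+ c) = ≤-refl
    κ-submodular true  false true  true  (+ c) = ≤-refl
    κ-submodular true  false true  false (+ c) = ≤-refl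
    κ-submodular true  false false true  (+ c) = +≤+ z≤n
    κ-submodular true  false false false (+ c) = ≤-reflexive (+-comm 0ℤ (+ c))
    κ-submodular false true  true  true  (+ c) = ≤-refl
    κ-submodular false true  true  false (+ c) = +≤+ z≤n
    κ-submodular false true  false true  (+ c) = ≤-refl
    κ-submodular false true  false false (+ c) = ≤-reflexive (+-comm 0ℤ (+ c))

  surplus-submodular : ∀ {n m} (G : Multigraph n m) x y (S T : Subset n) →
    surplus G x y (lookup (S ∩ T)) + surplus G x y (lookup (S ∪ T))
    ≤ surplus G x y (lookup S) + surplus G x y (lookup T)
  surplus-submodular {n} G x y S T = begin
    surplus G x y (lookup (S ∩ T)) + surplus G x y (lookup (S ∪ T))
      ≡⟨ cong₂ _+_ (surplus-cong G {x} {x} {y} {y} (λ _ → refl) (λ _ → refl) (λ i → lookup-zipWith _∧_ i S T))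
                   (surplus-cong G {x} {x} {y} {y} (λ _ → refl) (λ _ → refl) (λ i → lookup-zipWith _∨_ i S T)) ⟩
    surplus G x y s∧t + surplus G x y s∨t
      ≡⟨ swap (A s∧t) (E s∧t) (A s∨t) (E s∨t) ⟩
    (A s∧t + A s∨t) + (E s∧t + E s∨t)
      ≤⟨ +-mono-≤ (≤-reflexive nodes) edges ⟩
    (A s + A t) + (E s + E t)
      ≡⟨ swap (A s) (E s) (A t) (E t) ⟨
    surplus G x y s + surplus G x y t ∎
    where
    open ≤-Reasoning
    s t s∧t s∨t : Fin n → Bool
    s = lookup S
    t = lookup T
    s∧t i = s i ∧ t i
    s∨t i = s i ∨ t i
    A E : (Fin n → Bool) → ℤ
    A r = sum (λ i → ⟦ r i ⟧ * x i)
    E = edgePart G y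
    swap : ∀ a b c d → (a + b) + (c + d) ≡ (a + c) + (b + d)
    swap = solve-∀
    nodes : A s∧t + A s∨t ≡ A s + A t
    nodes = trans (sym (∑-distrib-+ (λ i → ⟦ s∧t i ⟧ * x i) (λ i → ⟦ s∨t i ⟧ * x i)))
      (trans (sum-cong-≗ λ i → trans (sym (*-distribʳ-+ (x i) ⟦ s∧t i ⟧ ⟦ s∨t i ⟧))
               (trans (cong (_* x i) (⟦⟧-modular (s i) (t i))) (*-distribʳ-+ (x i) ⟦ s i ⟧ ⟦ t i ⟧)))
             (∑-distrib-+ (λ i → ⟦ s i ⟧ * x i) (λ i → ⟦ t i ⟧ * x i)))
    k : (Fin n → Bool) → _ → ℤ
    k r f = κ (r (src G f)) (r (tgt G f)) (y f)
    edges : E s∧t + E s∨t ≤ E s + E t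
    edges = subst₂ _≤_ (∑-distrib-+ (k s∧t) (k s∨t)) (∑-distrib-+ (k s) (k t))
      (sum-mono λ f → κ-submodular (s (src G f)) (s (tgt G f)) (t (src G f)) (t (tgt G f)) (y f))

  module _ {I : Set} (p : I → Bool) (l : I → ℤ) (t₀ : ℤ) where

    -- A maximum over the indices selected by `p`. The start value `t₀` covers an empty selection;
    -- in the elimination it is the capacity bound `- + c`.
    sup : List I → ℤ
    sup []       = t₀
    sup (i ∷ is) = if p i then l i ⊔ sup is else sup is

    t₀≤sup : ∀ is → t₀ ≤ sup is
    t₀≤sup []       = ≤-refl
    t₀≤sup (i ∷ is) with p i
    ... | true  = ≤-trans (t₀≤sup is) (i≤j⊔i (l i) (sup is))
    ... | false = t₀≤sup is

    ≤sup : ∀ {i is} → i List.∈ is → p i ≡ true → l i ≤ sup is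
    ≤sup {i} {i ∷ is} (here refl) pi rewrite pi = i≤i⊔j (l i) (sup is)
    ≤sup {i} {j ∷ is} (there i∈)  pi with p j
    ... | true  = ≤-trans (≤sup i∈ pi) (i≤j⊔i (l j) (sup is))
    ... | false = ≤sup i∈ pi

    -- A maximum of finitely many integers is attained, so a property of `t₀` and of every selected
    -- `l i` passes to it, whatever the property is.
    sup-elim : (U : ℤ → Set) → U t₀ → (∀ i → p i ≡ true → U (l i)) → ∀ is → U (sup is)
    sup-elim U u₀ u []       = u₀
    sup-elim U u₀ u (i ∷ is) with p i in eq
    ... | false = sup-elim U u₀ u is
    ... | true with ⊔-sel (l i) (sup is)
    ...   | inj₁ e = subst U (sym e) (u i eq)
    ...   | inj₂ e = subst U (sym e) (sup-elim U u₀ u is)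

  ≤-from : ∀ {a b e} → 0ℤ ≤ e → e ≡ b - a → a ≤ b
  ≤-from 0≤e eq = 0≤i-j⇒j≤i (subst (0ℤ ≤_) eq 0≤e)

  private
    xor-bound : ∀ a b {A t c} → - + c ≤ t → t ≤ + c → 0ℤ ≤ A + t * (⟦ a ⟧ - ⟦ b ⟧) → 0ℤ ≤ A + κ a b (+ c)
    xor-bound true true {A} {t} _ _ p = subst (0ℤ ≤_) (lem A t) p
      where lem : ∀ a t → a + t * 0ℤ ≡ a + 0ℤ
            lem = solve-∀
    xor-bound false false {A} {t} _ _ p = subst (0ℤ ≤_) (lem A t) p
      where lem : ∀ a t → a + t * 0ℤ ≡ a + 0ℤ
            lem = solve-∀
    xor-bound true false {A} {t} {c} _ t≤c p = ≤-trans p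
      (subst (_≤ A + + c) (lem A t) (+-monoʳ-≤ A t≤c))
      where lem : ∀ a t → a + t ≡ a + t * (1ℤ - 0ℤ)
            lem = solve-∀
    xor-bound false true {A} {t} {c} -c≤t _ p = ≤-trans p
      (subst₂ _≤_ (lem A t) (cong (_+_ A) (neg-involutive (+ c))) (+-monoʳ-≤ A (neg-mono-≤ -c≤t)))
      where lem : ∀ a t → a + - t ≡ a + t * (0ℤ - 1ℤ)
            lem = solve-∀

  module _ {n m : ℕ} (G : Multigraph n (suc m)) where

    surplus-delete : ∀ x y s → surplus G x y s ≡
      surplus (delete G) x (y ∘ suc) s + κ (s (src G zero)) (s (tgt G zero)) (y zero)
    surplus-delete x y s = lem (sum (λ i → ⟦ s i ⟧ * x i)) (κ (s (src G zero)) (s (tgt G zero)) (y zero)) _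
      where
      lem : ∀ a b c → a + (b + c) ≡ a + c + b
      lem = solve-∀

  -- Weak duality: settling one edge raises the surplus over the other edges by at most its `κ`, and
  -- once all edges are settled the surplus is a sum of nonnegative entries.
  Feasible⇒Cut : ∀ {n m} (G : Multigraph n m) {x y} → Feasible G x y → Cut G x y
  Feasible⇒Cut {n} {zero} G {x} p S = subst (0ℤ ≤_) (sym (+-identityʳ _))
    (≤-trans (≤-reflexive (sym (sum-replicate-zero n))) (sum-mono λ i → nonneg (lookup S i) (p i)))
    where
    nonneg : ∀ b {a} → 0ℤ ≤ a → 0ℤ ≤ ⟦ b ⟧ * a
    nonneg true  {a} 0≤a = subst (0ℤ ≤_) (sym (*-identityˡ a)) 0≤a
    nonneg false {a} _   = ≤-refl
  Feasible⇒Cut {n} {suc m} G {x} {y} p S = subst (0ℤ ≤_) (sym (surplus-delete G x y s)) (go (y zero) p)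
    where
    s = lookup S
    u = src G zero
    v = tgt G zero
    R : (Fin n → ℤ) → Set
    R x′ = Feasible (delete G) x′ (y ∘ suc)
    go : ∀ c → Step c u v R x → 0ℤ ≤ surplus (delete G) x (y ∘ suc) s + κ (s u) (s v) c
    go (+ c) (t , -c≤t , t≤c , r) = xor-bound (s u) (s v) {surplus (delete G) x (y ∘ suc) s} -c≤t t≤c
      (subst (0ℤ ≤_) (surplus-transfer (delete G) x (y ∘ suc) s u v t) (Feasible⇒Cut (delete G) r S))
    go -[1+ c ] r =
      subst (0ℤ ≤_) (surplus-consume (delete G) x (y ∘ suc) s u v -[1+ c ]) (Feasible⇒Cut (delete G) r S)

  -- (a , b) = (true , false), (false , true): the cut bounds t from below, above.
  down up : Bool → Bool → Bool
  down a b = a ∧ not b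
  up   a b = b ∧ not a

  bounds⇒≤ : ∀ a b {A t} → (down a b ≡ true → - A ≤ t) → (up a b ≡ true → t ≤ A) →
    (a ≡ b → 0ℤ ≤ A) → 0ℤ ≤ A + t * (⟦ a ⟧ - ⟦ b ⟧)
  bounds⇒≤ true true {A} {t} _ _ p = subst (0ℤ ≤_) (lem A t) (p refl)
    where lem : ∀ a t → a ≡ a + t * 0ℤ
          lem = solve-∀
  bounds⇒≤ false false {A} {t} _ _ p = subst (0ℤ ≤_) (lem A t) (p refl)
    where lem : ∀ a t → a ≡ a + t * 0ℤ
          lem = solve-∀
  bounds⇒≤ true false {A} {t} p _ _ = subst (0ℤ ≤_) (lem A t) (i≤j⇒0≤j-i (p refl))
    where lem : ∀ a t → t - - a ≡ a + t * (1ℤ - 0ℤ)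
          lem = solve-∀
  bounds⇒≤ false true {A} {t} _ p _ = subst (0ℤ ≤_) (lem A t) (i≤j⇒0≤j-i (p refl))
    where lem : ∀ a t → a - t ≡ a + t * (0ℤ - 1ℤ)
          lem = solve-∀

  ≤⇒down : ∀ a b {A t} → 0ℤ ≤ A + t * (⟦ a ⟧ - ⟦ b ⟧) → down a b ≡ true → - A ≤ t
  ≤⇒down true false {A} {t} p _ = ≤-from p (lem A t)
    where lem : ∀ a t → a + t * (1ℤ - 0ℤ) ≡ t - - a
          lem = solve-∀

  ≤⇒up : ∀ a b {A t} → 0ℤ ≤ A + t * (⟦ a ⟧ - ⟦ b ⟧) → up a b ≡ true → t ≤ A
  ≤⇒up false true {A} {t} p _ = ≤-from p (lem A t)
    where lem : ∀ a t → a + t * (0ℤ - 1ℤ) ≡ a - t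
          lem = solve-∀

  ≤⇒neutral : ∀ a b {A t} → 0ℤ ≤ A + t * (⟦ a ⟧ - ⟦ b ⟧) → a ≡ b → 0ℤ ≤ A
  ≤⇒neutral a .a {A} {t} p refl = subst (0ℤ ≤_) (lem A t ⟦ a ⟧) p
    where lem : ∀ a t c → a + t * (c - c) ≡ a
          lem = solve-∀

  -- Fourier–Motzkin elimination of the flow t through one edge; a lower bound
  -- coming from S and an upper bound coming from T are compatible because
  -- neither S ∩ T nor S ∪ T separates the ends of the edge.
  module _ {n m : ℕ} (G : Multigraph n m) (u v : Fin n) (x : Fin n → ℤ) (y : Fin m → ℤ) (c : ℕ)
    (cut : (S : Subset n) → 0ℤ ≤ surplus G x y (lookup S) + κ (lookup S u) (lookup S v) (+ c)) where

    private
      A : Subset n → ℤ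
      A S = surplus G x y (lookup S)

      lower upper : Subset n → Bool
      lower S = down (lookup S u) (lookup S v)
      upper S = up   (lookup S u) (lookup S v)

      neutral : ∀ S → lookup S u ≡ lookup S v → 0ℤ ≤ A S
      neutral S eq = subst (0ℤ ≤_) (trans (cong (_+_ (A S)) (zero-κ _ _ eq)) (+-identityʳ (A S))) (cut S)
        where
        zero-κ : ∀ a b → a ≡ b → κ a b (+ c) ≡ 0ℤ
        zero-κ true  .true  refl = refl
        zero-κ false .false refl = refl

      lower-cut : ∀ S → lower S ≡ true → - A S ≤ + c
      lower-cut S eq with lookup S u | lookup S v | cut S
      ... | true | false | q = ≤-from q (lem (A S) (+ c))
        where lem : ∀ a c → a + c ≡ c - - a
              lem = solve-∀

      upper-cut : ∀ S → upper S ≡ true → - + c ≤ A S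
      upper-cut S eq with lookup S u | lookup S v | cut S
      ... | false | true | q = ≤-from q (lem (A S) (+ c))
        where lem : ∀ a c → a + c ≡ a - - c
              lem = solve-∀

      crossing : ∀ S T → lower S ≡ true → upper T ≡ true → - A S ≤ A T
      crossing S T p q = ≤-from (≤-trans (+-mono-≤ (neutral (S ∩ T) ∩-neutral) (neutral (S ∪ T) ∪-neutral))
                                         (surplus-submodular G x y S T))
                                (lem (A S) (A T))
        where
        lem : ∀ a b → a + b ≡ b - - a
        lem = solve-∀
        ∧-lem : ∀ a b a′ b′ → down a b ≡ true → up a′ b′ ≡ true → a ∧ a′ ≡ b ∧ b′
        ∧-lem true false false true _ _ = refl
        ∨-lem : ∀ a b a′ b′ → down a b ≡ true → up a′ b′ ≡ true → a ∨ a′ ≡ b ∨ b′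
        ∨-lem true false false true _ _ = refl
        ∩-neutral : lookup (S ∩ T) u ≡ lookup (S ∩ T) v
        ∩-neutral = trans (lookup-zipWith _∧_ u S T)
          (trans (∧-lem (lookup S u) (lookup S v) _ _ p q) (sym (lookup-zipWith _∧_ v S T)))
        ∪-neutral : lookup (S ∪ T) u ≡ lookup (S ∪ T) v
        ∪-neutral = trans (lookup-zipWith _∨_ u S T)
          (trans (∨-lem (lookup S u) (lookup S v) _ _ p q) (sym (lookup-zipWith _∨_ v S T)))

    eliminate : ∃[ t ] (- + c ≤ t × t ≤ + c × Cut G (transfer u v t x) y)
    eliminate = t , t₀≤sup lower (-_ ∘ A) (- + c) Ss , proj₁ below , λ S →
      subst (0ℤ ≤_) (sym (surplus-transfer G x y (lookup S) u v t))
        (bounds⇒≤ (lookup S u) (lookup S v)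
          (≤sup lower (-_ ∘ A) (- + c) (∈-allSubsets S)) (proj₂ below S) (neutral S))
      where
      Ss = allSubsets n
      t : ℤ
      -- The smallest admissible flow: the largest of `- + c` and the lower bounds from cuts. As a
      -- maximum of integers it is an integer, so integrality is preserved from edge to edge.
      t = sup lower (-_ ∘ A) (- + c) Ss
      U : ℤ → Set
      U t = t ≤ + c × (∀ T → upper T ≡ true → t ≤ A T)
      below : U t
      below = sup-elim lower (-_ ∘ A) (- + c) U (neg-≤-pos {c} {c} , upper-cut)
        (λ S p → lower-cut S p , λ T q → crossing S T p q) Ss

  Cut⇒Feasible : ∀ {n m} (G : Multigraph n m) {x y} → Cut G x y → Feasible G x y
  -- Without edges, the surplus of a singleton is the coordinate at its node.
  Cut⇒Feasible {n} {zero} G {x} {y} p i = subst (0ℤ ≤_) eq (p ⁅ i ⁆)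
    where
    singleton : ∀ {n} (i j : Fin n) → ⟦ lookup ⁅ i ⁆ j ⟧ ≡ δ i j
    singleton zero    zero    = refl
    singleton zero    (suc j) = cong ⟦_⟧ (lookup-replicate j false)
    singleton (suc i) zero    = refl
    singleton (suc i) (suc j) = singleton i j
    eq : surplus G x y (lookup ⁅ i ⁆) ≡ x i
    eq = trans (+-identityʳ _) (trans
      (sum-cong-≗ λ j → trans (cong (_* x j) (singleton i j)) (*-comm (δ i j) (x j))) (sum-δ x i))
  Cut⇒Feasible {n} {suc m} G {x} {y} p = go (y zero) (λ S → subst (0ℤ ≤_) (surplus-delete G x y (lookup S)) (p S))
    where
    u = src G zero
    v = tgt G zero
    go : ∀ c → (∀ S → 0ℤ ≤ surplus (delete G) x (y ∘ suc) (lookup S) + κ (lookup S u) (lookup S v) c) →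
         Step c u v (λ x′ → Feasible (delete G) x′ (y ∘ suc)) x
    go (+ c) cut with eliminate (delete G) u v x (y ∘ suc) c cut
    ... | t , -c≤t , t≤c , q = t , -c≤t , t≤c , Cut⇒Feasible (delete G) q
    go -[1+ c ] cut = Cut⇒Feasible (delete G) λ S →
      subst (0ℤ ≤_) (sym (surplus-consume (delete G) x (y ∘ suc) (lookup S) u v -[1+ c ])) (cut S)

  -- Vectors are functions compared pointwise. The transport goes through the cuts because a surplus
  -- depends on values only, while flows would call for another induction over the edges.
  Feasible-resp : ∀ {n m} (G : Multigraph n m) {x x′ y y′} → x ≗ x′ → y ≗ y′ →
    Feasible G x y → Feasible G x′ y′
  Feasible-resp G x≗ y≗ = Cut⇒Feasible G ∘ Cut-resp G x≗ y≗ ∘ Feasible⇒Cut G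

-- Fibres of the contraction map are intervals

module ContractionFibres where

  open Graph
  open FlowsAndCuts
  open import Data.Bool.Base using (Bool; true; false)
  open import Data.Fin.Base using (Fin; zero; suc; punchIn; punchOut)
  open import Data.Fin.Properties using (_≟_; punchIn-punchOut; punchInᵢ≢i; punchIn-injective)
  open import Data.Fin.Subset using (Subset; ⁅_⁆)
  open import Data.Fin.Subset.Properties using (x∈⁅x⁆; x∈⁅y⁆⇒x≡y)
  open import Data.Integer.Base hiding (suc)
  open import Data.Integer.Properties hiding (_≟_)
  open import Data.Integer.Tactic.RingSolver using (solve-∀)
  open import Data.Nat.Base using (ℕ; zero; suc; z≤n)
  open import Data.Product.Base using (∃-syntax; _×_; _,_; proj₁; proj₂)
  open import Data.Sum.Base using (_⊎_; inj₁; inj₂)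
  open import Data.Vec.Base using (lookup)
  open import Data.Vec.Properties using ([]=⇒lookup; lookup⇒[]=)
  open import Function.Base using (_∘_)
  open import Function.Bundles using (_⇔_; mk⇔; Equivalence)
  open import Relation.Binary.PropositionalEquality
  open import Relation.Nullary using (yes; no; contradiction)

  transfer-cong : ∀ {n} {u v : Fin n} t {x x′} → x ≗ x′ → transfer u v t x ≗ transfer u v t x′
  transfer-cong {u = u} {v} t x≗ i = cong (_+ t * (δ u i - δ v i)) (x≗ i)

  consume-cong : ∀ {n} {u v : Fin n} t {x x′} → x ≗ x′ → consume u v t x ≗ consume u v t x′
  consume-cong {u = u} {v} t x≗ i = cong (_+ t * (δ u i + δ v i)) (x≗ i)

  transfer-inverse : ∀ {n} (u v : Fin n) t x → transfer u v t (transfer u v (- t) x) ≗ x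
  transfer-inverse u v t x i = lem (x i) t (δ u i - δ v i)
    where lem : ∀ a t d → a + - t * d + t * d ≡ a
          lem = solve-∀

  transfer-inverse′ : ∀ {n} (u v : Fin n) t x → transfer u v (- t) (transfer u v t x) ≗ x
  transfer-inverse′ u v t x i = lem (x i) t (δ u i - δ v i)
    where lem : ∀ a t d → a + t * d + - t * d ≡ a
          lem = solve-∀

  consume-inverse : ∀ {n} (u v : Fin n) t x → consume u v t (consume u v (- t) x) ≗ x
  consume-inverse u v t x i = lem (x i) t (δ u i + δ v i)
    where lem : ∀ a t d → a + - t * d + t * d ≡ a
          lem = solve-∀

  consume-inverse′ : ∀ {n} (u v : Fin n) t x → consume u v (- t) (consume u v t x) ≗ x
  consume-inverse′ u v t x i = lem (x i) t (δ u i + δ v i)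
    where lem : ∀ a t d → a + t * d + - t * d ≡ a
          lem = solve-∀

  module _ {n : ℕ} {u v : Fin (suc n)} (v≢u : v ≢ u) where

    private
      π = merge v≢u
      û = punchOut v≢u

    punch-ext : (P : Fin (suc n) → Set) → P v → (∀ k → P (punchIn v k)) → ∀ i → P i
    punch-ext P pv pk i with v ≟ i
    ... | yes refl = pv
    ... | no v≢i   = subst P (punchIn-punchOut v≢i) (pk (punchOut v≢i))

    private
      δ-punchIn : ∀ i k → δ (punchIn v i) (punchIn v k) ≡ δ i k
      δ-punchIn = δ-injective (punchIn v) (punchIn-injective v _ _)

      δv-punchIn : ∀ k → δ v (punchIn v k) ≡ 0ℤ
      δv-punchIn k = δ-≢ (punchInᵢ≢i v k ∘ sym)

      δu-punchIn : ∀ k → δ u (punchIn v k) ≡ δ û k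
      δu-punchIn k = trans (cong (λ i → δ i (punchIn v k)) (sym (punchIn-punchOut v≢u))) (δ-punchIn û k)

      δu-v : δ u v ≡ 0ℤ
      δu-v = δ-≢ (v≢u ∘ sym)

    -- The fibres of project are the lines in direction e_v - e_u.
    project : (Fin (suc n) → ℤ) → Fin n → ℤ
    project x k = x (punchIn v k) + x v * δ û k

    extend : (Fin n → ℤ) → Fin (suc n) → ℤ
    extend b i with v ≟ i
    ... | yes _   = 0ℤ
    ... | no v≢i = b (punchOut v≢i)

    -- A fibre is parametrised by its coordinate at `v`: `extend b` vanishes there, and `t` units
    -- are then moved from `u` to `v`.
    line : (Fin n → ℤ) → ℤ → Fin (suc n) → ℤ
    line b t = transfer v u t (extend b)

    extend-v : ∀ b → extend b v ≡ 0ℤ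
    extend-v b with v ≟ v
    ... | yes _  = refl
    ... | no v≢v = contradiction refl v≢v

    extend-punchIn : ∀ b k → extend b (punchIn v k) ≡ b k
    extend-punchIn b k with v ≟ punchIn v k
    ... | yes p   = contradiction (sym p) (punchInᵢ≢i v k)
    ... | no v≢p = cong b (punchIn-injective v _ _ (punchIn-punchOut v≢p))

    line-v : ∀ b t → line b t v ≡ t
    line-v b t = trans (cong₂ (λ a d → a + t * d) (extend-v b) (cong₂ _-_ (δ-refl v) δu-v)) (lem t)
      where lem : ∀ t → 0ℤ + t * (1ℤ - 0ℤ) ≡ t
            lem = solve-∀

    line-punchIn : ∀ b t k → line b t (punchIn v k) ≡ b k - t * δ û k
    line-punchIn b t k = trans
      (cong₂ (λ a d → a + t * d) (extend-punchIn b k) (cong₂ _-_ (δv-punchIn k) (δu-punchIn k)))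
      (lem (b k) t (δ û k))
      where lem : ∀ a t d → a + t * (0ℤ - d) ≡ a - t * d
            lem = solve-∀

    project-line : ∀ b t → project (line b t) ≗ b
    project-line b t k = trans (cong₂ (λ p q → p + q * δ û k) (line-punchIn b t k) (line-v b t))
                               (lem (b k) (t * δ û k))
      where lem : ∀ a d → a - d + d ≡ a
            lem = solve-∀

    line-project : ∀ x → line (project x) (x v) ≗ x
    line-project x = punch-ext _ (line-v (project x) (x v)) λ k →
      trans (line-punchIn (project x) (x v) k) (lem (x (punchIn v k)) (x v * δ û k))
      where lem : ∀ a d → a + d - d ≡ a
            lem = solve-∀

    line-cong : ∀ {b b′ t} → b ≗ b′ → line b t ≗ line b′ t
    line-cong {b} {b′} {t} b≗ = punch-ext _ (trans (line-v b t) (sym (line-v b′ t))) λ k →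
      trans (line-punchIn b t k)
        (trans (cong (λ a → a - t * δ û k) (b≗ k)) (sym (line-punchIn b′ t k)))

    project-cong : ∀ {x x′} → x ≗ x′ → project x ≗ project x′
    project-cong x≗ k = cong₂ (λ p q → p + q * δ û k) (x≗ _) (x≗ v)

    -- `project` is linear, so its compatibility with `transfer` and `consume` comes down to its
    -- values on unit vectors.
    project-δ : ∀ a k → δ a (punchIn v k) + δ a v * δ û k ≡ δ (π a) k
    project-δ a k with v ≟ a
    ... | yes refl = trans (cong₂ (λ p q → p + q * δ û k) (δv-punchIn k) (δ-refl v)) (lem (δ û k))
      where lem : ∀ d → 0ℤ + 1ℤ * d ≡ d
            lem = solve-∀
    ... | no v≢a = trans (cong₂ (λ p q → p + q * δ û k)
                            (trans (cong (λ i → δ i (punchIn v k)) (sym (punchIn-punchOut v≢a))) (δ-punchIn _ k))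
                            (δ-≢ (v≢a ∘ sym)))
                          (lem _ (δ û k))
      where lem : ∀ a d → a + 0ℤ * d ≡ a
            lem = solve-∀

    project-transfer : ∀ a b t x → project (transfer a b t x) ≗ transfer (π a) (π b) t (project x)
    project-transfer a b t x k = trans
      (lem (x (punchIn v k)) (x v) t (δ a (punchIn v k)) (δ b (punchIn v k)) (δ a v) (δ b v) (δ û k))
      (cong₂ (λ p q → project x k + t * (p - q)) (project-δ a k) (project-δ b k))
      where lem : ∀ x₁ x₂ t a₁ b₁ a₂ b₂ d →
                  (x₁ + t * (a₁ - b₁)) + (x₂ + t * (a₂ - b₂)) * d
                  ≡ (x₁ + x₂ * d) + t * ((a₁ + a₂ * d) - (b₁ + b₂ * d))
            lem = solve-∀

    project-consume : ∀ a b t x → project (consume a b t x) ≗ consume (π a) (π b) t (project x)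
    project-consume a b t x k = trans
      (lem (x (punchIn v k)) (x v) t (δ a (punchIn v k)) (δ b (punchIn v k)) (δ a v) (δ b v) (δ û k))
      (cong₂ (λ p q → project x k + t * (p + q)) (project-δ a k) (project-δ b k))
      where lem : ∀ x₁ x₂ t a₁ b₁ a₂ b₂ d →
                  (x₁ + t * (a₁ + b₁)) + (x₂ + t * (a₂ + b₂)) * d
                  ≡ (x₁ + x₂ * d) + t * ((a₁ + a₂ * d) + (b₁ + b₂ * d))
            lem = solve-∀

    feasible-project : ∀ {m} (G : Multigraph (suc n) m) {x y} →
      Feasible G x y → Feasible (contract v≢u G) (project x) y
    feasible-project {zero} G {x} p k = +-mono-≤ (p (punchIn v k)) (nonneg (p v) (δ-nonneg û k))
      where
      δ-nonneg : ∀ {n} (i j : Fin n) → 0ℤ ≤ δ i j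
      δ-nonneg zero    zero    = +≤+ z≤n
      δ-nonneg zero    (suc j) = ≤-refl
      δ-nonneg (suc i) zero    = ≤-refl
      δ-nonneg (suc i) (suc j) = δ-nonneg i j
      nonneg : ∀ {a b} → 0ℤ ≤ a → 0ℤ ≤ b → 0ℤ ≤ a * b
      nonneg {+ a} {+ b} _ _ = subst (0ℤ ≤_) (pos-* a b) (+≤+ z≤n)
    feasible-project {suc m} G {x} {y} = go (y zero)
      where
      G′ = contract v≢u (delete G)
      a = src G zero
      b = tgt G zero
      go : ∀ c → Step c a b (λ x′ → Feasible (delete G) x′ (y ∘ suc)) x →
        Step c (π a) (π b) (λ x′ → Feasible G′ x′ (y ∘ suc)) (project x)
      go (+ c) (t , p , q , r) = t , p , q ,
        Feasible-resp G′ (project-transfer a b t x) (λ _ → refl) (feasible-project (delete G) r)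
      go -[1+ c ] r =
        Feasible-resp G′ (project-consume a b -[1+ c ] x) (λ _ → refl) (feasible-project (delete G) r)

    -- The flows found in the contraction are used unchanged upstairs, and undoing them commutes
    -- with `project`. A choice is made only in the edgeless case, where the value of the merged
    -- node is left entirely at `u`.
    feasible-lift : ∀ {m} (G : Multigraph (suc n) m) {z y} →
      Feasible (contract v≢u G) z y → ∃[ x ] (project x ≗ z × Feasible G x y)
    feasible-lift {zero} G {z} p = line z 0ℤ , project-line z 0ℤ , punch-ext _
      (≤-reflexive (sym (line-v z 0ℤ)))
      (λ k → subst (0ℤ ≤_) (sym (trans (line-punchIn z 0ℤ k) (+-identityʳ (z k)))) (p k))
    feasible-lift {suc m} G {z} {y} = go (y zero)
      where
      G′ = contract v≢u (delete G)
      a = src G zero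
      b = tgt G zero
      go : ∀ c → Step c (π a) (π b) (λ x′ → Feasible G′ x′ (y ∘ suc)) z →
        ∃[ x ] (project x ≗ z × Step c a b (λ x′ → Feasible (delete G) x′ (y ∘ suc)) x)
      go (+ c) (t , p , q , r) with feasible-lift (delete G) r
      ... | x , eq , f = transfer a b (- t) x
        , (λ k → trans (project-transfer a b (- t) x k)
                   (trans (transfer-cong {u = π a} {π b} (- t) eq k) (transfer-inverse′ (π a) (π b) t z k)))
        , t , p , q , Feasible-resp (delete G) (λ i → sym (transfer-inverse a b t x i)) (λ _ → refl) f
      go -[1+ c ] r with feasible-lift (delete G) r
      ... | x , eq , f = consume a b (- -[1+ c ]) x
        , (λ k → trans (project-consume a b (- -[1+ c ]) x k)
                   (trans (consume-cong {u = π a} {π b} (- -[1+ c ]) eq k) (consume-inverse′ (π a) (π b) -[1+ c ] z k)))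
        , Feasible-resp (delete G) (λ i → sym (consume-inverse a b -[1+ c ] x i)) (λ _ → refl) f

    module _ {m : ℕ} (G : Multigraph (suc n) m) (b : Fin n → ℤ) (y : Fin m → ℤ) where

      private
        A : Subset (suc n) → ℤ
        A S = surplus G (extend b) y (lookup S)

        lower upper : Subset (suc n) → Bool
        lower S = down (lookup S v) (lookup S u)
        upper S = up   (lookup S v) (lookup S u)

        Ss = allSubsets (suc n)

        lookup-singleton : ∀ {n} {i j : Fin n} → i ≢ j → lookup ⁅ i ⁆ j ≡ false
        lookup-singleton {i = i} {j} i≢j with lookup ⁅ i ⁆ j in eq
        ... | true  = contradiction (sym (x∈⁅y⁆⇒x≡y i (lookup⇒[]= j ⁅ i ⁆ eq))) i≢j
        ... | false = refl

        lower-v : lower ⁅ v ⁆ ≡ true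
        lower-v = cong₂ down ([]=⇒lookup (x∈⁅x⁆ v)) (lookup-singleton v≢u)

        upper-u : upper ⁅ u ⁆ ≡ true
        upper-u = cong₂ up (lookup-singleton (v≢u ∘ sym)) ([]=⇒lookup (x∈⁅x⁆ u))

      opaque
        -- The extreme bounds from the node sets that separate `v` from `u`; `hi` is a minimum,
        -- written as a negated maximum. The start values come from the singletons of `v` and `u`,
        -- which are themselves separating sets, so they add no foreign bound.
        lo hi : ℤ
        lo = sup lower (-_ ∘ A) (- A ⁅ v ⁆) Ss
        hi = - sup upper (-_ ∘ A) (- A ⁅ u ⁆) Ss

      private
        opaque
          unfolding lo hi

          surplus-line : ∀ t → Feasible G (line b t) y →
            ∀ S → 0ℤ ≤ A S + t * (⟦ lookup S v ⟧ - ⟦ lookup S u ⟧)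
          surplus-line t f S = subst (0ℤ ≤_) (surplus-transfer G (extend b) y (lookup S) v u t)
                                               (Feasible⇒Cut G f S)

          lo≤ : ∀ t → Feasible G (line b t) y → lo ≤ t
          lo≤ t f = sup-elim lower (-_ ∘ A) (- A ⁅ v ⁆) (_≤ t) (low ⁅ v ⁆ lower-v) low Ss
            where
            low : ∀ S → lower S ≡ true → - A S ≤ t
            low S = ≤⇒down (lookup S v) (lookup S u) {A S} {t} (surplus-line t f S)

          ≤hi : ∀ t → Feasible G (line b t) y → t ≤ hi
          ≤hi t f = subst (_≤ hi) (neg-involutive t) (neg-mono-≤
            (sup-elim upper (-_ ∘ A) (- A ⁅ u ⁆) (_≤ - t) (upp ⁅ u ⁆ upper-u) upp Ss))
            where
            upp : ∀ S → upper S ≡ true → - A S ≤ - t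
            upp S eq = neg-mono-≤ (≤⇒up (lookup S v) (lookup S u) {A S} {t} (surplus-line t f S) eq)

      module _ (f : Feasible (contract v≢u G) b y) where

        private
          point : ∃[ t ] Feasible G (line b t) y
          point with feasible-lift G f
          ... | x , eq , r = x v ,
            Feasible-resp G (λ i → trans (sym (line-project x i)) (line-cong {t = x v} eq i)) (λ _ → refl) r

        lo≤hi : lo ≤ hi
        lo≤hi = ≤-trans (lo≤ (proj₁ point) (proj₂ point)) (≤hi (proj₁ point) (proj₂ point))

        opaque
          unfolding lo hi

          fibre : ∀ t → Feasible G (line b t) y ⇔ (lo ≤ t × t ≤ hi)
          fibre t = mk⇔ (λ r → lo≤ t r , ≤hi t r) λ (lo≤t , t≤hi) → Cut⇒Feasible G λ S →
            subst (0ℤ ≤_) (sym (surplus-transfer G (extend b) y (lookup S) v u t))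
              (bounds⇒≤ (lookup S v) (lookup S u) {A S} {t}
                (λ p → ≤-trans (≤sup lower (-_ ∘ A) (- A ⁅ v ⁆) (∈-allSubsets S) p) lo≤t)
                (λ p → ≤-trans t≤hi (subst (hi ≤_) (neg-involutive (A S))
                         (neg-mono-≤ (≤sup upper (-_ ∘ A) (- A ⁅ u ⁆) (∈-allSubsets S) p))))
                -- A set that does not separate `u` and `v` imposes a condition without `t`. It
                -- holds along the whole line because it holds at one feasible point, supplied by
                -- lifting.
                (≤⇒neutral (lookup S v) (lookup S u) {A S} {proj₁ point}
                  (surplus-line (proj₁ point) (proj₂ point) S)))

      -- The extra edge joins `u` and `v`, so its flow slides a point along its own fibre. The slice
      -- over `b` is thus the Minkowski sum of the fibre with the interval from `- c` to `c`.
      thickened-fibre : ∀ c t → Step (+ c) u v (λ x → Feasible G x y) (line b t)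
        ⇔ (Feasible (contract v≢u G) b y × lo - + c ≤ t × t ≤ hi + + c)
      thickened-fibre c t = mk⇔ to from
        where
        shift : ∀ s → transfer u v s (line b t) ≗ line b (t - s)
        shift s i = lem (extend b i) s t (δ u i) (δ v i)
          where lem : ∀ e s t p q → e + t * (q - p) + s * (p - q) ≡ e + (t - s) * (q - p)
                lem = solve-∀

        to : Step (+ c) u v (λ x → Feasible G x y) (line b t) →
          Feasible (contract v≢u G) b y × lo - + c ≤ t × t ≤ hi + + c
        to (s , -c≤s , s≤c , r) = base , lower-bound , upper-bound
          where
          r′ : Feasible G (line b (t - s)) y
          r′ = Feasible-resp G (shift s) (λ _ → refl) r
          base : Feasible (contract v≢u G) b y
          base = Feasible-resp (contract v≢u G) (project-line b (t - s)) (λ _ → refl) (feasible-project G r′)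
          recover : ∀ t s → t - s + s ≡ t
          recover = solve-∀
          lower-bound : lo - + c ≤ t
          lower-bound = subst (lo - + c ≤_) (recover t s) (+-mono-≤ (lo≤ (t - s) r′) -c≤s)
          upper-bound : t ≤ hi + + c
          upper-bound = subst (_≤ hi + + c) (recover t s) (+-mono-≤ (≤hi (t - s) r′) s≤c)

        from : Feasible (contract v≢u G) b y × lo - + c ≤ t × t ≤ hi + + c →
          Step (+ c) u v (λ x → Feasible G x y) (line b t)
        from (f , l , h) = choose (≤-total lo t) (≤-total t hi)
          where
          lem₁ : ∀ l t c → t - (l - c) ≡ t - l - - c
          lem₁ = solve-∀
          lem₂ : ∀ h t c → h + c - t ≡ c - (t - h)
          lem₂ = solve-∀
          lem₃ : ∀ t r → r ≡ t - (t - r)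
          lem₃ = solve-∀
          flow : ∀ r → lo ≤ r → r ≤ hi → - + c ≤ t - r → t - r ≤ + c →
            Step (+ c) u v (λ x → Feasible G x y) (line b t)
          flow r lo≤r r≤hi p q = t - r , p , q , Feasible-resp G
            (λ i → trans (cong (λ w → line b w i) (lem₃ t r)) (sym (shift (t - r) i))) (λ _ → refl)
            (Equivalence.from (fibre f r) (lo≤r , r≤hi))
          -- The flow is taken to the point of the fibre nearest to `t`: `t` itself, or the end
          -- beyond which it lies.
          choose : lo ≤ t ⊎ t ≤ lo → t ≤ hi ⊎ hi ≤ t → Step (+ c) u v (λ x → Feasible G x y) (line b t)
          choose (inj₁ lo≤t) (inj₁ t≤hi) = flow t lo≤t t≤hi
              (subst (- + c ≤_) (sym (+-inverseʳ t)) (neg-≤-pos {c} {0}))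
              (subst (_≤ + c) (sym (+-inverseʳ t)) (+≤+ z≤n))
          choose (inj₂ t≤lo) _ = flow lo ≤-refl (lo≤hi f)
              (≤-from (i≤j⇒0≤j-i l) (lem₁ lo t (+ c)))
              (≤-trans (i≤j⇒i-j≤0 t≤lo) (+≤+ z≤n))
          choose _ (inj₂ hi≤t) = flow hi (lo≤hi f) ≤-refl
              (≤-trans (neg-≤-pos {c} {0}) (i≤j⇒0≤j-i hi≤t))
              (≤-from (i≤j⇒0≤j-i h) (lem₂ hi t (+ c)))

-- Cardinalities witnessed by lists without repetition

module Cardinality where

  open import Data.Integer.Base as ℤ using (ℤ; +_; ∣_∣)
  import Data.Integer.Properties as ℤ
  open import Data.Integer.Tactic.RingSolver using (solve-∀)
  open import Data.List.Base using (List; []; _∷_; _++_; map; upTo)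
  open import Data.List.Membership.Propositional using (_∈_)
  open import Data.List.Membership.Propositional.Properties
    using (∈-map⁺; ∈-map⁻; ∈-++⁺ˡ; ∈-++⁺ʳ; ∈-++⁻; ∈-upTo⁺; ∈-upTo⁻)
  open import Data.List.Membership.Propositional.Properties.WithK using (unique∧set⇒bag)
  open import Data.List.Properties using (length-map; length-++; length-upTo)
  open import Data.List.Relation.Binary.BagAndSetEquality using (∼bag⇒↭)
  open import Data.List.Relation.Binary.Permutation.Propositional.Properties using (↭-length)
  open import Data.List.Relation.Unary.All as All using ()
  open import Data.List.Relation.Unary.AllPairs using ([]; _∷_)
  open import Data.List.Relation.Unary.Any using (here; there)
  open import Data.List.Relation.Unary.Unique.Propositional using (Unique)
  open import Data.List.Relation.Unary.Unique.Propositional.Properties as Unique using ()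
  open import Data.Nat.Base using (ℕ; suc; _+_; z≤n; s≤s)
  open import Data.Nat.ListAction using (sum)
  import Data.Nat.Properties as ℕ
  open import Data.Product.Base using (_×_; _,_; proj₁; proj₂)
  open import Data.Sum.Base using (inj₁; inj₂)
  open import Function.Base using (_∘_)
  open import Function.Bundles using (mk⇔; Equivalence)
  open import Level using (0ℓ)
  open import Relation.Binary.PropositionalEquality
  open import Relation.Unary using (Pred)

  open Equivalence using (to; from)

  -- Allows a count made fibre by fibre to be equated with a count already known.
  card-unique : {A : Set} {S : Pred A 0ℓ} {k l : ℕ} → HasCardinality S k → HasCardinality S l → k ≡ l
  card-unique (xs , xs! , ∈xs , refl) (ys , ys! , ∈ys , refl) =
    ↭-length (∼bag⇒↭ (unique∧set⇒bag xs! ys! λ {x} →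
      mk⇔ (from (∈ys x) ∘ to (∈xs x)) (from (∈xs x) ∘ to (∈ys x))))

  -- `f (g b) ≡ b` is asked only on `T`: an integer vector with a negative entry, say, is not the
  -- image of a composition into natural numbers.
  card-image : {A B : Set} {S : Pred A 0ℓ} {T : Pred B 0ℓ} {k : ℕ} (f : A → B) (g : B → A) →
    (∀ a → g (f a) ≡ a) → (∀ {b} → T b → f (g b) ≡ b) →
    (∀ {a} → S a → T (f a)) → (∀ {b} → T b → S (g b)) →
    HasCardinality S k → HasCardinality T k
  card-image {T = T} f g gf fg S⇒T T⇒S (xs , xs! , ∈xs , refl) = map f xs ,
    Unique.map⁺ (λ {a} {a′} eq → trans (sym (gf a)) (trans (cong g eq) (gf a′))) xs! ,
    (λ b → mk⇔ (image b) λ t → subst (_∈ map f xs) (fg t) (∈-map⁺ f (from (∈xs (g b)) (T⇒S t)))) ,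
    length-map f xs
    where
    image : ∀ b → b ∈ map f xs → T b
    image b p with ∈-map⁻ f p
    ... | a , a∈ , refl = S⇒T (to (∈xs a) a∈)

  card-resp : {A : Set} {S T : Pred A 0ℓ} {k : ℕ} →
    (∀ {a} → S a → T a) → (∀ {a} → T a → S a) → HasCardinality S k → HasCardinality T k
  card-resp S⇒T T⇒S (xs , xs! , ∈xs , eq) = xs , xs! ,
    (λ a → mk⇔ (S⇒T ∘ to (∈xs a)) (from (∈xs a) ∘ T⇒S)) , eq

  card-Σ : {I A : Set} {T : I → Pred A 0ℓ} {k : I → ℕ} {is : List I} → Unique is →
    (∀ i → i ∈ is → HasCardinality (T i) (k i)) →
    HasCardinality (λ (i , a) → i ∈ is × T i a) (sum (map k is))
  card-Σ [] h = [] , [] , (λ _ → mk⇔ (λ ()) (λ ())) , refl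
  card-Σ {T = T} {k} {i ∷ is} (i∉ ∷ is!) h
    with h i (here refl) | card-Σ is! (λ j j∈ → h j (there j∈))
  ... | xs , xs! , ∈xs , ∣xs∣ | ys , ys! , ∈ys , ∣ys∣ =
    map (i ,_) xs ++ ys ,
    Unique.++⁺ (Unique.map⁺ (cong proj₂) xs!) ys! disjoint ,
    (λ p → mk⇔ (fwd p) (bwd p)) ,
    trans (length-++ (map (i ,_) xs)) (cong₂ _+_ (trans (length-map (i ,_) xs) ∣xs∣) ∣ys∣)
    where
    disjoint : ∀ {p} → p ∈ map (i ,_) xs × p ∈ ys → _
    disjoint (p , q) with ∈-map⁻ (i ,_) p
    ... | a , _ , refl = All.lookup i∉ (proj₁ (to (∈ys _) q)) refl
    fwd : ∀ p → p ∈ map (i ,_) xs ++ ys → proj₁ p ∈ i ∷ is × T (proj₁ p) (proj₂ p)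
    fwd p q with ∈-++⁻ (map (i ,_) xs) q
    ... | inj₂ r = there (proj₁ (to (∈ys p) r)) , proj₂ (to (∈ys p) r)
    ... | inj₁ r with ∈-map⁻ (i ,_) r
    ...   | a , a∈ , refl = here refl , to (∈xs a) a∈
    bwd : ∀ p → proj₁ p ∈ i ∷ is × T (proj₁ p) (proj₂ p) → p ∈ map (i ,_) xs ++ ys
    bwd (_ , a) (here refl , t) = ∈-++⁺ˡ (∈-map⁺ (i ,_) (from (∈xs a) t))
    bwd (j , a) (there j∈ , t)  = ∈-++⁺ʳ (map (i ,_) xs) (from (∈ys (j , a)) (j∈ , t))

  card-interval : ∀ {lo hi} → lo ℤ.≤ hi →
    HasCardinality (λ t → lo ℤ.≤ t × t ℤ.≤ hi) (suc ∣ hi ℤ.- lo ∣)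
  card-interval {lo} {hi} lo≤hi = card-image {S = _∈ upTo (suc ∣ hi ℤ.- lo ∣)}
    (λ k → lo ℤ.+ + k) (λ t → ∣ t ℤ.- lo ∣)
    (λ k → cong ∣_∣ (lem₁ lo (+ k)))
    (λ {t} (p , _) → trans (cong (ℤ._+_ lo) (ℤ.0≤i⇒+∣i∣≡i (ℤ.i≤j⇒0≤j-i p))) (lem₂ lo t))
    (λ {k} k∈ → subst (ℤ._≤ lo ℤ.+ + k) (ℤ.+-identityʳ lo) (ℤ.+-monoʳ-≤ lo (ℤ.+≤+ z≤n)) ,
      subst (lo ℤ.+ + k ℤ.≤_) (lem₂ lo hi) (ℤ.+-monoʳ-≤ lo
        (subst (+ k ℤ.≤_) ∣w∣ (ℤ.+≤+ (ℕ.≤-pred (∈-upTo⁻ k∈))))))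
    (λ {t} (p , q) → ∈-upTo⁺ (s≤s (ℤ.drop‿+≤+ (subst₂ ℤ._≤_
        (sym (ℤ.0≤i⇒+∣i∣≡i (ℤ.i≤j⇒0≤j-i p))) (sym ∣w∣) (ℤ.+-monoˡ-≤ (ℤ.- lo) q)))))
    (upTo (suc ∣ hi ℤ.- lo ∣) , Unique.upTo⁺ _ , (λ _ → mk⇔ (λ p → p) (λ p → p)) , length-upTo _)
    where
    ∣w∣ : + ∣ hi ℤ.- lo ∣ ≡ hi ℤ.- lo
    ∣w∣ = ℤ.0≤i⇒+∣i∣≡i (ℤ.i≤j⇒0≤j-i lo≤hi)
    lem₁ : ∀ l k → l ℤ.+ k ℤ.- l ≡ k
    lem₁ = solve-∀
    lem₂ : ∀ l t → l ℤ.+ (t ℤ.- l) ≡ t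
    lem₂ = solve-∀

-- Counting the points of the cone slice by slice

module CountingPoints where

  open Graph
  open FlowsAndCuts
  open ContractionFibres
  open Cardinality
  open import Data.Fin.Base using (Fin; zero; suc; punchIn; punchOut)
  open import Data.Integer.Base hiding (suc)
  open import Data.Integer.Properties hiding (_≟_)
  open import Data.Integer.Tactic.RingSolver using (solve-∀)
  open import Data.List.Base as List using (List; []; _∷_; _++_; length; upTo)
  open import Data.List.Membership.Propositional using (_∈_)
  open import Data.List.Membership.Propositional.Properties
    using (∈-map⁺; ∈-map⁻; ∈-++⁺ˡ; ∈-++⁺ʳ; ∈-++⁻; ∈-upTo⁺; ∈-upTo⁻)
  open import Data.List.Properties using (map-++; map-∘)
  open import Data.List.Relation.Unary.Any using (here; there)
  open import Data.List.Relation.Unary.Unique.Propositional using (Unique)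
  open import Data.List.Relation.Unary.Unique.Propositional.Properties as Unique using ()
  open import Data.Nat.Base as ℕ using (ℕ; zero; suc; z≤n; s≤s)
  import Data.Nat.Properties as ℕ
  import Data.Nat.ListAction as ℕ using (sum)
  import Data.Nat.ListAction.Properties as ℕ using (sum-++)
  open import Data.Nat.Tactic.RingSolver using () renaming (solve-∀ to solve-∀ℕ)
  open import Data.Product.Base using (_×_; _,_; proj₁; proj₂)
  open import Data.Sum.Base using (inj₁; inj₂)
  open import Data.Vec.Base as Vec using (Vec; lookup; tabulate)
  open import Data.Vec.Functional using (removeAt)
  open import Data.Vec.Properties using (tabulate∘lookup; lookup∘tabulate; tabulate-cong)
  open import Function.Base using (_∘_; case_of_)
  open import Function.Bundles using (Equivalence)
  open import Level using (0ℓ)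
  open import Relation.Binary.PropositionalEquality hiding (resp)
  open import Relation.Unary using (Pred)

  open import Algebra.Properties.Semiring.Sum +-*-semiring using (sum-remove)

  open Equivalence using (to; from)

  private
    sum-1* : ∀ {n} (x : Fin n → ℤ) → sum (λ i → 1ℤ * x i) ≡ sum x
    sum-1* x = sum-cong-≗ (λ i → *-identityˡ (x i))

  module _ {n : ℕ} (u v : Fin n) (t : ℤ) (x : Fin n → ℤ) where

    total-transfer : sum (transfer u v t x) ≡ sum x
    total-transfer = trans (sym (sum-1* (transfer u v t x)))
      (trans (sum-transfer (λ _ → 1ℤ) x u v t) (trans (cong₂ _+_ (sum-1* x) (*-zeroʳ t)) (+-identityʳ _)))

    total-consume : sum (consume u v t x) ≡ sum x + t * + 2
    total-consume = trans (sym (sum-1* (consume u v t x)))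
      (trans (sum-consume (λ _ → 1ℤ) x u v t) (cong (λ s → s + t * + 2) (sum-1* x)))

  total-project : ∀ {n} {u v : Fin (suc n)} (v≢u : v ≢ u) x → sum (project v≢u x) ≡ sum x
  total-project {u = u} {v} v≢u x = begin
    sum (λ k → x (punchIn v k) + x v * δ û k)   ≡⟨ sum-cong-≗ (λ k → cong (_+ x v * δ û k) (*-identityˡ (x (punchIn v k)))) ⟨
    sum (λ k → 1ℤ * x (punchIn v k) + x v * δ û k)
      ≡⟨ ∑-distrib-+ (λ k → 1ℤ * x (punchIn v k)) (λ k → x v * δ û k) ⟩
    sum (λ k → 1ℤ * x (punchIn v k)) + sum (λ k → x v * δ û k)
      ≡⟨ cong₂ _+_ (sum-1* (x ∘ punchIn v)) (sum-δ (λ _ → x v) û) ⟩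
    sum (removeAt x v) + x v                    ≡⟨ +-comm (sum (removeAt x v)) (x v) ⟩
    x v + sum (removeAt x v)                    ≡⟨ sum-remove {i = v} x ⟨
    sum x                                       ∎
    where
    open ≡-Reasoning
    û = punchOut v≢u

  Step-resp : ∀ {n} {u v : Fin n} {R : (Fin n → ℤ) → Set} →
    (∀ {x x′} → x ≗ x′ → R x → R x′) → ∀ c {x x′} → x ≗ x′ → Step c u v R x → Step c u v R x′
  Step-resp {u = u} {v} resp (+ c) x≗ (t , p , q , r) =
    t , p , q , resp (transfer-cong {u = u} {v} t x≗) r
  Step-resp {u = u} {v} resp -[1+ c ] x≗ r = resp (consume-cong {u = u} {v} -[1+ c ] x≗) r

  -- The total of a feasible point is ∑ ∣ y f ∣ plus the sum of a nonnegative vector.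
  step-total : ∀ {n} {u v : Fin n} {R : (Fin n → ℤ) → Set} {r : ℤ} →
    (∀ {x} → R x → 0ℤ ≤ sum x + r) → ∀ c {x} → Step c u v R x → + ∣ c ∣ ≤ sum x + (c + r)
  step-total {u = u} {v} {r = r} h (+ c) {x} (t , _ , _ , p) = ≤-from
    (subst (λ s → 0ℤ ≤ s + r) (total-transfer u v t x) (h p)) (lem (sum x) r (+ c))
    where lem : ∀ s r c → s + r ≡ s + (c + r) - c
          lem = solve-∀
  step-total {u = u} {v} {r = r} h -[1+ c ] {x} p = ≤-from
    (subst (λ s → 0ℤ ≤ s + r) (total-consume u v -[1+ c ] x) (h p)) (lem (sum x) r -[1+ c ])
    where lem : ∀ s r c → s + c * + 2 + r ≡ s + (c + r) - (- c)
          lem = solve-∀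

  feasible-total : ∀ {n m} (G : Multigraph n m) {x y} → Feasible G x y → 0ℤ ≤ sum x + sum y
  feasible-total {n} {zero} G {x} p = subst (0ℤ ≤_) (sym (+-identityʳ (sum x)))
    (subst (_≤ sum x) (sum-replicate-zero n) (sum-mono p))
  feasible-total {n} {suc m} G {x} {y} p =
    ≤-trans (+≤+ z≤n) (step-total {r = sum (y ∘ suc)} (feasible-total (delete G)) (y zero) p)

  Point : ℕ → ℕ → Set
  Point n m = Vec ℤ n × Vec ℤ m

  total : ∀ {n m} → Point n m → ℤ
  total (x , y) = sum (lookup x) + sum (lookup y)

  Points : ∀ {n m} → Multigraph n m → ℕ → Pred (Point n m) 0ℓ
  Points G j p@(x , y) = Feasible G (lookup x) (lookup y) × total p ≡ + j

  -- The points of the slice y zero ≡ c, with that coordinate left out.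
  Slice : ∀ {n m} → Fin n → Fin n → Multigraph n m → ℤ → ℤ → Pred (Point n m) 0ℓ
  Slice u v G c l p@(x , y) = Step c u v (λ x′ → Feasible G x′ (lookup y)) (lookup x) × total p ≡ l

  tabulate-lookup : ∀ {n} {f : Fin n → ℤ} {x : Vec ℤ n} → f ≗ lookup x → tabulate f ≡ x
  tabulate-lookup {x = x} f≗ = trans (tabulate-cong f≗) (tabulate∘lookup x)

  module _ {n m : ℕ} (G : Multigraph n m) (u v : Fin n) where

    slice-zero : ∀ {j k} → HasCardinality (Points G j) k → HasCardinality (Slice u v G 0ℤ (+ j)) k
    slice-zero = card-resp
      (λ {(x , y)} (f , eq) → (0ℤ , ≤-refl , ≤-refl , Feasible-resp G (λ i → sym (+-identityʳ (lookup x i))) (λ _ → refl) f) , eq)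
      (λ {(x , y)} ((t , p , q , f) , eq) →
        Feasible-resp G (λ i → trans (cong (λ t → lookup x i + t * (δ u i - δ v i)) (≤-antisym q p)) (+-identityʳ (lookup x i))) (λ _ → refl) f , eq)

    -- No flow is involved: the slice is a translate of the cone of the remaining graph. Both ends
    -- lose the weight, so the total drops by twice its size.
    slice-negative : ∀ c {j l k} → + j ≡ l + -[1+ c ] * + 2 →
      HasCardinality (Points G j) k → HasCardinality (Slice u v G -[1+ c ] l) k
    slice-negative c {j} {l} eq = card-image (move (- C)) (move C)
      (λ (x , y) → cong (_, y) (tabulate-lookup λ i →
        trans (consume-cong {u = u} {v} C (lookup-move (- C) (x , y)) i) (consume-inverse u v C (lookup x) i)))
      (λ {(x , y)} _ → cong (_, y) (tabulate-lookup λ i →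
        trans (consume-cong {u = u} {v} (- C) (lookup-move C (x , y)) i) (consume-inverse′ u v C (lookup x) i)))
      (λ {(x , y)} (f , eq′) →
        Feasible-resp G (λ i → sym (trans (consume-cong {u = u} {v} C (lookup-move (- C) (x , y)) i)
                                          (consume-inverse u v C (lookup x) i))) (λ _ → refl) f ,
        trans (total-move (- C) (x , y)) (trans (cong (_+ - C * + 2) (trans eq′ eq)) (lem l C)))
      (λ {(x , y)} (f , eq′) →
        Feasible-resp G (λ i → sym (lookup-move C (x , y) i)) (λ _ → refl) f ,
        trans (total-move C (x , y)) (trans (cong (_+ C * + 2) eq′) (sym eq)))
      where
      C = -[1+ c ]
      move : ℤ → Point n m → Point n m
      move t (x , y) = tabulate (consume u v t (lookup x)) , y
      lookup-move : ∀ t p → lookup (proj₁ (move t p)) ≗ consume u v t (lookup (proj₁ p))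
      lookup-move t (x , y) = lookup∘tabulate (consume u v t (lookup x))
      total-move : ∀ t p → total (move t p) ≡ total p + t * + 2
      total-move t (x , y) = trans
        (cong (_+ sum (lookup y)) (trans (sum-cong-≗ (lookup-move t (x , y))) (total-consume u v t (lookup x))))
        (lem′ (sum (lookup x)) (t * + 2) (sum (lookup y)))
        where lem′ : ∀ a b c → a + b + c ≡ a + c + b
              lem′ = solve-∀
      lem : ∀ l c → l + c * + 2 + - c * + 2 ≡ l
      lem = solve-∀

  -- A flow along a loop ends at the node where it began, so the weight of the loop does not enlarge
  -- the slice.
  slice-loop : ∀ {n m} (G : Multigraph n m) (u : Fin n) c {j k} →
    HasCardinality (Points G j) k → HasCardinality (Slice u u G (+ c) (+ j)) k
  slice-loop G u c = card-resp
    (λ {(x , y)} (f , eq) → (0ℤ , neg-≤-pos {c} {0} , +≤+ z≤n ,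
      Feasible-resp G (λ i → sym (+-identityʳ (lookup x i))) (λ _ → refl) f) , eq)
    (λ {(x , y)} ((t , p , q , f) , eq) → Feasible-resp G (λ i → lem (lookup x i) t (δ u i)) (λ _ → refl) f , eq)
    where lem : ∀ x t d → x + t * (d - d) ≡ x
          lem = solve-∀

  -- Each fibre of the contraction map grows by c at both ends.
  module _ {n m : ℕ} {u v : Fin (suc n)} (v≢u : v ≢ u) (G : Multigraph (suc n) m) {j : ℕ} where

    private
      low high : Point n m → ℤ
      low  (b , y) = lo v≢u G (lookup b) (lookup y)
      high (b , y) = hi v≢u G (lookup b) (lookup y)

      -- The sum runs over the explicit list of base points, since the fibres over them differ in
      -- length.
      fibrewise : ∀ c {k} ((bs , _) : HasCardinality (Points (contract v≢u G) j) k) →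
        HasCardinality (Slice u v G (+ c) (+ j))
          (ℕ.sum (List.map (λ b → suc ∣ (high b + + c) - (low b - + c) ∣) bs))
      fibrewise c (bs , bs! , ∈bs , _) = card-image
          f g gf (λ {q} → fg {q}) (λ {p} → S⇒T {p}) (λ {q} → T⇒S {q})
          (card-Σ bs! λ b b∈ → card-interval (wide b (proj₁ (to (∈bs b) b∈))))
        where
        f : Point n m × ℤ → Point (suc n) m
        f ((b , y) , t) = tabulate (line v≢u (lookup b) t) , y
        g : Point (suc n) m → Point n m × ℤ
        g (x , y) = (tabulate (project v≢u (lookup x)) , y) , lookup x v

        gf : ∀ p → g (f p) ≡ p
        gf ((b , y) , t) = cong₂ (λ b t → (b , y) , t)
          (tabulate-lookup λ k → trans (project-cong v≢u (lookup∘tabulate (line v≢u (lookup b) t)) k)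
                                       (project-line v≢u (lookup b) t k))
          (trans (lookup∘tabulate (line v≢u (lookup b) t) v) (line-v v≢u (lookup b) t))

        line-project′ : ∀ x → line v≢u (lookup (tabulate (project v≢u (lookup x)))) (lookup x v) ≗ lookup x
        line-project′ x i = trans (line-cong v≢u {t = lookup x v} (lookup∘tabulate (project v≢u (lookup x))) i)
                                  (line-project v≢u (lookup x) i)

        fg : ∀ {q} → Slice u v G (+ c) (+ j) q → f (g q) ≡ q
        fg {x , y} _ = cong (_, y) (tabulate-lookup (line-project′ x))

        wide : ∀ ((b , y) : Point n m) → Feasible (contract v≢u G) (lookup b) (lookup y) →
          low (b , y) - + c ≤ high (b , y) + + c
        wide (b , y) r = +-mono-≤ (lo≤hi v≢u G (lookup b) (lookup y) r) (neg-≤-pos {c} {c})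

        resp : ∀ {y : Fin m → ℤ} {x x′} → x ≗ x′ →
          Step (+ c) u v (λ x → Feasible G x y) x → Step (+ c) u v (λ x → Feasible G x y) x′
        resp = Step-resp {u = u} {v} (λ x≗ → Feasible-resp G x≗ (λ _ → refl)) (+ c)

        S⇒T : ∀ {p} → proj₁ p ∈ bs × (low (proj₁ p) - + c ≤ proj₂ p × proj₂ p ≤ high (proj₁ p) + + c) →
          Slice u v G (+ c) (+ j) (f p)
        S⇒T {(b , y) , t} (b∈ , l , h) =
          resp (λ i → sym (lookup∘tabulate (line v≢u (lookup b) t) i))
               (from (thickened-fibre v≢u G (lookup b) (lookup y) c t) (proj₁ (to (∈bs (b , y)) b∈) , l , h)) ,
          trans (cong (_+ sum (lookup y)) (begin
            sum (lookup (tabulate (line v≢u (lookup b) t))) ≡⟨ sum-cong-≗ (lookup∘tabulate (line v≢u (lookup b) t)) ⟩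
            sum (line v≢u (lookup b) t)                     ≡⟨ total-project v≢u (line v≢u (lookup b) t) ⟨
            sum (project v≢u (line v≢u (lookup b) t))       ≡⟨ sum-cong-≗ (project-line v≢u (lookup b) t) ⟩
            sum (lookup b)                                  ∎)) (proj₂ (to (∈bs (b , y)) b∈))
          where open ≡-Reasoning

        T⇒S : ∀ {q} → Slice u v G (+ c) (+ j) q → proj₁ (g q) ∈ bs ×
          (low (proj₁ (g q)) - + c ≤ proj₂ (g q) × proj₂ (g q) ≤ high (proj₁ (g q)) + + c)
        T⇒S {x , y} (s , eq) = from (∈bs (b , y)) (proj₁ inside , total-b) , proj₂ inside
          where
          b : Vec ℤ n
          b = tabulate (project v≢u (lookup x))
          inside : Feasible (contract v≢u G) (lookup b) (lookup y) ×
            (low (b , y) - + c ≤ lookup x v × lookup x v ≤ high (b , y) + + c)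
          inside = to (thickened-fibre v≢u G (lookup b) (lookup y) c (lookup x v))
                      (resp (λ i → sym (line-project′ x i)) s)
          total-b : sum (lookup b) + sum (lookup y) ≡ + j
          total-b = trans (cong (_+ sum (lookup y)) (trans
            (sum-cong-≗ (lookup∘tabulate (project v≢u (lookup x)))) (total-project v≢u (lookup x)))) eq

      -- Every interval gains `2 * c` points over the case `c = 0`, so the difference depends on the
      -- number of fibres alone. The zeros on the right are kept so that the sum is literally the
      -- count given by `fibrewise 0`.
      widths : ∀ c (bs : List (Point n m)) → (∀ {b} → b ∈ bs → low b ≤ high b) →
        ℕ.sum (List.map (λ b → suc ∣ (high b + + c) - (low b - + c) ∣) bs)
        ≡ ℕ.sum (List.map (λ b → suc ∣ (high b + 0ℤ) - (low b - 0ℤ) ∣) bs) ℕ.+ 2 ℕ.* c ℕ.* length bs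
      widths c []       _ = sym (ℕ.*-zeroʳ (2 ℕ.* c))
      widths c (b ∷ bs) h = trans
        (cong₂ (λ w s → suc w ℕ.+ s) (width (low b) (high b) (h (here refl))) (widths c bs (h ∘ there)))
        (lem₂ ∣ high b + 0ℤ - (low b - 0ℤ) ∣ (ℕ.sum (List.map (λ b → suc ∣ (high b + 0ℤ) - (low b - 0ℤ) ∣) bs))
          c (length bs))
        where
        lem₂ : ∀ w s c k → suc (w ℕ.+ 2 ℕ.* c) ℕ.+ (s ℕ.+ 2 ℕ.* c ℕ.* k) ≡ (suc w ℕ.+ s) ℕ.+ 2 ℕ.* c ℕ.* suc k
        lem₂ = solve-∀ℕ
        lem₁ : ∀ l h c → h + c - (l - c) ≡ h + 0ℤ - (l - 0ℤ) + + 2 * c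
        lem₁ = solve-∀
        width : ∀ l h → l ≤ h → ∣ h + + c - (l - + c) ∣ ≡ ∣ h + 0ℤ - (l - 0ℤ) ∣ ℕ.+ 2 ℕ.* c
        width l h l≤h = begin
          ∣ h + + c - (l - + c) ∣               ≡⟨ cong ∣_∣ (lem₁ l h (+ c)) ⟩
          ∣ w + + 2 * + c ∣                     ≡⟨ cong (λ z → ∣ z + + 2 * + c ∣) (0≤i⇒+∣i∣≡i 0≤w) ⟨
          ∣ + ∣ w ∣ + + 2 * + c ∣               ≡⟨ cong (λ z → ∣ + ∣ w ∣ + z ∣) (pos-* 2 c) ⟨
          ∣ w ∣ ℕ.+ 2 ℕ.* c                     ∎
          where
          open ≡-Reasoning
          w = h + 0ℤ - (l - 0ℤ)
          0≤w : 0ℤ ≤ w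
          0≤w = i≤j⇒0≤j-i (+-mono-≤ l≤h (≤-refl {0ℤ}))

    -- For `c = 0` the slice is the point set of `G` itself. Uniqueness of cardinality therefore
    -- identifies the total length of the fibres with `N`, and only the increment for `M` fibres is
    -- added.
    slice-fibres : ∀ c {M N} → HasCardinality (Points (contract v≢u G) j) M → HasCardinality (Points G j) N →
      HasCardinality (Slice u v G (+ c) (+ j)) (N ℕ.+ 2 ℕ.* c ℕ.* M)
    slice-fibres c hM@(bs , _ , ∈bs , refl) hN = subst (HasCardinality (Slice u v G (+ c) (+ j)))
      (trans (widths c bs (λ {(b , y)} b∈ → lo≤hi v≢u G (lookup b) (lookup y) (proj₁ (to (∈bs _) b∈))))
             (cong (ℕ._+ 2 ℕ.* c ℕ.* length bs)
                   (card-unique (fibrewise 0 hM) (slice-zero G u v hN))))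
      (fibrewise c hM)

  module _ {n m : ℕ} (G : Multigraph n (suc m)) {j : ℕ} (a b : ℕ → ℕ)
    (a-card : ∀ {k} → k ℕ.≤ j → HasCardinality (Slice (src G zero) (tgt G zero) (delete G) (+ k) (+ (j ℕ.∸ k))) (a k))
    (b-card : ∀ {k} → k ℕ.< j → HasCardinality (Points (delete G) (j ℕ.∸ suc k)) (b k)) where

    private
      u = src G zero
      v = tgt G zero

      values : List ℤ
      values = List.map +_ (upTo (suc j)) ++ List.map -[1+_] (upTo j)

      values! : Unique values
      values! = Unique.++⁺ (Unique.map⁺ +-injective (Unique.upTo⁺ (suc j)))
        (Unique.map⁺ -[1+-injective (Unique.upTo⁺ j)) λ (p , q) →
          case ∈-map⁻ +_ p , ∈-map⁻ -[1+_] q of λ where ((_ , _ , refl) , (_ , _ , ()))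

      size : ℤ → ℕ
      size (+ k)    = a k
      size -[1+ k ] = b k

      diff : ∀ {k} → k ℕ.≤ j → + (j ℕ.∸ k) ≡ + j - + k
      diff {k} k≤j = trans (sym (⊖-≥ k≤j)) (sym (m-n≡m⊖n j k))

      slices : ∀ c → c ∈ values → HasCardinality (Slice u v (delete G) c (+ j - c)) (size c)
      slices c c∈ with ∈-++⁻ (List.map +_ (upTo (suc j))) c∈
      ... | inj₁ p with ∈-map⁻ +_ p
      ...   | k , k∈ , refl = subst (λ l → HasCardinality (Slice u v (delete G) (+ k) l) (a k))
                (diff k≤j) (a-card k≤j)
              where k≤j = ℕ.≤-pred (∈-upTo⁻ k∈)
      slices c c∈ | inj₂ p with ∈-map⁻ -[1+_] p
      ...   | k , k∈ , refl = slice-negative (delete G) u v k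
                (trans (diff (∈-upTo⁻ k∈)) (lem (+ j) -[1+ k ])) (b-card (∈-upTo⁻ k∈))
              where lem : ∀ j c → j + c ≡ j - c + c * + 2
                    lem = solve-∀

      sizes : ℕ.sum (List.map size values) ≡ ℕ.sum (List.map a (upTo (suc j))) ℕ.+ ℕ.sum (List.map b (upTo j))
      sizes = trans (cong ℕ.sum (map-++ size (List.map +_ (upTo (suc j))) _))
        (trans (ℕ.sum-++ (List.map size (List.map +_ (upTo (suc j)))) _)
          (cong₂ (λ p q → ℕ.sum p ℕ.+ ℕ.sum q) (sym (map-∘ (upTo (suc j)))) (sym (map-∘ (upTo j)))))

    -- The remaining coordinates of the slice at `c` have total `j - c`. For `c = -[1+ k ]` this
    -- exceeds `j` by `suc k`, and consuming twice that amount leaves `j ∸ suc k`. Weights of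
    -- absolute value above `j` do not occur, by `step-total`.
    points-suc : HasCardinality (Points G j)
      (ℕ.sum (List.map a (upTo (suc j))) ℕ.+ ℕ.sum (List.map b (upTo j)))
    points-suc = subst (HasCardinality (Points G j)) sizes (card-image f g (λ _ → refl)
      (λ {q} → fg {q}) (λ {p} → S⇒T {p}) (λ {q} → T⇒S {q}) (card-Σ values! slices))
      where
      f : ℤ × Point n m → Point n (suc m)
      f (c , (x , y)) = x , c Vec.∷ y
      g : Point n (suc m) → ℤ × Point n m
      g (x , c Vec.∷ y) = c , (x , y)
      fg : ∀ {q} → Points G j q → f (g q) ≡ q
      fg {x , c Vec.∷ y} _ = refl
      rearrange : ∀ a b c → a + (c + b) ≡ a + b + c
      rearrange = solve-∀
      cancel : ∀ j c → j - c + c ≡ j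
      cancel = solve-∀
      cancel′ : ∀ j c → j + c - c ≡ j
      cancel′ = solve-∀
      S⇒T : ∀ {p} → proj₁ p ∈ values × Slice u v (delete G) (proj₁ p) (+ j - proj₁ p) (proj₂ p) → Points G j (f p)
      S⇒T {c , (x , y)} (_ , s , eq) = s , trans (rearrange (sum (lookup x)) (sum (lookup y)) c)
        (trans (cong (_+ c) eq) (cancel (+ j) c))
      T⇒S : ∀ {q} → Points G j q → proj₁ (g q) ∈ values × Slice u v (delete G) (proj₁ (g q)) (+ j - proj₁ (g q)) (proj₂ (g q))
      T⇒S {x , c Vec.∷ y} (s , eq) = bounded c (drop‿+≤+ (subst (+ ∣ c ∣ ≤_) eq
          (step-total {r = sum (lookup y)} (feasible-total (delete G)) c s))) , s ,
        trans (sym (cancel′ (total (x , y)) c)) (cong (_- c) (trans (sym (rearrange (sum (lookup x)) (sum (lookup y)) c)) eq))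
        where
        bounded : ∀ c → ∣ c ∣ ℕ.≤ j → c ∈ values
        bounded (+ k)    k≤j = ∈-++⁺ˡ (∈-map⁺ +_ (∈-upTo⁺ (s≤s k≤j)))
        bounded -[1+ k ] k<j = ∈-++⁺ʳ _ (∈-map⁺ -[1+_] (∈-upTo⁺ k<j))

-- Power series and sums over edge subsets

module GeneratingFunctions where

  open import Data.Fin.Subset using (Subset; inside; outside; ∣_∣)
  open import Data.Fin.Subset.Properties using (_⊆?_; ∣p∣≤n)
  open import Data.Integer.Base hiding (suc; ∣_∣)
  open import Data.Integer.Properties hiding (_≟_)
  open import Data.Integer.Tactic.RingSolver using (solve-∀)
  open import Data.List.Base as List using ([]; _∷_; applyUpTo)
  open import Data.List.Properties using (map-applyUpTo)
  open import Data.Bool.Base using (if_then_else_)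
  open import Data.Nat.Base as ℕ using (ℕ; zero; suc; _∸_)
  import Data.Nat.Properties as ℕ
  open import Data.Vec.Base as Vec using ([]; _∷_)
  open import Function.Base using (_∘_; id)
  open import Function.Bundles using (_⇔_; Equivalence)
  open import Relation.Binary.PropositionalEquality
  open import Relation.Nullary using (¬_; Dec; yes; no; contradiction; does)

  shift : Series → Series
  shift f zero    = 0ℤ
  shift f (suc k) = f k

  -- Multiplication by the polynomial a + b z.
  linear : ℤ → ℤ → Series → Series
  linear a b f k = a * f k + b * shift f k

  -- All factors in the theorem are powers of binomials in z. As operators they commute by an
  -- identity between coefficients, which takes the place of the general ring laws of `_⊛_`.
  linear^ : ℤ → ℤ → ℕ → Series → Series
  linear^ a b zero    f = f
  linear^ a b (suc r) f = linear a b (linear^ a b r f)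

  one : Series
  one = poly (1ℤ ∷ [])

  infixl 6 _⊞_
  _⊞_ : Series → Series → Series
  (f ⊞ g) k = f k + g k

  infixr 7 _·_
  _·_ : ℤ → Series → Series
  (c · f) k = c * f k

  ≐-trans : ∀ {f g h} → f ≐ g → g ≐ h → f ≐ h
  ≐-trans p q k = trans (p k) (q k)

  ≐-sym : ∀ {f g} → f ≐ g → g ≐ f
  ≐-sym p k = sym (p k)

  shift-cong : ∀ {f g} → f ≐ g → shift f ≐ shift g
  shift-cong p zero    = refl
  shift-cong p (suc k) = p k

  shift-⊞ : ∀ f g → shift (f ⊞ g) ≐ shift f ⊞ shift g
  shift-⊞ f g zero    = refl
  shift-⊞ f g (suc k) = refl

  shift-· : ∀ c f → shift (c · f) ≐ c · shift f
  shift-· c f zero    = sym (*-zeroʳ c)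
  shift-· c f (suc k) = refl

  module _ (a b : ℤ) where

    linear-cong : ∀ {f g} → f ≐ g → linear a b f ≐ linear a b g
    linear-cong p k = cong₂ (λ x y → a * x + b * y) (p k) (shift-cong p k)

    linear-⊞ : ∀ f g → linear a b (f ⊞ g) ≐ linear a b f ⊞ linear a b g
    linear-⊞ f g k = trans (cong (λ x → a * (f k + g k) + b * x) (shift-⊞ f g k))
                           (lem a b (f k) (g k) (shift f k) (shift g k))
      where lem : ∀ a b f g f′ g′ → a * (f + g) + b * (f′ + g′) ≡ (a * f + b * f′) + (a * g + b * g′)
            lem = solve-∀

    linear-· : ∀ c f → linear a b (c · f) ≐ c · linear a b f
    linear-· c f k = trans (cong (λ x → a * (c * f k) + b * x) (shift-· c f k))
                           (lem a b c (f k) (shift f k))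
      where lem : ∀ a b c f f′ → a * (c * f) + b * (c * f′) ≡ c * (a * f + b * f′)
            lem = solve-∀

    shift-linear : ∀ f → shift (linear a b f) ≐ linear a b (shift f)
    shift-linear f zero    = lem a b
      where lem : ∀ a b → 0ℤ ≡ a * 0ℤ + b * 0ℤ
            lem = solve-∀
    shift-linear f (suc k) = refl

    linear^-cong : ∀ r {f g} → f ≐ g → linear^ a b r f ≐ linear^ a b r g
    linear^-cong zero    p = p
    linear^-cong (suc r) p = linear-cong (linear^-cong r p)

    linear^-⊞ : ∀ r f g → linear^ a b r (f ⊞ g) ≐ linear^ a b r f ⊞ linear^ a b r g
    linear^-⊞ zero    f g k = refl
    linear^-⊞ (suc r) f g = ≐-trans (linear-cong (linear^-⊞ r f g)) (linear-⊞ _ _)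

  linear-comm : ∀ a b c d f → linear a b (linear c d f) ≐ linear c d (linear a b f)
  linear-comm a b c d f k = begin
    a * linear c d f k + b * shift (linear c d f) k            ≡⟨ cong (λ x → a * linear c d f k + b * x) (shift-linear c d f k) ⟩
    a * linear c d f k + b * linear c d (shift f) k            ≡⟨ lem a b c d (f k) (shift f k) (shift (shift f) k) ⟩
    c * linear a b f k + d * linear a b (shift f) k            ≡⟨ cong (λ x → c * linear a b f k + d * x) (shift-linear a b f k) ⟨
    c * linear a b f k + d * shift (linear a b f) k            ∎
    where
    open ≡-Reasoning
    lem : ∀ a b c d x y z → a * (c * x + d * y) + b * (c * y + d * z) ≡ c * (a * x + b * y) + d * (a * y + b * z)
    lem = solve-∀

  linear^-comm : ∀ a b r c d f → linear^ a b r (linear c d f) ≐ linear c d (linear^ a b r f)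
  linear^-comm a b zero    c d f k = refl
  linear^-comm a b (suc r) c d f =
    ≐-trans (linear-cong a b (linear^-comm a b r c d f)) (linear-comm a b c d (linear^ a b r f))

  private
    -- The reversal of indices in a Cauchy product is absorbed into the second argument, so that
    -- linearity in the first is a plain induction.
    dot : (ℕ → ℤ) → (ℕ → ℤ) → ℕ → ℤ
    dot f g n = sumℤ (applyUpTo (λ i → f i * g i) n)

    dot-linear : ∀ a b f f′ g n →
      dot (λ i → a * f i + b * f′ i) g n ≡ a * dot f g n + b * dot f′ g n
    dot-linear a b f f′ g zero    = lem a b
      where lem : ∀ a b → 0ℤ ≡ a * 0ℤ + b * 0ℤ
            lem = solve-∀
    dot-linear a b f f′ g (suc n) = trans
      (cong (_+_ ((a * f 0 + b * f′ 0) * g 0)) (dot-linear a b (f ∘ suc) (f′ ∘ suc) (g ∘ suc) n))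
      (lem a b (f 0) (f′ 0) (g 0) (dot (f ∘ suc) (g ∘ suc) n) (dot (f′ ∘ suc) (g ∘ suc) n))
      where lem : ∀ a b f f′ g d d′ → (a * f + b * f′) * g + (a * d + b * d′) ≡ a * (f * g + d) + b * (f′ * g + d′)
            lem = solve-∀

    dot-cong : ∀ {f f′ g g′ : ℕ → ℤ} → (∀ i → f i ≡ f′ i) → (∀ i → g i ≡ g′ i) → ∀ n → dot f g n ≡ dot f′ g′ n
    dot-cong p q zero    = refl
    dot-cong p q (suc n) = cong₂ _+_ (cong₂ _*_ (p 0) (q 0)) (dot-cong (p ∘ suc) (q ∘ suc) n)

    dot-zero : ∀ g n → dot (λ _ → 0ℤ) g n ≡ 0ℤ
    dot-zero g zero    = refl
    dot-zero g (suc n) = trans (+-identityˡ _) (dot-zero (g ∘ suc) n)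

    ⊛-dot : ∀ f g k → (f ⊛ g) k ≡ dot f (λ i → g (k ∸ i)) (suc k)
    ⊛-dot f g k = cong sumℤ (map-applyUpTo id (λ i → f i * g (k ∸ i)) (suc k))

  ⊛-cong : ∀ {f f′ g g′} → f ≐ f′ → g ≐ g′ → f ⊛ g ≐ f′ ⊛ g′
  ⊛-cong {f} {f′} {g} {g′} p q k = trans (⊛-dot f g k)
    (trans (dot-cong p (λ i → q (k ∸ i)) (suc k)) (sym (⊛-dot f′ g′ k)))

  one-⊛ : ∀ f → one ⊛ f ≐ f
  one-⊛ f k = trans (⊛-dot one f k) (trans (cong₂ _+_ (*-identityˡ (f k)) (dot-zero (λ i → f (k ∸ suc i)) k)) (+-identityʳ (f k)))

  shift-⊛ : ∀ f g → shift f ⊛ g ≐ shift (f ⊛ g)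
  shift-⊛ f g zero    = refl
  shift-⊛ f g (suc k) = trans (⊛-dot (shift f) g (suc k)) (trans (+-identityˡ _) (sym (⊛-dot f g k)))

  linear-⊛ : ∀ a b f g → linear a b f ⊛ g ≐ linear a b (f ⊛ g)
  linear-⊛ a b f g k = begin
    (linear a b f ⊛ g) k                        ≡⟨ ⊛-dot (linear a b f) g k ⟩
    dot (linear a b f) g′ (suc k)               ≡⟨ dot-linear a b f (shift f) g′ (suc k) ⟩
    a * dot f g′ (suc k) + b * dot (shift f) g′ (suc k)
      ≡⟨ cong₂ (λ x y → a * x + b * y) (⊛-dot f g k) (⊛-dot (shift f) g k) ⟨
    a * (f ⊛ g) k + b * (shift f ⊛ g) k         ≡⟨ cong (λ x → a * (f ⊛ g) k + b * x) (shift-⊛ f g k) ⟩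
    linear a b (f ⊛ g) k                        ∎
    where
    open ≡-Reasoning
    g′ : ℕ → ℤ
    g′ i = g (k ∸ i)

  poly≐linear : ∀ a b → poly (a ∷ b ∷ []) ≐ linear a b one
  poly≐linear a b zero          = lem a b
    where lem : ∀ a b → a ≡ a * 1ℤ + b * 0ℤ
          lem = solve-∀
  poly≐linear a b (suc zero)    = lem a b
    where lem : ∀ a b → b ≡ a * 0ℤ + b * 1ℤ
          lem = solve-∀
  poly≐linear a b (suc (suc k)) = lem a b
    where lem : ∀ a b → 0ℤ ≡ a * 0ℤ + b * 0ℤ
          lem = solve-∀

  linear-poly : ∀ a b f → poly (a ∷ b ∷ []) ⊛ f ≐ linear a b f
  linear-poly a b f = ≐-trans (⊛-cong {g = f} (poly≐linear a b) (λ _ → refl))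
    (≐-trans (linear-⊛ a b one f) (linear-cong a b (one-⊛ f)))

  constant-poly : ∀ a f → poly (a ∷ []) ⊛ f ≐ a · f
  constant-poly a f k = trans (⊛-dot (poly (a ∷ [])) f k)
    (trans (cong (_+_ (a * f k)) (dot-zero (λ i → f (k ∸ suc i)) k)) (+-identityʳ _))

  ·-⊛ : ∀ a f g → (a · f) ⊛ g ≐ a · (f ⊛ g)
  ·-⊛ a f g = ≐-trans (⊛-cong {g = g} (λ k → sym (+-identityʳ (a * f k))) (λ _ → refl))
    (≐-trans (linear-⊛ a 0ℤ f g) (λ k → +-identityʳ _))

  linear-poly^ : ∀ a b r f → poly (a ∷ b ∷ []) ⊛^ r ⊛ f ≐ linear^ a b r f
  linear-poly^ a b zero    f = one-⊛ f
  linear-poly^ a b (suc r) f = ≐-trans (⊛-cong {g = f} (linear-poly a b (poly (a ∷ b ∷ []) ⊛^ r)) (λ _ → refl))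
    (≐-trans (linear-⊛ a b (poly (a ∷ b ∷ []) ⊛^ r) f) (linear-cong a b (linear-poly^ a b r f)))

  poly^≐linear^ : ∀ a b r → poly (a ∷ b ∷ []) ⊛^ r ≐ linear^ a b r one
  poly^≐linear^ a b zero    k = refl
  poly^≐linear^ a b (suc r) = ≐-trans (linear-poly a b (poly (a ∷ b ∷ []) ⊛^ r)) (linear-cong a b (poly^≐linear^ a b r))

  indicator : {P : Set} → Dec P → ℤ
  indicator p = if does p then 1ℤ else 0ℤ

  indicator-cong : {P Q : Set} (p : Dec P) (q : Dec Q) → P ⇔ Q → indicator p ≡ indicator q
  indicator-cong (yes _) (yes _) e = refl
  indicator-cong (yes p) (no ¬q) e = contradiction (Equivalence.to e p) ¬q
  indicator-cong (no ¬p) (yes q) e = contradiction (Equivalence.from e q) ¬p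
  indicator-cong (no _)  (no _)  e = refl

  indicator-no : {P : Set} (p : Dec P) → ¬ P → indicator p ≡ 0ℤ
  indicator-no (yes p) ¬p = contradiction p ¬p
  indicator-no (no _)  _  = refl

  indicator-yes : {P : Set} (p : Dec P) → P → indicator p ≡ 1ℤ
  indicator-yes (yes _) _ = refl
  indicator-yes (no ¬p) p = contradiction p ¬p

  -- ∑_S w(S) (2z)^∣S∣ (1+z)^(m-∣S∣)
  subsetSum : ∀ m → (Subset m → ℤ) → Series
  subsetSum zero    w = w [] · one
  subsetSum (suc m) w =
    linear 1ℤ 1ℤ (subsetSum m (w ∘ (outside ∷_))) ⊞ linear 0ℤ (+ 2) (subsetSum m (w ∘ (inside ∷_)))

  subsetSum-cong : ∀ m {w w′} → w ≗ w′ → subsetSum m w ≐ subsetSum m w′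
  subsetSum-cong zero    p k = cong (_* one k) (p [])
  subsetSum-cong (suc m) p k = cong₂ _+_
    (linear-cong 1ℤ 1ℤ (subsetSum-cong m (p ∘ (outside ∷_))) k)
    (linear-cong 0ℤ (+ 2) (subsetSum-cong m (p ∘ (inside ∷_))) k)

  subsetSum-+ : ∀ m w w′ → subsetSum m (λ S → w S + w′ S) ≐ subsetSum m w ⊞ subsetSum m w′
  subsetSum-+ zero    w w′ k = *-distribʳ-+ (one k) (w []) (w′ [])
  subsetSum-+ (suc m) w w′ k = trans
    (cong₂ _+_
      (trans (linear-cong 1ℤ 1ℤ (subsetSum-+ m (w ∘ (outside ∷_)) (w′ ∘ (outside ∷_))) k)
             (linear-⊞ 1ℤ 1ℤ (subsetSum m (w ∘ (outside ∷_))) (subsetSum m (w′ ∘ (outside ∷_))) k))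
      (trans (linear-cong 0ℤ (+ 2) (subsetSum-+ m (w ∘ (inside ∷_)) (w′ ∘ (inside ∷_))) k)
             (linear-⊞ 0ℤ (+ 2) (subsetSum m (w ∘ (inside ∷_))) (subsetSum m (w′ ∘ (inside ∷_))) k)))
    (lem (linear 1ℤ 1ℤ (subsetSum m (w ∘ (outside ∷_))) k) (linear 1ℤ 1ℤ (subsetSum m (w′ ∘ (outside ∷_))) k)
         (linear 0ℤ (+ 2) (subsetSum m (w ∘ (inside ∷_))) k) (linear 0ℤ (+ 2) (subsetSum m (w′ ∘ (inside ∷_))) k))
    where lem : ∀ a b c d → (a + b) + (c + d) ≡ (a + c) + (b + d)
          lem = solve-∀

  subsetSum-· : ∀ m c w → subsetSum m (λ S → c * w S) ≐ c · subsetSum m w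
  subsetSum-· zero    c w k = *-assoc c (w []) (one k)
  subsetSum-· (suc m) c w k = trans
    (cong₂ _+_
      (trans (linear-cong 1ℤ 1ℤ (subsetSum-· m c (w ∘ (outside ∷_))) k) (linear-· 1ℤ 1ℤ c _ k))
      (trans (linear-cong 0ℤ (+ 2) (subsetSum-· m c (w ∘ (inside ∷_))) k) (linear-· 0ℤ (+ 2) c _ k)))
    (sym (*-distribˡ-+ c _ _))

  subsetSum-0 : ∀ m → subsetSum m (λ _ → 0ℤ) ≐ λ _ → 0ℤ
  subsetSum-0 m k = trans (subsetSum-· m 0ℤ (λ _ → 0ℤ) k) refl

  linear-subsetSum-0 : ∀ a b m → linear a b (subsetSum m (λ _ → 0ℤ)) ≐ λ _ → 0ℤ
  linear-subsetSum-0 a b m k = trans (linear-cong a b (subsetSum-0 m) k) (linear-· a b 0ℤ (λ _ → 0ℤ) k)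

  -- 1 + 3z = (1 + z) + 2z, so (2z)^∣H∣ (1+3z)^(m-∣H∣) sums (2z)^∣S∣ (1+z)^(m-∣S∣) over all S ⊇ H.
  supersets : ∀ {m} (H : Subset m) →
    linear^ 0ℤ (+ 2) ∣ H ∣ (linear^ 1ℤ (+ 3) (m ∸ ∣ H ∣) one) ≐ subsetSum m (λ S → indicator (H ⊆? S))
  supersets [] k = sym (*-identityˡ (one k))
  supersets {suc m} (outside ∷ H) k = begin
    linear^ 0ℤ (+ 2) h (linear^ 1ℤ (+ 3) (suc m ∸ h) one) k
      -- Truncated subtraction is exact here because `∣ H ∣ ≤ m`; one factor 1 + 3z can be split
      -- off.
      ≡⟨ cong (λ r → linear^ 0ℤ (+ 2) h (linear^ 1ℤ (+ 3) r one) k) (ℕ.+-∸-assoc 1 (∣p∣≤n H)) ⟩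
    linear^ 0ℤ (+ 2) h (linear 1ℤ (+ 3) (linear^ 1ℤ (+ 3) (m ∸ h) one)) k
      ≡⟨ linear^-comm 0ℤ (+ 2) h 1ℤ (+ 3) _ k ⟩
    linear 1ℤ (+ 3) (linear^ 0ℤ (+ 2) h (linear^ 1ℤ (+ 3) (m ∸ h) one)) k
      ≡⟨ linear-cong 1ℤ (+ 3) (supersets H) k ⟩
    linear 1ℤ (+ 3) σ k
      ≡⟨ lem (σ k) (shift σ k) ⟩
    linear 1ℤ 1ℤ σ k + linear 0ℤ (+ 2) σ k
      ≡⟨⟩
    subsetSum (suc m) (λ S → indicator (outside ∷ H ⊆? S)) k ∎
    where
    open ≡-Reasoning
    h = ∣ H ∣
    σ = subsetSum m (λ S → indicator (H ⊆? S))
    lem : ∀ x y → 1ℤ * x + + 3 * y ≡ (1ℤ * x + 1ℤ * y) + (0ℤ * x + + 2 * y)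
    lem = solve-∀
  supersets {suc m} (inside ∷ H) k = begin
    linear 0ℤ (+ 2) (linear^ 0ℤ (+ 2) h (linear^ 1ℤ (+ 3) (m ∸ h) one)) k
      ≡⟨ linear-cong 0ℤ (+ 2) (supersets H) k ⟩
    linear 0ℤ (+ 2) (subsetSum m (λ S → indicator (H ⊆? S))) k
      ≡⟨ +-identityˡ _ ⟨
    0ℤ + linear 0ℤ (+ 2) (subsetSum m (λ S → indicator (H ⊆? S))) k
      -- No superset of `inside ∷ H` omits the first edge, so the half of the sum over sets without
      -- that edge is zero.
      ≡⟨ cong (_+ linear 0ℤ (+ 2) (subsetSum m (λ S → indicator (H ⊆? S))) k) (linear-subsetSum-0 1ℤ 1ℤ m k) ⟨
    subsetSum (suc m) (λ S → indicator (inside ∷ H ⊆? S)) k ∎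
    where
    open ≡-Reasoning
    h = ∣ H ∣

-- The Möbius sum as a sum over acyclic sets

module MöbiusInversion where

  open Graph
  open GeneratingFunctions
  open import Data.Bool.Base using (true; false)
  open import Data.Fin.Subset using (Subset; inside; outside; _⊆_; ⊥; ∣_∣)
  open import Data.Fin.Subset.Properties using (_⊆?_; ⊥⊆)
  open import Data.Integer.Base hiding (suc; ∣_∣)
  open import Data.Integer.Properties hiding (_≟_)
  open import Data.List.Base as List using (List; []; _∷_; filter)
  open import Data.List.Membership.Propositional using (_∈_)
  open import Data.List.Membership.Propositional.Properties using (∈-map⁻)
  open import Data.List.Relation.Unary.All as All using (All; []; _∷_)
  open import Data.List.Relation.Unary.AllPairs using ([]; _∷_)
  open import Data.List.Relation.Unary.Any using (here; there)
  open import Data.List.Relation.Unary.Unique.Propositional using (Unique)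
  open import Data.List.Relation.Unary.Unique.Propositional.Properties as Unique using ()
  open import Data.Nat.Base using (ℕ; zero; suc; _∸_)
  open import Data.Product.Base using (_×_; _,_)
  open import Data.Vec.Base as Vec using ([]; _∷_)
  open import Data.Vec.Properties using (∷-injectiveʳ)
  open import Function.Base using (_∘_)
  open import Function.Bundles using (_⇔_; mk⇔; Equivalence)
  open import Relation.Binary.PropositionalEquality
  open import Relation.Nullary using (Dec; yes; no; does)
  open import Relation.Nullary.Decidable using (_×-dec_)

  -- Links the filtered sum in the Möbius axiom to sums weighted by an indicator, which can be
  -- compared term by term.
  sumℤ-filter : {A : Set} {P : A → Set} (p : ∀ x → Dec (P x)) (f : A → ℤ) (xs : List A) →
    sumℤ (List.map f (filter p xs)) ≡ sumℤ (List.map (λ x → f x * indicator (p x)) xs)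
  sumℤ-filter p f []       = refl
  sumℤ-filter p f (x ∷ xs) with does (p x)
  ... | true  = cong₂ _+_ (sym (*-identityʳ (f x))) (sumℤ-filter p f xs)
  ... | false = trans (sumℤ-filter p f xs)
                      (sym (trans (cong (_+ _) (*-zeroʳ (f x))) (+-identityˡ _)))

  sumℤ-cong : {A : Set} {f g : A → ℤ} (xs : List A) → (∀ {x} → x ∈ xs → f x ≡ g x) →
    sumℤ (List.map f xs) ≡ sumℤ (List.map g xs)
  sumℤ-cong []       h = refl
  sumℤ-cong (x ∷ xs) h = cong₂ _+_ (h (here refl)) (sumℤ-cong xs (h ∘ there))

  sumℤ-zero : {A : Set} {f : A → ℤ} (xs : List A) → (∀ {x} → x ∈ xs → f x ≡ 0ℤ) →
    sumℤ (List.map f xs) ≡ 0ℤ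
  sumℤ-zero []       h = refl
  sumℤ-zero (x ∷ xs) h = cong₂ _+_ (h (here refl)) (sumℤ-zero xs (h ∘ there))

  sumℤ-single : {A : Set} {f : A → ℤ} {x : A} (xs : List A) → Unique xs → x ∈ xs →
    (∀ {y} → y ∈ xs → y ≢ x → f y ≡ 0ℤ) → sumℤ (List.map f xs) ≡ f x
  sumℤ-single {f = f} (x ∷ xs) (x∉ ∷ _) (here refl) h = trans
    (cong (_+_ (f x)) (sumℤ-zero xs λ y∈ → h (there y∈) (All.lookup x∉ y∈ ∘ sym)))
    (+-identityʳ (f x))
  sumℤ-single {f = f} (y ∷ xs) (y∉ ∷ xs!) (there x∈) h = trans
    (cong₂ _+_ (h (here refl) (All.lookup y∉ x∈)) (sumℤ-single xs xs! x∈ (h ∘ there)))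
    (+-identityˡ _)

  allSubsets! : ∀ m → Unique (allSubsets m)
  allSubsets! zero    = [] ∷ []
  allSubsets! (suc m) = Unique.++⁺ (Unique.map⁺ ∷-injectiveʳ (allSubsets! m))
                                   (Unique.map⁺ ∷-injectiveʳ (allSubsets! m)) disjoint
    where
    disjoint : ∀ {S} → S ∈ List.map (outside ∷_) (allSubsets m) × S ∈ List.map (inside ∷_) (allSubsets m) → _
    disjoint (p , q) with ∈-map⁻ (outside ∷_) p | ∈-map⁻ (inside ∷_) q
    ... | _ , _ , refl | _ , _ , ()

  module _ {n m : ℕ} (G : Multigraph n m) (μ : Subset m → Subset m → ℤ)
           (isMöbius : IsMöbius (bridgelessSubsets G) _⊆?_ μ) where

    open IsMöbius isMöbius

    private
      P : List (Subset m)
      P = bridgelessSubsets G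

      ⊥∈P : ⊥ ∈ P
      ⊥∈P = Equivalence.from (∈-bridgelessSubsets G) (bridgeless-⊥ G)

      weight : Subset m → ℤ
      weight S = sumℤ (List.map (λ H → μ ⊥ H * indicator (H ⊆? S)) P)

    -- The bridgeless subsets of S are those of its core, so their Möbius values
    -- cancel unless the core is empty.
    möbius-acyclic : ∀ S → weight S ≡ indicator (acyclic? G S)
    möbius-acyclic S = by-cases (acyclic? G S)
      where
      open ≡-Reasoning
      -- The interval from `⊥` to the core, in the shape of the filter in `interval`.
      below? : ∀ H → Dec (⊥ ⊆ H × H ⊆ core G S)
      below? H = (⊥ ⊆? H) ×-dec (H ⊆? core G S)

      below-core : ∀ {H} → H ∈ P → H ⊆ S ⇔ (⊥ ⊆ H × H ⊆ core G S)
      below-core {H} H∈P = mk⇔ forward backward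
        where
        forward : H ⊆ S → ⊥ ⊆ H × H ⊆ core G S
        forward H⊆S = (λ {x} → ⊥⊆ {x = x}) , (λ {x} → ⊆core G H⊆S (Equivalence.to (∈-bridgelessSubsets G) H∈P) {x})
        backward : ⊥ ⊆ H × H ⊆ core G S → H ⊆ S
        backward (_ , H⊆core) x∈H = core⊆ G S (H⊆core x∈H)

      by-cases : (d : Dec (Acyclic G S)) → weight S ≡ indicator d
      by-cases (yes acyclic) = begin
        weight S                       ≡⟨ sumℤ-single P (Unique.filter⁺ (bridgeless? G) (allSubsets! m)) ⊥∈P others ⟩
        μ ⊥ ⊥ * indicator (⊥ ⊆? S)     ≡⟨ cong₂ _*_ (diagonal ⊥∈P) (indicator-yes (⊥ ⊆? S) ⊥⊆) ⟩
        1ℤ                             ∎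
        where
        others : ∀ {H} → H ∈ P → H ≢ ⊥ → μ ⊥ H * indicator (H ⊆? S) ≡ 0ℤ
        others {H} H∈P H≢⊥ = trans
          (cong (_*_ (μ ⊥ H)) (indicator-no (H ⊆? S) λ H⊆S →
            H≢⊥ (acyclic H⊆S (Equivalence.to (∈-bridgelessSubsets G) H∈P))))
          (*-zeroʳ (μ ⊥ H))
      by-cases (no ¬acyclic) = begin
        weight S
          ≡⟨ sumℤ-cong P (λ {H} H∈P → cong (_*_ (μ ⊥ H)) (indicator-cong (H ⊆? S) (below? H) (below-core H∈P))) ⟩
        sumℤ (List.map (λ H → μ ⊥ H * indicator (below? H)) P)
          ≡⟨ sumℤ-filter below? (μ ⊥) P ⟨
        sumℤ (List.map (μ ⊥) (filter below? P))
          ≡⟨ interval ⊥∈P (Equivalence.from (∈-bridgelessSubsets G) (bridgeless-core G S)) ⊥⊆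
               (λ eq → ¬acyclic (core≡⊥⇒Acyclic G (sym eq))) ⟩
        0ℤ ∎

    private
      term : ∀ H → poly (μ ⊥ H ∷ []) ⊛ poly (0ℤ ∷ + 2 ∷ []) ⊛^ ∣ H ∣ ⊛ poly (1ℤ ∷ + 3 ∷ []) ⊛^ (m ∸ ∣ H ∣)
        ≐ μ ⊥ H · subsetSum m (λ S → indicator (H ⊆? S))
      term H = ≐-trans (⊛-cong {g = q} {q} (constant-poly c p) (λ _ → refl))
        (≐-trans (·-⊛ c p q) λ k → cong (_*_ c)
          (trans (linear-poly^ 0ℤ (+ 2) ∣ H ∣ q k)
          (trans (linear^-cong 0ℤ (+ 2) ∣ H ∣ (poly^≐linear^ 1ℤ (+ 3) (m ∸ ∣ H ∣)) k) (supersets H k))))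
        where
        c = μ ⊥ H
        p = poly (0ℤ ∷ + 2 ∷ []) ⊛^ ∣ H ∣
        q = poly (1ℤ ∷ + 3 ∷ []) ⊛^ (m ∸ ∣ H ∣)

      -- Interchanges the sum over `H` with the sum over its supersets `S`, since `subsetSum` is
      -- linear in its weight. The summand `t` is abstract because that of `möbiusSum` is local to
      -- its definition.
      collect : ∀ {t : Subset m → Series} →
        (∀ H → t H ≐ μ ⊥ H · subsetSum m (λ S → indicator (H ⊆? S))) → ∀ Hs →
        sumSeries (List.map t Hs) ≐ subsetSum m (λ S → sumℤ (List.map (λ H → μ ⊥ H * indicator (H ⊆? S)) Hs))
      collect h []       = ≐-sym (subsetSum-0 m)
      collect h (H ∷ Hs) k = trans
        (cong₂ _+_ (trans (h H k) (sym (subsetSum-· m (μ ⊥ H) (λ S → indicator (H ⊆? S)) k))) (collect h Hs k))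
        (sym (subsetSum-+ m (λ S → μ ⊥ H * indicator (H ⊆? S)) _ k))

    möbiusSum≐ : möbiusSum G μ ≐ subsetSum m (λ S → indicator (acyclic? G S))
    möbiusSum≐ = ≐-trans (collect term P) (subsetSum-cong m möbius-acyclic)

-- The Ehrhart series by deletion and contraction

module DeletionContraction where

  open Graph
  open FlowsAndCuts
  open ContractionFibres
  open Cardinality
  open CountingPoints
  open GeneratingFunctions
  open import Data.Fin.Base using (zero; suc)
  open import Data.Fin.Properties using (_≟_)
  open import Data.Fin.Subset using (outside)
  open import Data.Integer.Base hiding (suc)
  open import Data.Integer.Properties hiding (_≟_)
  open import Data.Integer.Tactic.RingSolver using (solve-∀)
  open import Data.List.Base as List using (List; []; _∷_; upTo; applyUpTo)
  open import Data.List.Membership.Propositional using (_∈_)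
  open import Data.List.Membership.Propositional.Properties using (∈-upTo⁺; ∈-upTo⁻)
  open import Data.List.Properties using (map-upTo)
  open import Data.List.Relation.Unary.All as All using ()
  open import Data.List.Relation.Unary.AllPairs using ([]; _∷_)
  open import Data.List.Relation.Unary.Any using (here)
  open import Data.List.Relation.Unary.Unique.Propositional.Properties as Unique using ()
  open import Data.Nat.Base as ℕ using (ℕ; zero; suc; z≤n; s≤s; _∸_)
  import Data.Nat.ListAction as ℕ using (sum)
  import Data.Nat.Properties as ℕ
  open import Data.Nat.Tactic.RingSolver using () renaming (solve-∀ to solve-∀ℕ)
  open import Data.Product.Base using (Σ-syntax; _×_; _,_; proj₁; proj₂)
  open import Data.Vec.Base as Vec using (Vec; lookup)
  open import Function.Base using (_∘_)
  open import Function.Bundles using (mk⇔)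
  open import Level using (0ℓ)
  open import Relation.Binary.PropositionalEquality
  open import Relation.Nullary using (yes; no)
  open import Relation.Unary using (Pred)

  private
    D : Series → Series
    D = linear 1ℤ -1ℤ

    D^ : ℕ → Series → Series
    D^ = linear^ 1ℤ -1ℤ

    -- the coefficients of N / (1 - z)
    partial : (ℕ → ℕ) → ℕ → ℕ
    partial N j = ℕ.sum (applyUpTo (λ k → N (j ∸ k)) (suc j))

    -- the coefficients of 2z M / (1 - z)²
    ramp : (ℕ → ℕ) → ℕ → ℕ
    ramp M j = ℕ.sum (applyUpTo (λ k → 2 ℕ.* k ℕ.* M (j ∸ k)) (suc j))

    series : (ℕ → ℕ) → Series
    series N k = + N k

    D-partial : ∀ N → D (series (partial N)) ≐ series N
    D-partial N zero    = trans (lem (+ (N 0 ℕ.+ 0))) (cong +_ (ℕ.+-identityʳ (N 0)))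
      where lem : ∀ a → 1ℤ * a + -1ℤ * 0ℤ ≡ a
            lem = solve-∀
    D-partial N (suc k) = lem (+ N (suc k)) (+ partial N k)
      where lem : ∀ a b → 1ℤ * (a + b) + -1ℤ * b ≡ a
            lem = solve-∀

    sum-applyUpTo-+ : ∀ (f g : ℕ → ℕ) n →
      ℕ.sum (applyUpTo (λ k → f k ℕ.+ g k) n) ≡ ℕ.sum (applyUpTo f n) ℕ.+ ℕ.sum (applyUpTo g n)
    sum-applyUpTo-+ f g zero    = refl
    sum-applyUpTo-+ f g (suc n) = trans (cong (f 0 ℕ.+ g 0 ℕ.+_) (sum-applyUpTo-+ (f ∘ suc) (g ∘ suc) n))
      (lem (f 0) (g 0) (ℕ.sum (applyUpTo (f ∘ suc) n)) (ℕ.sum (applyUpTo (g ∘ suc) n)))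
      where
      lem : ∀ a b c d → a ℕ.+ b ℕ.+ (c ℕ.+ d) ≡ (a ℕ.+ c) ℕ.+ (b ℕ.+ d)
      lem = solve-∀ℕ

    sum-applyUpTo-cong : ∀ {f g : ℕ → ℕ} → f ≗ g → ∀ n → ℕ.sum (applyUpTo f n) ≡ ℕ.sum (applyUpTo g n)
    sum-applyUpTo-cong f≗g zero    = refl
    sum-applyUpTo-cong f≗g (suc n) = cong₂ ℕ._+_ (f≗g 0) (sum-applyUpTo-cong (f≗g ∘ suc) n)

    sum-applyUpTo-* : ∀ c (f : ℕ → ℕ) n → ℕ.sum (applyUpTo (λ k → c ℕ.* f k) n) ≡ c ℕ.* ℕ.sum (applyUpTo f n)
    sum-applyUpTo-* c f zero    = sym (ℕ.*-zeroʳ c)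
    sum-applyUpTo-* c f (suc n) = trans (cong (c ℕ.* f 0 ℕ.+_) (sum-applyUpTo-* c (f ∘ suc) n))
      (sym (ℕ.*-distribˡ-+ c (f 0) _))

    ramp-suc : ∀ M j → ramp M (suc j) ≡ 2 ℕ.* partial M j ℕ.+ ramp M j
    ramp-suc M j = begin
      ℕ.sum (applyUpTo (λ k → 2 ℕ.* suc k ℕ.* M (j ∸ k)) (suc j))
        ≡⟨ sum-applyUpTo-cong (λ k → lem k (M (j ∸ k))) (suc j) ⟩
      ℕ.sum (applyUpTo (λ k → 2 ℕ.* M (j ∸ k) ℕ.+ 2 ℕ.* k ℕ.* M (j ∸ k)) (suc j))
        ≡⟨ sum-applyUpTo-+ (λ k → 2 ℕ.* M (j ∸ k)) (λ k → 2 ℕ.* k ℕ.* M (j ∸ k)) (suc j) ⟩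
      ℕ.sum (applyUpTo (λ k → 2 ℕ.* M (j ∸ k)) (suc j)) ℕ.+ ramp M j
        ≡⟨ cong (ℕ._+ ramp M j) (sum-applyUpTo-* 2 (λ k → M (j ∸ k)) (suc j)) ⟩
      2 ℕ.* partial M j ℕ.+ ramp M j ∎
      where
      open ≡-Reasoning
      lem : ∀ k x → 2 ℕ.* suc k ℕ.* x ≡ 2 ℕ.* x ℕ.+ 2 ℕ.* k ℕ.* x
      lem = solve-∀ℕ

    D-ramp : ∀ M → D (series (ramp M)) ≐ linear 0ℤ (+ 2) (series (partial M))
    D-ramp M zero    = sym (trans (+-identityˡ _) refl)
    D-ramp M (suc k) = trans
      (cong (λ r → 1ℤ * r + -1ℤ * + ramp M k)
        (trans (cong +_ (ramp-suc M k)) (cong (_+ + ramp M k) (pos-* 2 (partial M k)))))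
      (lem (+ partial M (suc k)) (+ partial M k) (+ ramp M k))
      where lem : ∀ q a b → 1ℤ * (+ 2 * a + b) + -1ℤ * b ≡ 0ℤ * q + + 2 * a
            lem = solve-∀

    -- The coefficients of z N / (1 - z): negative weights begin with `- 1`, hence the delay by one.
    delayed : (ℕ → ℕ) → ℕ → ℕ
    delayed N j = ℕ.sum (applyUpTo (λ k → N (j ∸ suc k)) j)

    delayed≐ : ∀ N → series (delayed N) ≐ shift (series (partial N))
    delayed≐ N zero    = refl
    delayed≐ N (suc k) = refl

  Composition : ∀ n → ℕ → Pred (Vec ℤ n) 0ℓ
  Composition n j x = (∀ i → 0ℤ ≤ lookup x i) × sum (lookup x) ≡ + j

  -- A first entry `k` leaves a composition of `j ∸ k`, so each coordinate divides the series by 1 -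
  -- z.
  compositions : ∀ n → Σ[ L ∈ (ℕ → ℕ) ] ((∀ j → HasCardinality (Composition n j) (L j)) × D^ n (series L) ≐ one)
  compositions zero = L , cards , λ where
      zero    → refl
      (suc k) → refl
    where
    L : ℕ → ℕ
    L zero    = 1
    L (suc _) = 0
    cards : ∀ j → HasCardinality (Composition 0 j) (L j)
    cards zero    = Vec.[] ∷ [] , All.[] ∷ [] ,
      (λ where Vec.[] → mk⇔ (λ _ → (λ ()) , refl) (λ _ → here refl)) , refl
    cards (suc j) = [] , [] , (λ x → mk⇔ (λ ()) (λ where (_ , ()))) , refl
  compositions (suc n) with compositions n
  ... | N , cards , gf = partial N , cards′ ,
        ≐-trans (≐-sym (linear^-comm 1ℤ -1ℤ n 1ℤ -1ℤ (series (partial N))))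
          (≐-trans (linear^-cong 1ℤ -1ℤ n (D-partial N)) gf)
    where
    cards′ : ∀ j → HasCardinality (Composition (suc n) j) (partial N j)
    cards′ j = subst (HasCardinality (Composition (suc n) j)) (cong ℕ.sum (map-upTo (λ k → N (j ∸ k)) (suc j)))
      (card-image f g (λ _ → refl) (λ {b} → fg {b}) (λ {a} → S⇒T {a}) (λ {b} → T⇒S {b})
        (card-Σ {k = λ k → N (j ∸ k)} (Unique.upTo⁺ (suc j)) (λ k _ → cards (j ∸ k))))
      where
      f : ℕ × Vec ℤ n → Vec ℤ (suc n)
      f (k , x) = + k Vec.∷ x
      g : Vec ℤ (suc n) → ℕ × Vec ℤ n
      g (c Vec.∷ x) = ∣ c ∣ , x
      fg : ∀ {b} → Composition (suc n) j b → f (g b) ≡ b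
      fg {c Vec.∷ x} (p , _) = cong (Vec._∷ x) (0≤i⇒+∣i∣≡i (p zero))
      S⇒T : ∀ {a} → proj₁ a ∈ upTo (suc j) × Composition n (j ∸ proj₁ a) (proj₂ a) → Composition (suc n) j (f a)
      S⇒T {k , x} (k∈ , p , eq) = (λ where zero → +≤+ z≤n ; (suc i) → p i) ,
        trans (cong (_+_ (+ k)) eq) (cong +_ (ℕ.m+[n∸m]≡n (ℕ.≤-pred (∈-upTo⁻ k∈))))
      T⇒S : ∀ {b} → Composition (suc n) j b → proj₁ (g b) ∈ upTo (suc j) × Composition n (j ∸ proj₁ (g b)) (proj₂ (g b))
      T⇒S {+ k Vec.∷ x} (p , eq) = ∈-upTo⁺ (s≤s k≤j) , p ∘ suc , rest
        where
        0≤rest : 0ℤ ≤ sum (lookup x)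
        0≤rest = subst (_≤ sum (lookup x)) (sum-replicate-zero n) (sum-mono (p ∘ suc))
        k≤j : k ℕ.≤ j
        k≤j = drop‿+≤+ (subst₂ _≤_ (+-identityʳ (+ k)) eq (+-monoʳ-≤ (+ k) 0≤rest))
        rest : sum (lookup x) ≡ + (j ∸ k)
        rest = trans (cancel (+ k) (sum (lookup x)))
          (trans (cong (_- + k) eq) (trans (m-n≡m⊖n j k) (⊖-≥ k≤j)))
          where cancel : ∀ k s → s ≡ k + s - k
                cancel = solve-∀
      T⇒S { -[1+ k ] Vec.∷ x} (p , _) with p zero
      ... | ()

  -- If there is a node, the exponent `n + m` is the dimension of the polytope plus one, so the
  -- series on the right is the h*-polynomial with its denominator already cleared.
  EhrhartSeries : ∀ {n m} → Multigraph n m → Set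
  EhrhartSeries {n} {m} G = Σ[ L ∈ (ℕ → ℕ) ]
    ( (∀ j → HasCardinality (Points G j) (L j))
    × D^ (n ℕ.+ m) (series L) ≐ subsetSum m (λ S → indicator (acyclic? G S)))

  private
    edgeless-acyclic : ∀ {n} (G : Multigraph n 0) → Acyclic G Vec.[]
    edgeless-acyclic G {Vec.[]} _ _ = refl

    edgeless : ∀ {n} (G : Multigraph n 0) → EhrhartSeries G
    edgeless {n} G with compositions n
    ... | L , cards , gf = L , cards′ , λ k → begin
        D^ (n ℕ.+ 0) (series L) k              ≡⟨ cong (λ r → D^ r (series L) k) (ℕ.+-identityʳ n) ⟩
        D^ n (series L) k                      ≡⟨ gf k ⟩
        one k                                  ≡⟨ *-identityˡ (one k) ⟨
        1ℤ * one k                             ≡⟨ cong (_* one k) (indicator-yes (acyclic? G Vec.[]) (edgeless-acyclic G)) ⟨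
        indicator (acyclic? G Vec.[]) * one k  ∎
      where
      open ≡-Reasoning
      pad : ∀ {j} {p : Point n 0} → Points G j p → (proj₁ p , Vec.[]) ≡ p
      pad {p = _ , Vec.[]} _ = refl
      composition⇒points : ∀ {j} {x : Vec ℤ n} → Composition n j x → Points G j (x , Vec.[])
      composition⇒points {x = x} (p , eq) = p , trans (+-identityʳ (sum (lookup x))) eq
      points⇒composition : ∀ {j} {p : Point n 0} → Points G j p → Composition n j (proj₁ p)
      points⇒composition {p = x , Vec.[]} (p , eq) = p , trans (sym (+-identityʳ (sum (lookup x)))) eq
      cards′ : ∀ j → HasCardinality (Points G j) (L j)
      cards′ j = card-image (_, Vec.[]) proj₁ (λ _ → refl) (λ {p} → pad {j} {p})
        (λ {x} → composition⇒points {j} {x}) (λ {p} → points⇒composition {j} {p}) (cards j)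

    -- Each slice is equinumerous with a point set of `delete G`, which gives the factor (1 + z) /
    -- (1 - z). No acyclic set contains the loop, so the `inside` half of `subsetSum` vanishes.
    with-loop : ∀ {n m} (G : Multigraph n (suc m)) → tgt G zero ≡ src G zero →
      EhrhartSeries (delete G) → EhrhartSeries G
    with-loop {n} {m} G loop (N , cards , gf) = L , cards′ , gf′
      where
      u = src G zero
      L : ℕ → ℕ
      L j = ℕ.sum (List.map (λ k → N (j ∸ k)) (upTo (suc j))) ℕ.+ ℕ.sum (List.map (λ k → N (j ∸ suc k)) (upTo j))

      cards′ : ∀ j → HasCardinality (Points G j) (L j)
      cards′ j = points-suc G _ _
        (λ {k} _ → subst (λ v → HasCardinality (Slice u v (delete G) (+ k) (+ (j ∸ k))) (N (j ∸ k))) (sym loop)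
          (slice-loop (delete G) u k (cards (j ∸ k))))
        (λ {k} _ → cards (j ∸ suc k))

      L≐ : series L ≐ series (partial N) ⊞ shift (series (partial N))
      L≐ j = trans (cong₂ (λ p q → + (ℕ.sum p ℕ.+ ℕ.sum q)) (map-upTo (λ k → N (j ∸ k)) (suc j)) (map-upTo (λ k → N (j ∸ suc k)) j))
        (cong (_+_ (+ partial N j)) (delayed≐ N j))

      DL : D (series L) ≐ linear 1ℤ 1ℤ (series N)
      DL = ≐-trans (linear-cong 1ℤ -1ℤ (≐-trans L≐ (λ k → lem (+ partial N k) (shift (series (partial N)) k))))
        (≐-trans (linear-comm 1ℤ -1ℤ 1ℤ 1ℤ (series (partial N))) (linear-cong 1ℤ 1ℤ (D-partial N)))
        where lem : ∀ a b → a + b ≡ 1ℤ * a + 1ℤ * b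
              lem = solve-∀

      gf′ : D^ (n ℕ.+ suc m) (series L) ≐ subsetSum (suc m) (λ S → indicator (acyclic? G S))
      gf′ k = begin
        D^ (n ℕ.+ suc m) (series L) k            ≡⟨ cong (λ r → D^ r (series L) k) (ℕ.+-suc n m) ⟩
        D (D^ (n ℕ.+ m) (series L)) k            ≡⟨ linear^-comm 1ℤ -1ℤ (n ℕ.+ m) 1ℤ -1ℤ (series L) k ⟨
        D^ (n ℕ.+ m) (D (series L)) k            ≡⟨ linear^-cong 1ℤ -1ℤ (n ℕ.+ m) DL k ⟩
        D^ (n ℕ.+ m) (linear 1ℤ 1ℤ (series N)) k ≡⟨ linear^-comm 1ℤ -1ℤ (n ℕ.+ m) 1ℤ 1ℤ (series N) k ⟩
        linear 1ℤ 1ℤ (D^ (n ℕ.+ m) (series N)) k ≡⟨ linear-cong 1ℤ 1ℤ gf k ⟩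
        linear 1ℤ 1ℤ (subsetSum m (λ S → indicator (acyclic? (delete G) S))) k
          ≡⟨ linear-cong 1ℤ 1ℤ (subsetSum-cong m λ S → indicator-cong (acyclic? G _) (acyclic? (delete G) S) (acyclic-delete G)) k ⟨
        linear 1ℤ 1ℤ outer k                     ≡⟨ +-identityʳ _ ⟨
        linear 1ℤ 1ℤ outer k + 0ℤ                ≡⟨ cong (_+_ (linear 1ℤ 1ℤ outer k)) (trans
           (linear-cong 0ℤ (+ 2) (subsetSum-cong m λ S → indicator-no (acyclic? G _) (loop-¬acyclic G (sym loop))) k)
           (linear-subsetSum-0 0ℤ (+ 2) m k)) ⟨
        subsetSum (suc m) (λ S → indicator (acyclic? G S)) k ∎
        where
        open ≡-Reasoning
        outer = subsetSum m (λ S → indicator (acyclic? G (outside Vec.∷ S)))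

    with-edge : ∀ {n m} (G : Multigraph (suc n) (suc m)) (v≢u : tgt G zero ≢ src G zero) →
      EhrhartSeries (delete G) → EhrhartSeries (contract v≢u (delete G)) → EhrhartSeries G
    with-edge {n} {m} G v≢u (N , N-cards , N-gf) (M , M-cards , M-gf) = L , cards , gf
      where
      a b : ℕ → ℕ → ℕ
      a j k = N (j ∸ k) ℕ.+ 2 ℕ.* k ℕ.* M (j ∸ k)
      b j k = N (j ∸ suc k)
      L : ℕ → ℕ
      L j = ℕ.sum (List.map (a j) (upTo (suc j))) ℕ.+ ℕ.sum (List.map (b j) (upTo j))

      cards : ∀ j → HasCardinality (Points G j) (L j)
      cards j = points-suc G (a j) (b j)
        (λ {k} _ → slice-fibres v≢u (delete G) k (M-cards (j ∸ k)) (N-cards (j ∸ k)))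
        (λ {k} _ → N-cards (j ∸ suc k))

      L≐ : series L ≐ linear 1ℤ 1ℤ (series (partial N)) ⊞ series (ramp M)
      L≐ j = begin
        + L j
          ≡⟨ cong₂ (λ p q → + (ℕ.sum p ℕ.+ ℕ.sum q)) (map-upTo (a j) (suc j)) (map-upTo (b j) j) ⟩
        + (ℕ.sum (applyUpTo (a j) (suc j)) ℕ.+ delayed N j)
          ≡⟨ cong (λ p → + (p ℕ.+ delayed N j)) (sum-applyUpTo-+ (λ k → N (j ∸ k)) (λ k → 2 ℕ.* k ℕ.* M (j ∸ k)) (suc j)) ⟩
        + partial N j + + ramp M j + + delayed N j
          ≡⟨ cong (_+_ (+ partial N j + + ramp M j)) (delayed≐ N j) ⟩
        + partial N j + + ramp M j + shift (series (partial N)) j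
          ≡⟨ lem (+ partial N j) (+ ramp M j) (shift (series (partial N)) j) ⟩
        linear 1ℤ 1ℤ (series (partial N)) j + + ramp M j ∎
        where
        open ≡-Reasoning
        lem : ∀ p r s → p + r + s ≡ (1ℤ * p + 1ℤ * s) + r
        lem = solve-∀

      DL : D (series L) ≐ linear 1ℤ 1ℤ (series N) ⊞ linear 0ℤ (+ 2) (series (partial M))
      DL k = begin
        D (series L) k
          ≡⟨ linear-cong 1ℤ -1ℤ L≐ k ⟩
        D (linear 1ℤ 1ℤ (series (partial N)) ⊞ series (ramp M)) k
          ≡⟨ linear-⊞ 1ℤ -1ℤ (linear 1ℤ 1ℤ (series (partial N))) (series (ramp M)) k ⟩
        D (linear 1ℤ 1ℤ (series (partial N))) k + D (series (ramp M)) k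
          ≡⟨ cong₂ _+_ (trans (linear-comm 1ℤ -1ℤ 1ℤ 1ℤ (series (partial N)) k) (linear-cong 1ℤ 1ℤ (D-partial N) k))
                       (D-ramp M k) ⟩
        linear 1ℤ 1ℤ (series N) k + linear 0ℤ (+ 2) (series (partial M)) k ∎
        where open ≡-Reasoning

      -- The contraction term has denominator (1 - z)², so two factors are applied. The deletion
      -- term uses up only one; the other stays on `N`, as `delete G` has one node more than the
      -- contraction and needs that factor for its own h*-polynomial.
      DDL : D (D (series L)) ≐ linear 1ℤ 1ℤ (D (series N)) ⊞ linear 0ℤ (+ 2) (series M)
      DDL k = begin
        D (D (series L)) k
          ≡⟨ linear-cong 1ℤ -1ℤ DL k ⟩
        D (linear 1ℤ 1ℤ (series N) ⊞ linear 0ℤ (+ 2) (series (partial M))) k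
          ≡⟨ linear-⊞ 1ℤ -1ℤ (linear 1ℤ 1ℤ (series N)) (linear 0ℤ (+ 2) (series (partial M))) k ⟩
        D (linear 1ℤ 1ℤ (series N)) k + D (linear 0ℤ (+ 2) (series (partial M))) k
          ≡⟨ cong₂ _+_ (linear-comm 1ℤ -1ℤ 1ℤ 1ℤ (series N) k)
               (trans (linear-comm 1ℤ -1ℤ 0ℤ (+ 2) (series (partial M)) k) (linear-cong 0ℤ (+ 2) (D-partial M) k)) ⟩
        linear 1ℤ 1ℤ (D (series N)) k + linear 0ℤ (+ 2) (series M) k ∎
        where open ≡-Reasoning

      d : ℕ
      d = n ℕ.+ m

      gf : D^ (suc n ℕ.+ suc m) (series L) ≐ subsetSum (suc m) (λ S → indicator (acyclic? G S))
      gf k = begin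
        D^ (suc n ℕ.+ suc m) (series L) k        ≡⟨ cong (λ r → D^ (suc r) (series L) k) (ℕ.+-suc n m) ⟩
        D (D (D^ d (series L))) k
          ≡⟨ linear-cong 1ℤ -1ℤ (linear^-comm 1ℤ -1ℤ d 1ℤ -1ℤ (series L)) k ⟨
        D (D^ d (D (series L))) k
          ≡⟨ linear^-comm 1ℤ -1ℤ d 1ℤ -1ℤ (D (series L)) k ⟨
        D^ d (D (D (series L))) k
          ≡⟨ linear^-cong 1ℤ -1ℤ d DDL k ⟩
        D^ d (linear 1ℤ 1ℤ (D (series N)) ⊞ linear 0ℤ (+ 2) (series M)) k
          ≡⟨ linear^-⊞ 1ℤ -1ℤ d (linear 1ℤ 1ℤ (D (series N))) (linear 0ℤ (+ 2) (series M)) k ⟩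
        D^ d (linear 1ℤ 1ℤ (D (series N))) k + D^ d (linear 0ℤ (+ 2) (series M)) k
          ≡⟨ cong₂ _+_ (linear^-comm 1ℤ -1ℤ d 1ℤ 1ℤ (D (series N)) k) (linear^-comm 1ℤ -1ℤ d 0ℤ (+ 2) (series M) k) ⟩
        linear 1ℤ 1ℤ (D^ d (D (series N))) k + linear 0ℤ (+ 2) (D^ d (series M)) k
          ≡⟨ cong₂ _+_ (linear-cong 1ℤ 1ℤ (≐-trans (linear^-comm 1ℤ -1ℤ d 1ℤ -1ℤ (series N)) N-gf) k)
                       (linear-cong 0ℤ (+ 2) M-gf k) ⟩
        linear 1ℤ 1ℤ (subsetSum m (λ S → indicator (acyclic? (delete G) S))) k
        + linear 0ℤ (+ 2) (subsetSum m (λ S → indicator (acyclic? (contract v≢u (delete G)) S))) k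
          ≡⟨ cong₂ _+_
               (linear-cong 1ℤ 1ℤ (subsetSum-cong m λ S → indicator-cong (acyclic? G _) (acyclic? (delete G) S) (acyclic-delete G)) k)
               (linear-cong 0ℤ (+ 2) (subsetSum-cong m λ S →
                 indicator-cong (acyclic? G _) (acyclic? (contract v≢u (delete G)) S) (acyclic-contract G v≢u)) k) ⟨
        subsetSum (suc m) (λ S → indicator (acyclic? G S)) k ∎
        where open ≡-Reasoning

  ehrhart : ∀ {n m} (G : Multigraph n m) → EhrhartSeries G
  ehrhart {m = zero} G = edgeless G
  ehrhart {zero} {suc m} G with src G zero
  ... | ()
  ehrhart {suc n} {suc m} G with tgt G zero ≟ src G zero
  ... | yes loop = with-loop G loop (ehrhart (delete G))
  ... | no v≢u   = with-edge G v≢u (ehrhart (delete G)) (ehrhart (contract v≢u (delete G)))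

-- Linear functionals and convex combinations over the rationals

module RationalVectors where

  open import Data.Fin.Base using (zero; suc)
  open import Data.Integer.Base as ℤ using (ℤ; 0ℤ; 1ℤ)
  import Data.Integer.Properties as ℤ
  open import Data.Nat.Base using (ℕ; zero; suc)
  import Data.Nat.Properties as ℕ
  open import Data.Product.Base using (_,_)
  open import Data.Rational.Base as ℚ using (ℚ; 0ℚ; 1ℚ; _+_; _*_; _-_; -_; _≤_; toℚᵘ)
  open import Data.Rational.Properties
  open import Data.Rational.Solver using (module +-*-Solver)
  open import Data.Rational.Unnormalised.Base as ℚᵘ using (ℚᵘ; mkℚᵘ; *≡*; *≤*; _≃_)
  import Data.Rational.Unnormalised.Properties as ℚᵘ
  open import Data.Vec.Base as Vec using (Vec; []; _∷_; replicate)
  open import Data.Vec.Properties using (tabulate-∘)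
  open import Data.Vec.Relation.Unary.All as All using (All; []; _∷_)
  open import Relation.Binary.PropositionalEquality
  open import Relation.Unary using (Pred)
  open import Level using (0ℓ)

  private
    -- `fromℤ` is defined through normalisation. Its algebraic laws are checked on unnormalised
    -- fractions, where the denominator is visibly 1.
    toℚᵘ-fromℤ : ∀ z → toℚᵘ (fromℤ z) ≃ mkℚᵘ z 0
    toℚᵘ-fromℤ z = toℚᵘ-fromℚᵘ (mkℚᵘ z 0)

  fromℤ-+ : ∀ a b → fromℤ (a ℤ.+ b) ≡ fromℤ a + fromℤ b
  fromℤ-+ a b = toℚᵘ-injective (begin
    toℚᵘ (fromℤ (a ℤ.+ b))                ≈⟨ toℚᵘ-fromℤ (a ℤ.+ b) ⟩
    mkℚᵘ (a ℤ.+ b) 0                      ≈⟨ *≡* (cong₂ (λ x y → (x ℤ.+ y) ℤ.* 1ℤ) (ℤ.*-identityʳ a) (ℤ.*-identityʳ b)) ⟨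
    mkℚᵘ a 0 ℚᵘ.+ mkℚᵘ b 0                ≈⟨ ℚᵘ.+-cong (toℚᵘ-fromℤ a) (toℚᵘ-fromℤ b) ⟨
    toℚᵘ (fromℤ a) ℚᵘ.+ toℚᵘ (fromℤ b)    ≈⟨ toℚᵘ-homo-+ (fromℤ a) (fromℤ b) ⟨
    toℚᵘ (fromℤ a + fromℤ b)              ∎)
    where open import Relation.Binary.Reasoning.Setoid ℚᵘ.≃-setoid

  fromℤ-* : ∀ a b → fromℤ (a ℤ.* b) ≡ fromℤ a * fromℤ b
  fromℤ-* a b = toℚᵘ-injective (begin
    toℚᵘ (fromℤ (a ℤ.* b))                ≈⟨ toℚᵘ-fromℤ (a ℤ.* b) ⟩
    mkℚᵘ (a ℤ.* b) 0                      ≡⟨⟩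
    mkℚᵘ a 0 ℚᵘ.* mkℚᵘ b 0                ≈⟨ ℚᵘ.*-cong (toℚᵘ-fromℤ a) (toℚᵘ-fromℤ b) ⟨
    toℚᵘ (fromℤ a) ℚᵘ.* toℚᵘ (fromℤ b)    ≈⟨ toℚᵘ-homo-* (fromℤ a) (fromℤ b) ⟨
    toℚᵘ (fromℤ a * fromℤ b)              ∎)
    where open import Relation.Binary.Reasoning.Setoid ℚᵘ.≃-setoid

  fromℤ-neg : ∀ a → fromℤ (ℤ.- a) ≡ - fromℤ a
  fromℤ-neg a = toℚᵘ-injective (begin
    toℚᵘ (fromℤ (ℤ.- a))    ≈⟨ toℚᵘ-fromℤ (ℤ.- a) ⟩
    ℚᵘ.- mkℚᵘ a 0           ≈⟨ ℚᵘ.-‿cong (toℚᵘ-fromℤ a) ⟨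
    ℚᵘ.- toℚᵘ (fromℤ a)     ≈⟨ toℚᵘ-homo‿- (fromℤ a) ⟨
    toℚᵘ (- fromℤ a)        ∎)
    where open import Relation.Binary.Reasoning.Setoid ℚᵘ.≃-setoid

  fromℤ-sub : ∀ a b → fromℤ (a ℤ.- b) ≡ fromℤ a - fromℤ b
  fromℤ-sub a b = trans (fromℤ-+ a (ℤ.- b)) (cong (fromℤ a +_) (fromℤ-neg b))

  fromℤ-injective : ∀ {a b} → fromℤ a ≡ fromℤ b → a ≡ b
  fromℤ-injective {a} {b} eq
    with ℚᵘ.≃-trans (ℚᵘ.≃-sym (toℚᵘ-fromℤ a)) (ℚᵘ.≃-trans (ℚᵘ.≃-reflexive (cong toℚᵘ eq)) (toℚᵘ-fromℤ b))
  ... | *≡* e = trans (sym (ℤ.*-identityʳ a)) (trans e (ℤ.*-identityʳ b))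

  fromℤ-nonneg : ∀ {a} → 0ℤ ℤ.≤ a → 0ℚ ≤ fromℤ a
  fromℤ-nonneg {ℤ.+ n} _ = nonNegative⁻¹ (fromℤ (ℤ.+ n)) {{normalize-nonNeg n 1}}

  fromℤ-cancel-nonneg : ∀ {a} → 0ℚ ≤ fromℤ a → 0ℤ ℤ.≤ a
  fromℤ-cancel-nonneg {a} p with ℚᵘ.≤-trans (toℚᵘ-mono-≤ p) (ℚᵘ.≤-reflexive (toℚᵘ-fromℤ a))
  ... | *≤* q = subst (0ℤ ℤ.≤_) (ℤ.*-identityʳ a) q

  fromℤ-recip : ∀ j → fromℤ (ℤ.+ suc j) * (1ℤ ℚ./ suc j) ≡ 1ℚ
  fromℤ-recip j = toℚᵘ-injective (begin
    toℚᵘ (fromℤ (ℤ.+ suc j) * (1ℤ ℚ./ suc j))           ≈⟨ toℚᵘ-homo-* (fromℤ (ℤ.+ suc j)) (1ℤ ℚ./ suc j) ⟩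
    toℚᵘ (fromℤ (ℤ.+ suc j)) ℚᵘ.* toℚᵘ (1ℤ ℚ./ suc j)   ≈⟨ ℚᵘ.*-cong (toℚᵘ-fromℤ (ℤ.+ suc j)) (toℚᵘ-fromℚᵘ (mkℚᵘ 1ℤ j)) ⟩
    mkℚᵘ (ℤ.+ suc j) 0 ℚᵘ.* mkℚᵘ 1ℤ j                   ≈⟨ *≡* (trans (ℤ.*-identityʳ (ℤ.+ suc j ℤ.* 1ℤ))
                                                           (trans (ℤ.*-comm (ℤ.+ suc j) 1ℤ)
                                                             (cong (λ x → 1ℤ ℤ.* ℤ.+ x) (sym (ℕ.+-identityʳ (suc j)))))) ⟩
    toℚᵘ 1ℚ                                           ∎)
    where
    open import Relation.Binary.Reasoning.Setoid ℚᵘ.≃-setoid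

  recip-nonneg : ∀ j → 0ℚ ≤ 1ℤ ℚ./ suc j
  recip-nonneg j = nonNegative⁻¹ (1ℤ ℚ./ suc j) {{normalize-nonNeg 1 (suc j)}}

  ⟨_,_⟩ : ∀ {N} → Vec ℚ N → Vec ℚ N → ℚ
  ⟨ [] , [] ⟩         = 0ℚ
  ⟨ w ∷ ws , x ∷ xs ⟩ = w * x + ⟨ ws , xs ⟩

  ⟨⟩-+ : ∀ {N} (w x y : Vec ℚ N) → ⟨ w , x +ᵥ y ⟩ ≡ ⟨ w , x ⟩ + ⟨ w , y ⟩
  ⟨⟩-+ [] [] [] = refl
  ⟨⟩-+ (w ∷ ws) (x ∷ xs) (y ∷ ys) = trans (cong (w * (x + y) +_) (⟨⟩-+ ws xs ys))
    (solve 5 (λ w x y a b → w :* (x :+ y) :+ (a :+ b) := (w :* x :+ a) :+ (w :* y :+ b)) refl w x y ⟨ ws , xs ⟩ ⟨ ws , ys ⟩)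
    where open +-*-Solver

  ⟨⟩-* : ∀ {N} (w : Vec ℚ N) c x → ⟨ w , c *ᵥ x ⟩ ≡ c * ⟨ w , x ⟩
  ⟨⟩-* [] c [] = sym (*-zeroʳ c)
  ⟨⟩-* (w ∷ ws) c (x ∷ xs) = trans (cong (w * (c * x) +_) (⟨⟩-* ws c xs))
    (solve 4 (λ w c x a → w :* (c :* x) :+ c :* a := c :* (w :* x :+ a)) refl w c x ⟨ ws , xs ⟩)
    where open +-*-Solver

  ⟨⟩-sub : ∀ {N} (w x y : Vec ℚ N) → ⟨ w , x -ᵥ y ⟩ ≡ ⟨ w , x ⟩ - ⟨ w , y ⟩
  ⟨⟩-sub [] [] [] = refl
  ⟨⟩-sub (w ∷ ws) (x ∷ xs) (y ∷ ys) = trans (cong (w * (x - y) +_) (⟨⟩-sub ws xs ys))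
    (solve 5 (λ w x y a b → w :* (x :- y) :+ (a :- b) := (w :* x :+ a) :- (w :* y :+ b)) refl w x y ⟨ ws , xs ⟩ ⟨ ws , ys ⟩)
    where open +-*-Solver

  ⟨⟩-0 : ∀ {N} (w : Vec ℚ N) → ⟨ w , 0ᵥ ⟩ ≡ 0ℚ
  ⟨⟩-0 []       = refl
  ⟨⟩-0 (w ∷ ws) = trans (cong₂ _+_ (*-zeroʳ w) (⟨⟩-0 ws)) (+-identityʳ 0ℚ)

  ⟨⟩-basis : ∀ {N} (w : Vec ℚ N) i → ⟨ w , basis i ⟩ ≡ Vec.lookup w i
  ⟨⟩-basis (w ∷ ws) zero    = trans (cong₂ _+_ (*-identityʳ w) (⟨⟩-0 ws)) (+-identityʳ w)
  ⟨⟩-basis (w ∷ ws) (suc i) = trans (cong₂ _+_ (*-zeroʳ w) (⟨⟩-basis ws i)) (+-identityˡ _)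

  ⟨⟩-1 : ∀ {N} (x : Vec ℚ N) → ⟨ replicate N 1ℚ , x ⟩ ≡ sumℚ x
  ⟨⟩-1 []       = refl
  ⟨⟩-1 (x ∷ xs) = cong₂ _+_ (*-identityˡ x) (⟨⟩-1 xs)

  module _ {N : ℕ} (w : Vec ℚ N) (S : Pred (Vec ℚ N) 0ℓ) where

    ⟨⟩-nonneg : (∀ {s} → S s → 0ℚ ≤ ⟨ w , s ⟩) → ∀ {x} → Conv S x → 0ℚ ≤ ⟨ w , x ⟩
    ⟨⟩-nonneg h (k , xs , cs , xs∈S , cs≥0 , _ , refl) = go xs cs xs∈S cs≥0
      where
      go : ∀ {k} (xs : Vec (Vec ℚ N) k) cs → All S xs → All (0ℚ ≤_) cs → 0ℚ ≤ ⟨ w , combination cs xs ⟩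
      go []       []       []       []       = ≤-reflexive (sym (⟨⟩-0 w))
      go (x ∷ xs) (c ∷ cs) (p ∷ ps) (q ∷ qs) = subst (0ℚ ≤_)
        (sym (trans (⟨⟩-+ w (c *ᵥ x) (combination cs xs)) (cong (_+ ⟨ w , combination cs xs ⟩) (⟨⟩-* w c x))))
        (+-mono-≤ (nonNegative⁻¹ (c * ⟨ w , x ⟩)
            {{nonNeg*nonNeg⇒nonNeg c {{ℚ.nonNegative q}} ⟨ w , x ⟩ {{ℚ.nonNegative (h p)}}}})
          (go xs cs ps qs))

    ⟨⟩-constant : ∀ {a} → (∀ {s} → S s → ⟨ w , s ⟩ ≡ a) → ∀ {x} → Conv S x → ⟨ w , x ⟩ ≡ a
    ⟨⟩-constant {a} h (k , xs , cs , xs∈S , _ , sum≡1 , refl) =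
      trans (go xs cs xs∈S) (trans (cong (_* a) sum≡1) (*-identityˡ a))
      where
      go : ∀ {k} (xs : Vec (Vec ℚ N) k) cs → All S xs → ⟨ w , combination cs xs ⟩ ≡ sumℚ cs * a
      go []       []       []       = trans (⟨⟩-0 w) (sym (*-zeroˡ a))
      go (x ∷ xs) (c ∷ cs) (p ∷ ps) = begin
        ⟨ w , c *ᵥ x +ᵥ combination cs xs ⟩         ≡⟨ ⟨⟩-+ w (c *ᵥ x) (combination cs xs) ⟩
        ⟨ w , c *ᵥ x ⟩ + ⟨ w , combination cs xs ⟩  ≡⟨ cong₂ _+_ (trans (⟨⟩-* w c x) (cong (c *_) (h p))) (go xs cs ps) ⟩
        c * a + sumℚ cs * a                         ≡⟨ *-distribʳ-+ a c (sumℚ cs) ⟨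
        (c + sumℚ cs) * a                           ∎
        where open ≡-Reasoning

  dotℤ : ∀ {N} → Vec ℤ N → Vec ℤ N → ℤ
  dotℤ []       []       = 0ℤ
  dotℤ (w ∷ ws) (z ∷ zs) = w ℤ.* z ℤ.+ dotℤ ws zs

  ⟨⟩-fromℤ : ∀ {N} (w z : Vec ℤ N) → ⟨ Vec.map fromℤ w , Vec.map fromℤ z ⟩ ≡ fromℤ (dotℤ w z)
  ⟨⟩-fromℤ [] [] = refl
  ⟨⟩-fromℤ (w ∷ ws) (z ∷ zs) = trans (cong₂ _+_ (sym (fromℤ-* w z)) (⟨⟩-fromℤ ws zs))
    (sym (fromℤ-+ (w ℤ.* z) (dotℤ ws zs)))

  module _ {N : ℕ} {S : Pred (Vec ℚ N) 0ℓ} {j : ℕ} {z : Vec ℤ N} (w : Vec ℤ N) where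

    private
      -- The functional is multiplied by `j` instead of dividing `z` by `j`, so that the dilate with
      -- `j = 0` is included.
      scaled : ((x , _) : LatticePoint j (Conv S) z) → fromℤ (ℤ.+ j) * ⟨ Vec.map fromℤ w , x ⟩ ≡ fromℤ (dotℤ w z)
      scaled (x , _ , eq) = trans (sym (⟨⟩-* (Vec.map fromℤ w) (fromℤ (ℤ.+ j)) x))
        (trans (cong ⟨ Vec.map fromℤ w ,_⟩ eq) (⟨⟩-fromℤ w z))

    lattice-nonneg : (∀ {s} → S s → 0ℚ ≤ ⟨ Vec.map fromℤ w , s ⟩) → LatticePoint j (Conv S) z → 0ℤ ℤ.≤ dotℤ w z
    lattice-nonneg h p@(x , x∈ , _) = fromℤ-cancel-nonneg (subst (0ℚ ≤_) (scaled p)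
      (nonNegative⁻¹ (fromℤ (ℤ.+ j) * a) {{nonNeg*nonNeg⇒nonNeg (fromℤ (ℤ.+ j)) {{normalize-nonNeg j 1}} a
        {{ℚ.nonNegative (⟨⟩-nonneg (Vec.map fromℤ w) S h x∈)}}}}))
      where a = ⟨ Vec.map fromℤ w , x ⟩

    lattice-total : (∀ {s} → S s → ⟨ Vec.map fromℤ w , s ⟩ ≡ 1ℚ) → LatticePoint j (Conv S) z → dotℤ w z ≡ ℤ.+ j
    lattice-total h p@(x , x∈ , _) = fromℤ-injective (trans (sym (scaled p))
      (trans (cong (fromℤ (ℤ.+ j) *_) (⟨⟩-constant (Vec.map fromℤ w) S h x∈)) (*-identityʳ (fromℤ (ℤ.+ j)))))

  sumᵥ : ∀ {k N} → Vec (Vec ℚ N) k → Vec ℚ N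
  sumᵥ = Vec.foldr′ _+ᵥ_ 0ᵥ

  *ᵥ-+ᵥ : ∀ {N} c (x y : Vec ℚ N) → c *ᵥ (x +ᵥ y) ≡ c *ᵥ x +ᵥ c *ᵥ y
  *ᵥ-+ᵥ c []       []       = refl
  *ᵥ-+ᵥ c (x ∷ xs) (y ∷ ys) = cong₂ _∷_ (*-distribˡ-+ c x y) (*ᵥ-+ᵥ c xs ys)

  *ᵥ-0ᵥ : ∀ {N} c → c *ᵥ 0ᵥ {N} ≡ 0ᵥ
  *ᵥ-0ᵥ {zero}  c = refl
  *ᵥ-0ᵥ {suc N} c = cong₂ _∷_ (*-zeroʳ c) (*ᵥ-0ᵥ c)

  *ᵥ-assoc : ∀ {N} a b (x : Vec ℚ N) → a *ᵥ (b *ᵥ x) ≡ (a * b) *ᵥ x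
  *ᵥ-assoc a b []       = refl
  *ᵥ-assoc a b (x ∷ xs) = cong₂ _∷_ (sym (*-assoc a b x)) (*ᵥ-assoc a b xs)

  *ᵥ-identity : ∀ {N} (x : Vec ℚ N) → 1ℚ *ᵥ x ≡ x
  *ᵥ-identity []       = refl
  *ᵥ-identity (x ∷ xs) = cong₂ _∷_ (*-identityˡ x) (*ᵥ-identity xs)

  +ᵥ-0ᵥ : ∀ {N} (x : Vec ℚ N) → x +ᵥ 0ᵥ ≡ x
  +ᵥ-0ᵥ []       = refl
  +ᵥ-0ᵥ (x ∷ xs) = cong₂ _∷_ (+-identityʳ x) (+ᵥ-0ᵥ xs)

  combination-replicate : ∀ {k N} c (xs : Vec (Vec ℚ N) k) → combination (replicate k c) xs ≡ c *ᵥ sumᵥ xs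
  combination-replicate c []       = sym (*ᵥ-0ᵥ c)
  combination-replicate c (x ∷ xs) = trans (cong (c *ᵥ x +ᵥ_) (combination-replicate c xs)) (sym (*ᵥ-+ᵥ c x (sumᵥ xs)))

  sum-replicate : ∀ k c → sumℚ (replicate k c) ≡ fromℤ (ℤ.+ k) * c
  sum-replicate zero    c = sym (*-zeroˡ c)
  sum-replicate (suc k) c = begin
    c + sumℚ (replicate k c)       ≡⟨ cong (c +_) (sum-replicate k c) ⟩
    c + fromℤ (ℤ.+ k) * c            ≡⟨ cong (_+ fromℤ (ℤ.+ k) * c) (*-identityˡ c) ⟨
    1ℚ * c + fromℤ (ℤ.+ k) * c       ≡⟨ *-distribʳ-+ c 1ℚ (fromℤ (ℤ.+ k)) ⟨
    (1ℚ + fromℤ (ℤ.+ k)) * c         ≡⟨ cong (_* c) (fromℤ-+ 1ℤ (ℤ.+ k)) ⟨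
    fromℤ (ℤ.+ suc k) * c            ∎
    where open ≡-Reasoning

  -- The point of the hull is the average of the generators, with all weights equal to `1 / j`. For
  -- `j = 0` there is nothing to average and any point of the hull is scaled to zero; `s₀` provides
  -- one.
  sum-of-generators : ∀ {N} {S : Pred (Vec ℚ N) 0ℓ} {s₀} → S s₀ → ∀ {j} (xs : Vec (Vec ℚ N) j) → All S xs →
    ∀ {z} → sumᵥ xs ≡ Vec.map fromℤ z → LatticePoint j (Conv S) z
  sum-of-generators {N} {s₀ = s₀} s₀∈ {zero} [] _ {z} eq =
    s₀ , (1 , s₀ ∷ [] , 1ℚ ∷ [] , s₀∈ ∷ [] , ≤ᵇ⇒≤ _ ∷ [] , refl , trans (cong (_+ᵥ 0ᵥ) (*ᵥ-identity s₀)) (+ᵥ-0ᵥ s₀)) ,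
    trans (zero-*ᵥ s₀) eq
    where
    zero-*ᵥ : ∀ {N} (x : Vec ℚ N) → fromℤ (ℤ.+ 0) *ᵥ x ≡ 0ᵥ
    zero-*ᵥ []       = refl
    zero-*ᵥ (x ∷ xs) = cong₂ _∷_ (*-zeroˡ x) (zero-*ᵥ xs)
  sum-of-generators {S = S} _ {suc j} xs xs∈S {z} eq =
    combination cs xs , (suc j , xs , cs , xs∈S , replicate⁺ (suc j) , trans (sum-replicate (suc j) c) (fromℤ-recip j) , refl) ,
    (begin
      fromℤ (ℤ.+ suc j) *ᵥ combination cs xs        ≡⟨ cong (fromℤ (ℤ.+ suc j) *ᵥ_) (combination-replicate c xs) ⟩
      fromℤ (ℤ.+ suc j) *ᵥ (c *ᵥ sumᵥ xs)           ≡⟨ *ᵥ-assoc (fromℤ (ℤ.+ suc j)) c (sumᵥ xs) ⟩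
      (fromℤ (ℤ.+ suc j) * c) *ᵥ sumᵥ xs            ≡⟨ cong (_*ᵥ sumᵥ xs) (fromℤ-recip j) ⟩
      1ℚ *ᵥ sumᵥ xs                               ≡⟨ *ᵥ-identity (sumᵥ xs) ⟩
      sumᵥ xs                                     ≡⟨ eq ⟩
      Vec.map fromℤ z                             ∎)
    where
    open ≡-Reasoning
    c  = 1ℤ ℚ./ suc j
    cs = replicate (suc j) c
    replicate⁺ : ∀ k → All (0ℚ ≤_) (replicate k c)
    replicate⁺ zero    = []
    replicate⁺ (suc k) = recip-nonneg j ∷ replicate⁺ k

  combination-basis : ∀ {N} (cs : Vec ℚ N) → combination cs (Vec.tabulate basis) ≡ cs
  combination-basis []       = refl
  combination-basis {suc N} (c ∷ cs) = begin
    c *ᵥ (1ℚ ∷ 0ᵥ) +ᵥ combination cs (Vec.tabulate (λ i → 0ℚ ∷ basis i))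
      ≡⟨ cong (λ xs → c *ᵥ (1ℚ ∷ 0ᵥ) +ᵥ combination cs xs) (tabulate-∘ (0ℚ ∷_) basis) ⟩
    c *ᵥ (1ℚ ∷ 0ᵥ) +ᵥ combination cs (Vec.map (0ℚ ∷_) (Vec.tabulate basis))
      ≡⟨ cong (c *ᵥ (1ℚ ∷ 0ᵥ) +ᵥ_) (pad cs (Vec.tabulate basis)) ⟩
    (c * 1ℚ + 0ℚ) ∷ (c *ᵥ 0ᵥ +ᵥ combination cs (Vec.tabulate basis))
      ≡⟨ cong₂ _∷_ (trans (+-identityʳ (c * 1ℚ)) (*-identityʳ c))
                   (trans (cong₂ _+ᵥ_ (*ᵥ-0ᵥ c) (combination-basis cs)) (0ᵥ-+ᵥ cs)) ⟩
    c ∷ cs ∎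
    where
    open ≡-Reasoning
    0ᵥ-+ᵥ : ∀ {N} (x : Vec ℚ N) → 0ᵥ +ᵥ x ≡ x
    0ᵥ-+ᵥ []       = refl
    0ᵥ-+ᵥ (x ∷ xs) = cong₂ _∷_ (+-identityˡ x) (0ᵥ-+ᵥ xs)
    pad : ∀ {k N} cs (xs : Vec (Vec ℚ N) k) → combination cs (Vec.map (0ℚ ∷_) xs) ≡ 0ℚ ∷ combination cs xs
    pad []       []       = refl
    pad (c ∷ cs) (x ∷ xs) = trans (cong ((c * 0ℚ ∷ c *ᵥ x) +ᵥ_) (pad cs xs))
      (cong (_∷ (c *ᵥ x +ᵥ combination cs xs)) (trans (+-identityʳ (c * 0ℚ)) (*-zeroʳ c)))

-- Lattice points of the dilates are the points of the cone

module LatticePoints where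

  open Graph
  open FlowsAndCuts
  open Cardinality
  open CountingPoints
  open RationalVectors
  open import Data.Bool.Base using (Bool; true; false; _xor_)
  open import Data.Fin.Base using (Fin; zero; suc; _↑ˡ_; _↑ʳ_; splitAt)
  open import Data.Fin.Properties using (_≟_; splitAt⁻¹-↑ˡ; splitAt⁻¹-↑ʳ)
  open import Data.Integer.Base as ℤ hiding (suc; _/_)
  open import Data.Integer.Properties hiding (_≟_)
  open import Data.Integer.Tactic.RingSolver using (solve-∀)
  open import Data.Nat.Base as ℕ using (ℕ; zero; suc; z≤n; s≤s)
  import Data.Nat.Properties as ℕ
  open import Data.Product.Base using (Σ-syntax; ∃-syntax; _×_; _,_)
  open import Data.Rational.Base as ℚ using (ℚ; 0ℚ; 1ℚ)
  import Data.Rational.Properties as ℚ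
  open import Data.Sum.Base using (inj₁; inj₂)
  open import Data.Vec.Base as Vec using (Vec; []; _∷_; lookup; tabulate; _++_)
  open import Data.Vec.Properties
    using (lookup-map; lookup-replicate; lookup-++ˡ; lookup-++ʳ; lookup∘tabulate; tabulate∘lookup;
           tabulate-cong; lookup-zipWith; take++drop≡id; ++-injective)
  open import Data.Vec.Relation.Unary.All using (All; []; _∷_)
  open import Data.Vec.Relation.Unary.All.Properties using (tabulate⁺)
  open import Function.Base using (_∘_)
  open import Relation.Binary.PropositionalEquality
  open import Relation.Nullary using (yes; no)

  -- Each cut inequality is a linear functional that is nonnegative on the generators.

  dot-++ : ∀ {n m} (a : Fin n → ℤ) (b : Fin m → ℤ) (x : Vec ℤ n) (y : Vec ℤ m) →
    dotℤ (tabulate a ++ tabulate b) (x ++ y) ≡ sum (λ i → a i * lookup x i) + sum (λ f → b f * lookup y f)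
  dot-++ a b []       []       = refl
  dot-++ a b []       (y ∷ ys) = trans (cong (_+_ (b zero * y)) (trans (dot-++ a (b ∘ suc) [] ys) (+-identityˡ _))) (sym (+-identityˡ _))
  dot-++ a b (x ∷ xs) y        = trans (cong (_+_ (a zero * x)) (dot-++ (a ∘ suc) b xs y)) (sym (+-assoc (a zero * x) _ _))

  module _ {n m : ℕ} (G : Multigraph n m) (a : Fin n → ℤ) (b : Fin m → ℤ) where

    generatorValue : ∀ {s} → Generator G s → ℤ
    generatorValue (edge f)  = b f
    generatorValue (tilde f) = a (src G f) + a (tgt G f) - b f
    generatorValue (left f)  = a (src G f) - a (tgt G f) + b f
    generatorValue (right f) = a (tgt G f) - a (src G f) + b f
    generatorValue (node u)  = a u

    module _ (φ : Vec ℚ (n ℕ.+ m) → ℚ)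
      (φ-+ : ∀ x y → φ (x +ᵥ y) ≡ φ x ℚ.+ φ y) (φ-sub : ∀ x y → φ (x -ᵥ y) ≡ φ x ℚ.- φ y)
      (φ-V : ∀ u → φ (eV G u) ≡ fromℤ (a u)) (φ-E : ∀ f → φ (eE G f) ≡ fromℤ (b f)) where

      private
        plus : ∀ {x y} c d → φ x ≡ fromℤ c → φ y ≡ fromℤ d → φ (x +ᵥ y) ≡ fromℤ (c + d)
        plus {x} {y} c d p q = trans (φ-+ x y) (trans (cong₂ ℚ._+_ p q) (sym (fromℤ-+ c d)))

        minus : ∀ {x y} c d → φ x ≡ fromℤ c → φ y ≡ fromℤ d → φ (x -ᵥ y) ≡ fromℤ (c - d)
        minus {x} {y} c d p q = trans (φ-sub x y) (trans (cong₂ ℚ._-_ p q) (sym (fromℤ-sub c d)))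

      -- `φ` is abstract because it is used twice: as the pairing with an integral functional, and
      -- as a single coordinate of a generator.
      functional-value : ∀ {s} (g : Generator G s) → φ s ≡ fromℤ (generatorValue g)
      functional-value (edge f)  = φ-E f
      functional-value (tilde f) = minus (a u + a v) (b f) (plus (a u) (a v) (φ-V u) (φ-V v)) (φ-E f)
        where u = src G f ; v = tgt G f
      functional-value (left f)  = plus (a u - a v) (b f) (minus (a u) (a v) (φ-V u) (φ-V v)) (φ-E f)
        where u = src G f ; v = tgt G f
      functional-value (right f) = plus (a u - a v) (b f) (minus (a u) (a v) (φ-V u) (φ-V v)) (φ-E f)
        where u = tgt G f ; v = src G f
      functional-value (node u)  = φ-V u

    private
      w : Vec ℤ (n ℕ.+ m)
      w = tabulate a ++ tabulate b

      W : Vec ℚ (n ℕ.+ m)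
      W = Vec.map fromℤ w

      W-V : ∀ u → ⟨ W , eV G u ⟩ ≡ fromℤ (a u)
      W-V u = trans (⟨⟩-basis W (u ↑ˡ m)) (trans (lookup-map (u ↑ˡ m) fromℤ w)
        (cong fromℤ (trans (lookup-++ˡ (tabulate a) (tabulate b) u) (lookup∘tabulate a u))))

      W-E : ∀ f → ⟨ W , eE G f ⟩ ≡ fromℤ (b f)
      W-E f = trans (⟨⟩-basis W (n ↑ʳ f)) (trans (lookup-map (n ↑ʳ f) fromℤ w)
        (cong fromℤ (trans (lookup-++ʳ (tabulate a) (tabulate b) f) (lookup∘tabulate b f))))

    generator-value : ∀ {s} (g : Generator G s) → ⟨ W , s ⟩ ≡ fromℤ (generatorValue g)
    generator-value = functional-value ⟨ W ,_⟩ (⟨⟩-+ W) (⟨⟩-sub W) W-V W-E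

  private
    -- `κ` is only piecewise linear in the weight, and `slope` is the coefficient of the piece
    -- containing `c`. The functional is thus chosen according to the lattice point at which it will
    -- be evaluated; once chosen, it is linear and nonnegative on the entire polytope.
    slope : Bool → Bool → ℤ → ℤ
    slope a b (+ _)    = ⟦ a xor b ⟧
    slope a b -[1+ _ ] = ⟦ a ⟧ + ⟦ b ⟧

    slope-* : ∀ a b c → slope a b c * c ≡ κ a b c
    slope-* a b (+ c) with a xor b
    ... | true  = *-identityˡ (+ c)
    ... | false = refl
    slope-* a b -[1+ c ] = *-comm (⟦ a ⟧ + ⟦ b ⟧) -[1+ c ]

    0≤+ : ∀ {k} → 0ℤ ≤ + k
    0≤+ = +≤+ z≤n

    bit : ∀ a → 0ℤ ≤ ⟦ a ⟧
    bit true  = 0≤+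
    bit false = 0≤+

    slope-edge : ∀ a b c → 0ℤ ≤ slope a b c
    slope-edge a b (+ _)    = bit (a xor b)
    slope-edge a b -[1+ _ ] = +-mono-≤ (bit a) (bit b)

    slope-tilde : ∀ a b c → 0ℤ ≤ ⟦ a ⟧ + ⟦ b ⟧ - slope a b c
    slope-tilde true  true  (+ _)    = 0≤+
    slope-tilde true  false (+ _)    = 0≤+
    slope-tilde false true  (+ _)    = 0≤+
    slope-tilde false false (+ _)    = 0≤+
    slope-tilde a     b     -[1+ _ ] = ≤-reflexive (sym (+-inverseʳ (⟦ a ⟧ + ⟦ b ⟧)))

    slope-left : ∀ a b c → 0ℤ ≤ ⟦ a ⟧ - ⟦ b ⟧ + slope a b c
    slope-left true  true  (+ _)    = 0≤+
    slope-left true  true  -[1+ _ ] = 0≤+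
    slope-left true  false (+ _)    = 0≤+
    slope-left true  false -[1+ _ ] = 0≤+
    slope-left false true  (+ _)    = 0≤+
    slope-left false true  -[1+ _ ] = 0≤+
    slope-left false false (+ _)    = 0≤+
    slope-left false false -[1+ _ ] = 0≤+

    slope-right : ∀ a b c → 0ℤ ≤ ⟦ b ⟧ - ⟦ a ⟧ + slope a b c
    slope-right true  true  (+ _)    = 0≤+
    slope-right true  true  -[1+ _ ] = 0≤+
    slope-right true  false (+ _)    = 0≤+
    slope-right true  false -[1+ _ ] = 0≤+
    slope-right false true  (+ _)    = 0≤+
    slope-right false true  -[1+ _ ] = 0≤+
    slope-right false false (+ _)    = 0≤+
    slope-right false false -[1+ _ ] = 0≤+

  module _ {n m : ℕ} (G : Multigraph n m) where

    lattice⇒cut : ∀ {j} (x : Vec ℤ n) (y : Vec ℤ m) →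
      LatticePoint j (CosmologicalPolytope G) (x ++ y) → Cut G (lookup x) (lookup y)
    lattice⇒cut {j} x y p S = subst (0ℤ ≤_) (trans (dot-++ a b x y)
        (cong (_+_ (sum (λ i → a i * lookup x i))) (sum-cong-≗ λ f → slope-* (s (src G f)) (s (tgt G f)) (lookup y f))))
      (lattice-nonneg {j = j} (tabulate a ++ tabulate b)
        (λ g → subst (ℚ._≤_ 0ℚ) (sym (generator-value G a b g)) (fromℤ-nonneg (nonneg g))) p)
      where
      s : Fin n → Bool
      s = lookup S
      a : Fin n → ℤ
      a i = ⟦ s i ⟧
      b : Fin m → ℤ
      b f = slope (s (src G f)) (s (tgt G f)) (lookup y f)
      nonneg : ∀ {q} (g : Generator G q) → 0ℤ ≤ generatorValue G a b g
      nonneg (edge f)  = slope-edge (s (src G f)) (s (tgt G f)) (lookup y f)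
      nonneg (tilde f) = slope-tilde (s (src G f)) (s (tgt G f)) (lookup y f)
      nonneg (left f)  = slope-left (s (src G f)) (s (tgt G f)) (lookup y f)
      nonneg (right f) = slope-right (s (src G f)) (s (tgt G f)) (lookup y f)
      nonneg (node u)  = bit (s u)

    private
      ones : ∀ {s} (g : Generator G s) → generatorValue G (λ _ → 1ℤ) (λ _ → 1ℤ) g ≡ 1ℤ
      ones (edge f)  = refl
      ones (tilde f) = refl
      ones (left f)  = refl
      ones (right f) = refl
      ones (node u)  = refl

      ones-generator : ∀ {s} → Generator G s →
        ⟨ Vec.map fromℤ (tabulate {n = n} (λ _ → 1ℤ) ++ tabulate {n = m} (λ _ → 1ℤ)) , s ⟩ ≡ 1ℚ
      ones-generator g = trans (generator-value G (λ _ → 1ℤ) (λ _ → 1ℤ) g) (cong fromℤ (ones g))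

    lattice⇒points : ∀ {j} (x : Vec ℤ n) (y : Vec ℤ m) →
      LatticePoint j (CosmologicalPolytope G) (x ++ y) → Points G j (x , y)
    lattice⇒points {j} x y p = Cut⇒Feasible G (lattice⇒cut {j} x y p) ,
      trans (sym (trans (dot-++ (λ _ → 1ℤ) (λ _ → 1ℤ) x y)
                        (cong₂ _+_ (sum-cong-≗ (λ i → *-identityˡ (lookup x i))) (sum-cong-≗ (λ f → *-identityˡ (lookup y f))))))
            (lattice-total {j = j} (tabulate {n = n} (λ _ → 1ℤ) ++ tabulate {n = m} (λ _ → 1ℤ)) ones-generator p)

    coordinate-sum : ∀ {p} → CosmologicalPolytope G p → sumℚ p ≡ 1ℚ
    coordinate-sum {p} p∈ = trans (sym (⟨⟩-1 p)) (trans (cong ⟨_, p ⟩ (sym (map-ones n m)))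
      (⟨⟩-constant (Vec.map fromℤ (tabulate {n = n} (λ _ → 1ℤ) ++ tabulate {n = m} (λ _ → 1ℤ))) (Generator G) ones-generator p∈))
      where
      map-ones : ∀ n m → Vec.map fromℤ (tabulate {n = n} (λ _ → 1ℤ) ++ tabulate {n = m} (λ _ → 1ℤ)) ≡ Vec.replicate (n ℕ.+ m) 1ℚ
      map-ones zero    zero    = refl
      map-ones zero    (suc m) = cong (1ℚ ∷_) (map-ones zero m)
      map-ones (suc n) m       = cong (1ℚ ∷_) (map-ones n m)

  -- Integer decomposition into generators

  data Gen (n m : ℕ) : Set where
    edge tilde left right : Fin m → Gen n m
    node                  : Fin n → Gen n m

  module _ {n m : ℕ} (G : Multigraph n m) where

    genV : Gen n m → Fin n → ℤ
    genV (edge f)  i = 0ℤ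
    genV (tilde f) i = δ (src G f) i + δ (tgt G f) i
    genV (left f)  i = δ (src G f) i - δ (tgt G f) i
    genV (right f) i = δ (tgt G f) i - δ (src G f) i
    genV (node u)  i = δ u i

    genE : Gen n m → Fin m → ℤ
    genE (edge f)  k = δ f k
    genE (tilde f) k = - δ f k
    genE (left f)  k = δ f k
    genE (right f) k = δ f k
    genE (node u)  k = 0ℤ

    -- Sums of exactly `j` generators, with integral coordinates as long as the decomposition is
    -- being built. The coordinates are tied by pointwise equations instead of indices, because
    -- vectors here are functions.
    data GeneratorSum : ℕ → (Fin n → ℤ) → (Fin m → ℤ) → Set where
      none : ∀ {x y} → (∀ i → x i ≡ 0ℤ) → (∀ f → y f ≡ 0ℤ) → GeneratorSum 0 x y
      add  : ∀ g {j x y x′ y′} → (∀ i → x i ≡ x′ i + genV g i) → (∀ f → y f ≡ y′ f + genE g f) →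
             GeneratorSum j x′ y′ → GeneratorSum (suc j) x y

    GeneratorSum-resp : ∀ {j x y x′ y′} → x ≗ x′ → y ≗ y′ → GeneratorSum j x y → GeneratorSum j x′ y′
    GeneratorSum-resp x≗ y≗ (none p q)    = none (λ i → trans (sym (x≗ i)) (p i)) (λ f → trans (sym (y≗ f)) (q f))
    GeneratorSum-resp x≗ y≗ (add g p q c) = add g (λ i → trans (sym (x≗ i)) (p i)) (λ f → trans (sym (y≗ f)) (q f)) c

    add^ : ∀ g k {j x y} → GeneratorSum j x y → GeneratorSum (k ℕ.+ j) (λ i → x i + + k * genV g i) (λ f → y f + + k * genE g f)
    add^ g zero    c = GeneratorSum-resp (λ i → sym (+-identityʳ _)) (λ f → sym (+-identityʳ _)) c
    add^ g (suc k) {x = x} {y} c = add g (λ i → step (x i) (genV g i)) (λ f → step (y f) (genE g f)) (add^ g k c)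
      where
      lem : ∀ x k g → x + (1ℤ + k) * g ≡ x + k * g + g
      lem = solve-∀
      step : ∀ x g → x + + suc k * g ≡ x + + k * g + g
      step x g = lem x (+ k) g

  private
    embed : ∀ {n m} → Gen n m → Gen n (suc m)
    embed (edge f)  = edge (suc f)
    embed (tilde f) = tilde (suc f)
    embed (left f)  = left (suc f)
    embed (right f) = right (suc f)
    embed (node u)  = node u

    genV-embed : ∀ {n m} (G : Multigraph n (suc m)) g → genV (delete G) g ≗ genV G (embed g)
    genV-embed G (edge f)  i = refl
    genV-embed G (tilde f) i = refl
    genV-embed G (left f)  i = refl
    genV-embed G (right f) i = refl
    genV-embed G (node u)  i = refl

    genE-embed : ∀ {n m} (G : Multigraph n (suc m)) g → genE (delete G) g ≗ genE G (embed g) ∘ suc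
    genE-embed G (edge f)  k = refl
    genE-embed G (tilde f) k = refl
    genE-embed G (left f)  k = refl
    genE-embed G (right f) k = refl
    genE-embed G (node u)  k = refl

    genE-embed-zero : ∀ {n m} (G : Multigraph n (suc m)) g → genE G (embed g) zero ≡ 0ℤ
    genE-embed-zero G (edge f)  = refl
    genE-embed-zero G (tilde f) = refl
    genE-embed-zero G (left f)  = refl
    genE-embed-zero G (right f) = refl
    genE-embed-zero G (node u)  = refl

  extendE : ∀ {m} → ℤ → (Fin m → ℤ) → Fin (suc m) → ℤ
  extendE c y zero    = c
  extendE c y (suc f) = y f

  GeneratorSum-delete : ∀ {n m} (G : Multigraph n (suc m)) {j x y} → GeneratorSum (delete G) j x y → GeneratorSum G j x (extendE 0ℤ y)
  GeneratorSum-delete G (none p q) = none p λ where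
    zero    → refl
    (suc f) → q f
  GeneratorSum-delete G (add g {x′ = x′} {y′} p q c) = add (embed g)
    (λ i → trans (p i) (cong (_+_ (x′ i)) (genV-embed G g i)))
    (λ where
      zero    → sym (trans (+-identityˡ _) (genE-embed-zero G g))
      (suc f) → trans (q f) (cong (_+_ (y′ f)) (genE-embed G g f)))
    (GeneratorSum-delete G c)

  private
    sum≡0 : ∀ {n} (x : Fin n → ℤ) → (∀ i → 0ℤ ≤ x i) → sum x ≡ 0ℤ → ∀ i → x i ≡ 0ℤ
    sum≡0 {suc n} x x≥0 eq = λ where
        zero    → head≡0
        (suc i) → sum≡0 (x ∘ suc) (x≥0 ∘ suc) (trans (sym (+-identityˡ _)) (trans (cong (_+ sum (x ∘ suc)) (sym head≡0)) eq)) i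
      where
      rest≥0 : 0ℤ ≤ sum (x ∘ suc)
      rest≥0 = subst (_≤ sum (x ∘ suc)) (sum-replicate-zero n) (sum-mono (x≥0 ∘ suc))
      head≡0 : x zero ≡ 0ℤ
      head≡0 = ≤-antisym (subst₂ _≤_ (+-identityʳ (x zero)) eq (+-monoʳ-≤ (x zero) rest≥0)) (x≥0 zero)

    positive-entry : ∀ {n j} (x : Fin n → ℤ) → (∀ i → 0ℤ ≤ x i) → sum x ≡ + suc j → ∃[ i ] 1ℤ ≤ x i
    positive-entry {suc n} x x≥0 eq with x zero in x₀ | x≥0 zero
    ... | + suc k | _ = zero , subst (1ℤ ≤_) (sym x₀) (+≤+ (s≤s z≤n))
    ... | + zero  | _ with positive-entry (x ∘ suc) (x≥0 ∘ suc) (trans (sym (+-identityˡ _)) eq)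
    ...   | i , p = suc i , p

    -- A nonnegative integer vector with positive total has an entry of at least one, from which a
    -- unit vector can be split off.
    nodes : ∀ {n m} (G : Multigraph n m) j {x} → (∀ i → 0ℤ ≤ x i) → sum x ≡ + j → GeneratorSum G j x (λ _ → 0ℤ)
    nodes G zero    {x} x≥0 eq = none (sum≡0 x x≥0 eq) (λ _ → refl)
    nodes G (suc j) {x} x≥0 eq with positive-entry x x≥0 eq
    ... | i , 1≤xi = add (node i) {x′ = x′} (λ k → recover (x k) (δ i k)) (λ _ → refl) (nodes G j x′≥0 total′)
      where
      x′ : _ → ℤ
      x′ k = x k + -1ℤ * δ i k
      recover : ∀ a d → a ≡ a + -1ℤ * d + d
      recover = solve-∀
      x′≥0 : ∀ k → 0ℤ ≤ x′ k
      x′≥0 k with i ≟ k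
      ... | yes refl = subst (0ℤ ≤_) (trans (lem (x i)) (cong (λ d → x i + -1ℤ * d) (sym (δ-refl i)))) (i≤j⇒0≤j-i 1≤xi)
        where lem : ∀ a → a - 1ℤ ≡ a + -1ℤ * 1ℤ
              lem = solve-∀
      ... | no i≢k = subst (0ℤ ≤_) (sym (trans (cong (λ d → x k + -1ℤ * d) (δ-≢ i≢k)) (+-identityʳ (x k)))) (x≥0 k)
      total′ : sum x′ ≡ + j
      total′ = begin
        sum x′                                 ≡⟨ sum-cong-≗ (λ k → *-identityˡ (x′ k)) ⟨
        sum (λ k → 1ℤ * x′ k)                  ≡⟨ sum-*-+ (λ _ → 1ℤ) x (δ i) -1ℤ ⟩
        sum (λ k → 1ℤ * x k) + -1ℤ * sum (λ k → 1ℤ * δ i k)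
          ≡⟨ cong₂ (λ p q → p + -1ℤ * q) (trans (sum-cong-≗ (λ k → *-identityˡ (x k))) eq) (sum-δ (λ _ → 1ℤ) i) ⟩
        + suc j + -1ℤ * 1ℤ                     ≡⟨⟩
        + j                                    ∎
        where open ≡-Reasoning

  -- A flow is a recipe. An edge of weight `c ≥ 0` with flow `t` stands for `∣ t ∣` copies of `left`
  -- or `right` and `c - ∣ t ∣` copies of `edge`; one of negative weight `c` stands for `∣ c ∣`
  -- copies of `tilde`; the nonnegative remainder consists of nodes. Each generator has coordinate
  -- sum one, so the total counts them.
  Feasible⇒GeneratorSum : ∀ {n m} (G : Multigraph n m) j {x y} → Feasible G x y → sum x + sum y ≡ + j → GeneratorSum G j x y
  Feasible⇒GeneratorSum {m = zero} G j {x} p eq = GeneratorSum-resp G (λ _ → refl) (λ ()) (nodes G j p (trans (sym (+-identityʳ (sum x))) eq))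
  Feasible⇒GeneratorSum {n} {suc m} G j {x} {y} p eq = GeneratorSum-resp G (λ _ → refl) (λ where zero → refl ; (suc f) → refl) (go (y zero) p eq′)
    where
    u = src G zero
    v = tgt G zero
    r = sum (y ∘ suc)

    rearrange : ∀ a b c → a + (b + c) ≡ a + c + b
    rearrange = solve-∀

    eq′ : sum x + r + y zero ≡ + j
    eq′ = trans (sym (rearrange (sum x) (y zero) r)) eq

    tail-cone : ∀ j′ {x′} → Feasible (delete G) x′ (y ∘ suc) → sum x′ + r ≡ + j′ → GeneratorSum G j′ x′ (extendE 0ℤ (y ∘ suc))
    tail-cone j′ f e = GeneratorSum-delete G (Feasible⇒GeneratorSum (delete G) j′ f e)

    flow : ∀ g h a b {x′ j′} → GeneratorSum G j′ x′ (extendE 0ℤ (y ∘ suc)) →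
      genE G g ≗ δ zero → genE G h ≗ δ zero → a ℕ.+ (b ℕ.+ j′) ≡ j →
      (∀ i → x i ≡ x′ i + + b * genV G h i + + a * genV G g i) →
      GeneratorSum G j x (extendE (+ (a ℕ.+ b)) (y ∘ suc))
    flow g h a b {x′} {j′} c g≗ h≗ j≡ x≡ = subst (λ k → GeneratorSum G k x _) j≡ (GeneratorSum-resp G (λ i → sym (x≡ i))
        (λ f → trans (cong₂ (λ p q → extendE 0ℤ (y ∘ suc) f + + b * p + + a * q) (h≗ f) (g≗ f)) (last f))
        (add^ G g a (add^ G h b c)))
      where
      last : ∀ f → extendE 0ℤ (y ∘ suc) f + + b * δ zero f + + a * δ zero f ≡ extendE (+ (a ℕ.+ b)) (y ∘ suc) f
      last zero    = lem (+ a) (+ b)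
        where lem : ∀ a b → 0ℤ + b * 1ℤ + a * 1ℤ ≡ a + b
              lem = solve-∀
      last (suc f) = lem (y (suc f)) (+ a) (+ b)
        where lem : ∀ y a b → y + b * 0ℤ + a * 0ℤ ≡ y
              lem = solve-∀

    go : ∀ c → Step c u v (λ x′ → Feasible (delete G) x′ (y ∘ suc)) x → sum x + r + c ≡ + j →
         GeneratorSum G j x (extendE c (y ∘ suc))
    go (+ c) (t , -c≤t , t≤c , f) e = oriented t -c≤t t≤c f
      where
      base : ∀ t → Feasible (delete G) (transfer u v t x) (y ∘ suc) → ∃[ j′ ] (sum (transfer u v t x) + r ≡ + j′ × c ℕ.+ j′ ≡ j)
      base t f with sum (transfer u v t x) + r in s | feasible-total (delete G) f
      ... | + j′ | _ = j′ , refl , +-injective (trans (+-comm (+ c) (+ j′))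
        (trans (cong (_+ + c) (trans (sym s) (cong (_+ r) (total-transfer u v t x)))) e))

      oriented : ∀ t → - + c ≤ t → t ≤ + c → Feasible (delete G) (transfer u v t x) (y ∘ suc) →
        GeneratorSum G j x (extendE (+ c) (y ∘ suc))
      -- A flow `t ≥ 0` takes units from the target to the source, so restoring `x` calls for
      -- `right`, which carries them back.
      oriented (+ t) _ t≤c f with base (+ t) f
      ... | j′ , s , j≡ = subst (λ k → GeneratorSum G j x (extendE (+ k) (y ∘ suc))) c≡
        (flow (right zero) (edge zero) t (c ℕ.∸ t) (tail-cone j′ f s) (λ _ → refl) (λ _ → refl)
          (trans (sym (ℕ.+-assoc t (c ℕ.∸ t) j′)) (trans (cong (ℕ._+ j′) c≡) j≡))
          (λ i → lem (x i) (+ t) (δ u i) (δ v i) (+ (c ℕ.∸ t))))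
        where
        c≡ : t ℕ.+ (c ℕ.∸ t) ≡ c
        c≡ = ℕ.m+[n∸m]≡n (drop‿+≤+ t≤c)
        lem : ∀ x t p q b → x ≡ x + t * (p - q) + b * 0ℤ + t * (q - p)
        lem = solve-∀
      oriented -[1+ t ] -c≤t _ f with base -[1+ t ] f
      ... | j′ , s , j≡ = subst (λ k → GeneratorSum G j x (extendE (+ k) (y ∘ suc))) c≡
        (flow (left zero) (edge zero) (suc t) (c ℕ.∸ suc t) (tail-cone j′ f s) (λ _ → refl) (λ _ → refl)
          (trans (sym (ℕ.+-assoc (suc t) (c ℕ.∸ suc t) j′)) (trans (cong (ℕ._+ j′) c≡) j≡))
          (λ i → lem (x i) (+ suc t) (δ u i) (δ v i) (+ (c ℕ.∸ suc t))))
        where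
        c≡ : suc t ℕ.+ (c ℕ.∸ suc t) ≡ c
        c≡ = ℕ.m+[n∸m]≡n (drop‿+≤+ (subst (+ suc t ≤_) (neg-involutive (+ c)) (neg-mono-≤ -c≤t)))
        lem : ∀ x t p q b → x ≡ x + - t * (p - q) + b * 0ℤ + t * (p - q)
        lem = solve-∀
    go -[1+ c ] f e with sum (consume u v -[1+ c ] x) + r in s | feasible-total (delete G) f
    ... | + j′ | _ = subst (λ k → GeneratorSum G k x _) j≡ (GeneratorSum-resp G
            (λ i → lem (x i) (+ suc c) (δ u i + δ v i))
            (λ where
              zero    → lem₀ (+ suc c)
              (suc f) → lem₁ (y (suc f)) (+ suc c))
            (add^ G (tilde zero) (suc c) (tail-cone j′ f s)))
      where
      lem : ∀ x t p → x + - t * p + t * p ≡ x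
      lem = solve-∀
      lem₀ : ∀ t → 0ℤ + t * - 1ℤ ≡ - t
      lem₀ = solve-∀
      lem₁ : ∀ y t → y + t * - 0ℤ ≡ y
      lem₁ = solve-∀
      lem₂ : ∀ a t r → t + (a + - t * + 2 + r) ≡ a + r + - t
      lem₂ = solve-∀
      j≡ : suc c ℕ.+ j′ ≡ j
      j≡ = +-injective (trans (cong (_+_ (+ suc c)) (sym s))
        (trans (cong (λ a → + suc c + (a + r)) (total-consume u v -[1+ c ] x)) (trans (lem₂ (sum x) (+ suc c) r) e)))

  -- From integral decompositions to rational vectors

  private
    vec-ext : ∀ {N} {A : Set} {x y : Vec A N} → lookup x ≗ lookup y → x ≡ y
    vec-ext {x = x} {y} eq = trans (sym (tabulate∘lookup x)) (trans (tabulate-cong eq) (tabulate∘lookup y))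

    ++-ext : ∀ {n m} {A : Set} {p q : Vec A (n ℕ.+ m)} →
      (∀ i → lookup p (i ↑ˡ m) ≡ lookup q (i ↑ˡ m)) → (∀ f → lookup p (n ↑ʳ f) ≡ lookup q (n ↑ʳ f)) → p ≡ q
    ++-ext {n} {m} {p = p} {q} V E = vec-ext λ k → split k
      where
      split : lookup p ≗ lookup q
      split k with splitAt n k in eq
      ... | inj₁ i = subst (λ k → lookup p k ≡ lookup q k) (splitAt⁻¹-↑ˡ eq) (V i)
      ... | inj₂ f = subst (λ k → lookup p k ≡ lookup q k) (splitAt⁻¹-↑ʳ eq) (E f)

    lookup-basis : ∀ {N} (i k : Fin N) → lookup (basis i) k ≡ fromℤ (δ i k)
    lookup-basis zero    zero    = refl
    lookup-basis zero    (suc k) = lookup-replicate k 0ℚ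
    lookup-basis (suc i) zero    = refl
    lookup-basis (suc i) (suc k) = lookup-basis i k

    δ-↑ˡ : ∀ {n} m (i k : Fin n) → δ (i ↑ˡ m) (k ↑ˡ m) ≡ δ i k
    δ-↑ˡ m zero    zero    = refl
    δ-↑ˡ m zero    (suc k) = refl
    δ-↑ˡ m (suc i) zero    = refl
    δ-↑ˡ m (suc i) (suc k) = δ-↑ˡ m i k

    δ-↑ʳ : ∀ n {m} (i k : Fin m) → δ (n ↑ʳ i) (n ↑ʳ k) ≡ δ i k
    δ-↑ʳ zero    i k = refl
    δ-↑ʳ (suc n) i k = δ-↑ʳ n i k

    δ-↑ˡʳ : ∀ {n m} (i : Fin n) (k : Fin m) → δ (i ↑ˡ m) (n ↑ʳ k) ≡ 0ℤ
    δ-↑ˡʳ zero    k = refl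
    δ-↑ˡʳ (suc i) k = δ-↑ˡʳ i k

    δ-↑ʳˡ : ∀ {n m} (k : Fin m) (i : Fin n) → δ (n ↑ʳ k) (i ↑ˡ m) ≡ 0ℤ
    δ-↑ʳˡ k zero    = refl
    δ-↑ʳˡ k (suc i) = δ-↑ʳˡ k i

  module _ {n m : ℕ} (G : Multigraph n m) where

    private
      V : Fin n → Fin (n ℕ.+ m)
      V i = i ↑ˡ m
      E : Fin m → Fin (n ℕ.+ m)
      E f = n ↑ʳ f

      eV-V : ∀ u i → lookup (eV G u) (V i) ≡ fromℤ (δ u i)
      eV-V u i = trans (lookup-basis (V u) (V i)) (cong fromℤ (δ-↑ˡ m u i))
      eV-E : ∀ u f → lookup (eV G u) (E f) ≡ fromℤ 0ℤ
      eV-E u f = trans (lookup-basis (V u) (E f)) (cong fromℤ (δ-↑ˡʳ u f))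
      eE-V : ∀ f i → lookup (eE G f) (V i) ≡ fromℤ 0ℤ
      eE-V f i = trans (lookup-basis (E f) (V i)) (cong fromℤ (δ-↑ʳˡ f i))
      eE-E : ∀ f k → lookup (eE G f) (E k) ≡ fromℤ (δ f k)
      eE-E f k = trans (lookup-basis (E f) (E k)) (cong fromℤ (δ-↑ʳ n f k))

    genVec : Gen n m → Vec ℚ (n ℕ.+ m)
    genVec (edge f)  = eE G f
    genVec (tilde f) = eV G (src G f) +ᵥ eV G (tgt G f) -ᵥ eE G f
    genVec (left f)  = eV G (src G f) -ᵥ eV G (tgt G f) +ᵥ eE G f
    genVec (right f) = eV G (tgt G f) -ᵥ eV G (src G f) +ᵥ eE G f
    genVec (node u)  = eV G u

    generator : ∀ g → Generator G (genVec g)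
    generator (edge f)  = edge f
    generator (tilde f) = tilde f
    generator (left f)  = left f
    generator (right f) = right f
    generator (node u)  = node u

    private
      coordinate : ∀ k (a : Fin n → ℤ) (b : Fin m → ℤ) →
        (∀ u → lookup (eV G u) k ≡ fromℤ (a u)) → (∀ f → lookup (eE G f) k ≡ fromℤ (b f)) →
        ∀ g → lookup (genVec g) k ≡ fromℤ (generatorValue G a b (generator g))
      coordinate k a b p q g = functional-value G a b (λ x → lookup x k)
        (lookup-zipWith ℚ._+_ k) (lookup-zipWith ℚ._-_ k) p q (generator g)

      genVec-V : ∀ g i → lookup (genVec g) (V i) ≡ fromℤ (genV G g i)
      genVec-V g i = trans
        (coordinate (V i) (λ u → δ u i) (λ _ → 0ℤ) (λ u → eV-V u i) (λ f → eE-V f i) g) (cong fromℤ (value g))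
        where
        value : ∀ g → generatorValue G (λ u → δ u i) (λ _ → 0ℤ) (generator g) ≡ genV G g i
        value (edge f)  = refl
        value (tilde f) = +-identityʳ (genV G (tilde f) i)
        value (left f)  = +-identityʳ (genV G (left f) i)
        value (right f) = +-identityʳ (genV G (right f) i)
        value (node u)  = refl

      genVec-E : ∀ g k → lookup (genVec g) (E k) ≡ fromℤ (genE G g k)
      genVec-E g k = trans
        (coordinate (E k) (λ _ → 0ℤ) (λ f → δ f k) (λ u → eV-E u k) (λ f → eE-E f k) g) (cong fromℤ (value g))
        where
        value : ∀ g → generatorValue G (λ _ → 0ℤ) (λ f → δ f k) (generator g) ≡ genE G g k
        value (edge f)  = refl
        value (tilde f) = +-identityˡ (- δ f k)
        value (left f)  = +-identityˡ (δ f k)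
        value (right f) = +-identityˡ (δ f k)
        value (node u)  = refl

      add-coordinate : ∀ (p q : Vec ℚ (n ℕ.+ m)) k c d {z} → lookup p k ≡ fromℤ d → lookup q k ≡ fromℤ c →
        z ≡ c + d → lookup (p +ᵥ q) k ≡ fromℤ z
      add-coordinate p q k c d e e′ refl = trans (lookup-zipWith ℚ._+_ k p q)
        (trans (cong₂ ℚ._+_ e e′) (trans (sym (fromℤ-+ d c)) (cong fromℤ (+-comm d c))))

      generators : ∀ {j x y} → GeneratorSum G j x y → Σ[ gs ∈ Vec (Vec ℚ (n ℕ.+ m)) j ] (All (Generator G) gs ×
        (∀ i → lookup (sumᵥ gs) (V i) ≡ fromℤ (x i)) × (∀ f → lookup (sumᵥ gs) (E f) ≡ fromℤ (y f)))
      generators (none p q) = [] , [] ,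
        (λ i → trans (lookup-replicate (V i) 0ℚ) (cong fromℤ (sym (p i)))) ,
        (λ f → trans (lookup-replicate (E f) 0ℚ) (cong fromℤ (sym (q f))))
      generators (add g {x′ = x′} {y′} p q c) with generators c
      ... | gs , gs∈ , vs , es = genVec g ∷ gs , generator g ∷ gs∈ ,
        (λ i → add-coordinate (genVec g) (sumᵥ gs) (V i) (x′ i) (genV G g i) (genVec-V g i) (vs i) (p i)) ,
        (λ f → add-coordinate (genVec g) (sumᵥ gs) (E f) (y′ f) (genE G g f) (genVec-E g f) (es f) (q f))

    points⇒lattice : Fin n → ∀ {j} (x : Vec ℤ n) (y : Vec ℤ m) →
      Points G j (x , y) → LatticePoint j (CosmologicalPolytope G) (x ++ y)
    points⇒lattice u {j} x y (f , eq) with generators (Feasible⇒GeneratorSum G j f eq)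
    ... | gs , gs∈ , vs , es = sum-of-generators (node u) gs gs∈ (++-ext
        (λ i → trans (vs i) (sym (trans (lookup-map (V i) fromℤ (x ++ y)) (cong fromℤ (lookup-++ˡ x y i)))))
        (λ f → trans (es f) (sym (trans (lookup-map (E f) fromℤ (x ++ y)) (cong fromℤ (lookup-++ʳ x y f))))))

    lattice-cardinality : Fin n → ∀ {j k} → HasCardinality (Points G j) k →
      HasCardinality (LatticePoint j (CosmologicalPolytope G)) k
    lattice-cardinality u {j} = card-image join split split-join (λ {z} _ → take++drop≡id n z)
      (λ {(x , y)} → points⇒lattice u {j} x y)
      (λ {z} p → lattice⇒points G {j} (Vec.take n z) (Vec.drop n z)
        (subst (LatticePoint j (CosmologicalPolytope G)) (sym (take++drop≡id n z)) p))
      where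
      join : Point n m → Vec ℤ (n ℕ.+ m)
      join (x , y) = x ++ y
      split : Vec ℤ (n ℕ.+ m) → Point n m
      split z = Vec.take n z , Vec.drop n z
      split-join : ∀ p → split (join p) ≡ p
      split-join (x , y) with ++-injective (Vec.take n (x ++ y)) x (take++drop≡id n (x ++ y))
      ... | p , q = cong₂ _,_ p q

    -- The standard basis vectors are all generators.
    dimension : ∀ {d} → n ℕ.+ m ≡ suc d → HasDimension (CosmologicalPolytope G) d
    dimension {d} eq = go (n ℕ.+ m) eq (CosmologicalPolytope G) members coordinate-sum′
      where
      members : ∀ k → CosmologicalPolytope G (basis k)
      members k = 1 , basis k ∷ [] , 1ℚ ∷ [] , gen ∷ [] , ℚ.≤ᵇ⇒≤ _ ∷ [] , refl , one
        where
        gen : Generator G (basis k)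
        gen with splitAt n k in e
        ... | inj₁ i = subst (Generator G ∘ basis) (splitAt⁻¹-↑ˡ e) (node i)
        ... | inj₂ f = subst (Generator G ∘ basis) (splitAt⁻¹-↑ʳ e) (edge f)
        one : combination (1ℚ ∷ []) (basis k ∷ []) ≡ basis k
        one = trans (combination-replicate 1ℚ (basis k ∷ []))
          (trans (*ᵥ-identity (basis k +ᵥ 0ᵥ)) (+ᵥ-0ᵥ (basis k)))
      coordinate-sum′ : ∀ {p} → CosmologicalPolytope G p → sumℚ p ≡ 1ℚ
      coordinate-sum′ = coordinate-sum G
      -- The length is generalised to `N` so that the equation can be matched. Of the polytope only
      -- two facts enter: it contains the standard basis and lies in the hyperplane of coordinate
      -- sum one. A point then serves as its own vector of affine coefficients.
      go : ∀ N → N ≡ suc d → (P : Vec ℚ N → Set) → (∀ k → P (basis k)) → (∀ {p} → P p → sumℚ p ≡ 1ℚ) → HasDimension P d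
      go .(suc d) refl P P-basis P-sum = tabulate basis , tabulate⁺ P-basis ,
        (λ cs _ e → trans (sym (combination-basis cs)) e) ,
        (λ y y∈ → y , P-sum y∈ , combination-basis y)

-- The h*-polynomial of the cosmological polytope

open import Data.Fin.Base using (zero)
open import Data.Integer.Base using (+_; -_; 1ℤ)
open import Data.Nat.Base using (suc; _+_)
open import Data.Product.Base using (_,_)
open import Relation.Binary.PropositionalEquality using (refl)
open DeletionContraction using (ehrhart)
open GeneratingFunctions using (≐-trans; ≐-sym; linear-poly^)
open LatticePoints using (dimension; lattice-cardinality)
open MöbiusInversion using (möbiusSum≐)

mainTheorem16 : (n m : ℕ) .{{_ : NonZero n}} (G : Multigraph n m)
    (μ : Subset m → Subset m → ℤ) → IsMöbius (bridgelessSubsets G) _⊆?_ μ →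
    IsHStar (CosmologicalPolytope G) (möbiusSum G μ)
mainTheorem16 (suc n) m G μ isMöbius with ehrhart G
-- With `suc n` nodes the dimension is `n + m`, so the exponent `suc (n + m)` of 1 - z in the
-- definition of h* is the one that `ehrhart` provides. The node `zero` supplies the point needed
-- for the dilate by 0.
... | L , cards , gf = n + m , L , dimension G refl ,
  (λ j → lattice-cardinality G zero {j} (cards j)) ,
  ≐-trans (linear-poly^ 1ℤ (- 1ℤ) (suc n + m) (λ j → + L j))
    (≐-trans gf (≐-sym (möbiusSum≐ G μ isMöbius)))
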